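{- Let $n\ge1$, let $(P,Q)\in\bigsqcup_{\rho,\lambda\in\mathbb S}\mathrm{SST}(\lambda/\rho,n)^2$ and let $(P',Q')=\mathbf{cRSK}(P,Q)$. If $\Upsilon_{\mathrm{col}}(P,Q)=(H_1,H_2,\kappa,\nu)$ with $H_1,H_2$ of shape $\mu$, then $$\Upsilon_{\mathrm{col}}(P',Q')=(H_1,H_2,\kappa+\mu,\nu).$$
   Context: NOTATION. $\mathbb N=\{0,1,\dots\}$. A signature of length $\ell\ge0$ is a sequence of integers $\lambda=(\lambda_1\ge\dots\ge\lambda_\ell)$; $\mathbb S_\ell$ is the set of these, $\mathbb S=\bigsqcup_{\ell\ge0}\mathbb S_\ell$. $\mathbb Y$ is the set of partitions; for $\mu\in\mathbb Y$, $\ell(\mu)$ is the number of positive parts. Conjugate: $\lambda'_x=\#\{j:\lambda_j\ge x\}$, $x\in\mathbb Z$. $\kappa\preceq\mu$ (same length) means $\mu_1\ge\kappa_1\ge\mu_2\ge\kappa_2\ge\cdots$, equivalently $\mu'_x-\kappa'_x\in\{0,1\}$ for all $x$. $\mathcal K(\mu)=\{\kappa\in\mathbb Z^{\ell(\mu)}:\kappa_i\ge\kappa_{i+1}\text{ if }\mu_i=\mu_{i+1}\}$. FOMIN FIELDS. For $\kappa\preceq\mu$, $\kappa\preceq\lambda$ in $\mathbb S_\ell$ put $a_x=\mu'_x-\kappa'_x$, $b_x=\lambda'_x-\kappa'_x$, $c_x=\max\{0,a_x+b_x+c_{x-1}-1\}$ with $c_x=0$ for $x\ll0$; $\overline{\mathsf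 F}(\kappa,\mu,\lambda)=\nu\in\mathbb S_\ell$ is given by $\nu'_x=\mu'_x+\lambda'_x-\kappa'_x+c_{x-1}-c_x$. $\mathscr C_n=\mathbb Z^2/\sim$, $(x,y)\sim(x+kn,y-kn)$, $k\in\mathbb Z$. A Fomin field is a map $\boldsymbol\lambda:\mathscr C_n\to\mathbb S_\ell$ with $\boldsymbol\lambda(p)\preceq\boldsymbol\lambda(p+\mathbf e_i)$ ($i=1,2$) and $\boldsymbol\lambda(p+\mathbf e_1+\mathbf e_2)=\overline{\mathsf F}(\boldsymbol\lambda(p),\boldsymbol\lambda(p+\mathbf e_1),\boldsymbol\lambda(p+\mathbf e_2))$. TABLEAUX. For $\rho,\lambda$ of the same length, $P\in\mathrm{SST}(\lambda/\rho,n)$ is a chain $\rho=\lambda^{(0)}\preceq\lambda^{(1)}\preceq\dots\preceq\lambda^{(n)}=\lambda$; equivalently a filling where cells $(j,k)$ (row $j$, column $k$) with $\lambda^{(i-1)}_j<k\le\lambda^{(i)}_j$ have label $i$. For $P=(\lambda^{(i)})_i$, $Q=(\mu^{(i)})_i$ in $\mathrm{SST}(\lambda/\rho,n)$, $\boldsymbol\lambda[P,Q]$ is the unique Fomin field on $\mathscr C_n$ with $\boldsymbol\lambda(i,0)=\lambda^{(i)}$, $\boldsymbol\lambda(0,i)=\mu^{(i)}$, $0\le i\le n$. With $\boldsymbol\lambda=\boldsymbol\lambda[P,Q]$ define the invertible maps $\mathbf{cRSK}(P,Q)=\big((\boldsymbol\lambda(n+i,0))_{i=0}^n,(\boldsymbol\lambda(n,i))_{i=0}^n\big)$,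 $\iota_1(P,Q)=\big((\boldsymbol\lambda(1+i,0))_{i=0}^n,(\boldsymbol\lambda(1,i))_{i=0}^n\big)$, $\iota_2(P,Q)=\big((\boldsymbol\lambda(i,1))_{i=0}^n,(\boldsymbol\lambda(0,1+i))_{i=0}^n\big)$. For $\mu\in\mathbb N^\ell$, $\mathrm{HWT}(\mu,n)$ is the set of fillings by $\{1,\dots,n\}$ of left-justified rows of lengths $\mu_1,\dots,\mu_\ell$, weakly increasing along rows, no column condition. Soliton data: $\Phi(P,Q)=(H_1,H_2)$, where row $j$ of $H_1$ has $\lim_{t\to\infty}(\boldsymbol\lambda_j(i,t)-\boldsymbol\lambda_j(i-1,t))$ entries $i$, and row $j$ of $H_2$ has $\lim_{t\to\infty}(\boldsymbol\lambda_j(t,i)-\boldsymbol\lambda_j(t,i-1))$ entries $i$ ($1\le i\le n$); $H_1,H_2$ have a common shape $\mu\in\mathbb Y$. KASHIWARA OPERATORS ON HWT. Write $H\in\mathrm{HWT}(\mu,n)$ as $h_\ell\otimes\cdots\otimes h_1$ with $h_j$ the $j$-th row. For $1\le i\le n-1$ take the word $w=h_\ell\cdots h_1$, replace each $i$ by ")" and each $i+1$ by "(", ignore other letters, and delete successively adjacent pairs "(" ")" until the remaining string is $)\cdots)(\cdots($. $e_i(H)$ changes the $i+1$ of the leftmost remaining "(" into $i$ ($e_i(H)=\mathbf 0$ if none); $f_i(H)$ changes the $i$ of the rightmost remaining ")" into $i+1$ ($\mathbf 0$ if none). For $i=0$ use the word obtained by reversing each $h_j$ before concatenating, with $n$ as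 ")" and $1$ as "("; $e_0$ changes a $1$ into $n$, $f_0$ changes an $n$ into $1$ by the same rule; rows are re-sorted. COMBINATORIAL $R$, ENERGY. For rows $a,b$ of lengths $K\le L$: place the letters of $a$ as dots in a right column of boxes $1,\dots,n$ (top to bottom), those of $b$ in a left column. Pair each right dot (any order) with the lowest unpaired left dot in a strictly higher box; if none exists, with the lowest unpaired left dot (a winding pair). Move the unpaired left dots to the same boxes of the right column; the right column is now $b'$, the left $a'$; $\mathcal R(a\otimes b)=b'\otimes a'$, $W(a\otimes b)$ = number of winding pairs. For $K>L$, $\mathcal R$ is the inverse of this map and $W(a\otimes b)=W(\mathcal R(a\otimes b))$. $\sigma_i$ applies $\mathcal R$ to the factors $h_{i+1}\otimes h_i$; $W_i(H)=W(h_{i+1}\otimes h_i)$. Energy $D(H)=\sum_{1\le i<j\le\ell}W_i(\sigma_{i+1}\sigma_{i+2}\cdots\sigma_{j-1}(H))$. Let $\sigma^-=(\sigma_1\cdots\sigma_{\ell-1})\cdots(\sigma_1\sigma_2)(\sigma_1)$; $\eta(H)$ is obtained from $\sigma^-(H)$ by reversing the order of the tensor factors and replacing each entry $j$ by $n+1-j$ (re-sorting rows). Dual energy $D'(H)=D(\eta(H))$. LEADING PATHS. Let $\ell(\mu)\le n$; $H_{\max}\in\mathrm{HWT}(\mu,n)$ has all entries $1$. The classical component of $H$ is its connected component under $e_i,f_i$, $1\le i\le n-1$; it contains a unique $H_{\mathrm{lw}}$ killed by all $f_i$, $1\le i\le n-1$; $\underline{H_{\mathrm{lw}}}$ is obtained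 by subtracting $\min(H_{\mathrm{lw}})-1$ from all entries, and lies in the same classical component. The leading path $\mathcal L_H$ is the composition of Kashiwara operators with $\mathcal L_H(H)=H_{\max}$ defined recursively: if $D'(H)=D'(H_{\max})$, it is a composition of $e_1,\dots,e_{n-1}$ taking $H$ to $H_{\max}$; otherwise $\mathcal L_H=\mathcal L_{H'}\circ e_0\circ\mathcal G_H$, where $\mathcal G_H$ is a composition of $e_i,f_i$ ($1\le i\le n-1$) taking $H$ to $\underline{H_{\mathrm{lw}}}$ and $H'=e_0(\underline{H_{\mathrm{lw}}})$. (For $n=1$ the path is empty.) OPERATORS ON PAIRS. For skew $P$, $e_i(P),f_i(P)$ ($1\le i\le n-1$) are given by the same signature rule applied to the row reading word (rows concatenated from bottom to top). On pairs: $E^{(1)}_i=e_i\times\mathbf 1$, $F^{(1)}_i=f_i\times\mathbf 1$, $E^{(2)}_i=\mathbf 1\times e_i$, $F^{(2)}_i=\mathbf 1\times f_i$ for $1\le i\le n-1$, and $E^{(k)}_0=\iota_k\circ E^{(k)}_1\circ\iota_k^{ -1}$, $F^{(k)}_0=\iota_k\circ F^{(k)}_1\circ\iota_k^{ -1}$. If $\Phi(P,Q)=(H_1,H_2)$, $\mathcal L_{P,Q}$ is the composition on pairs obtained from $\mathcal L_{H_1}$ (with $e_i,f_i$ replaced by $E_i^{(1)},F_i^{(1)}$) followed by $\mathcal L_{H_2}$ (with $E_i^{(2)},F_i^{(2)}$). KKR. A box-ball state is a finitely supported $B=(b_x)_{x\in\mathbb Z}\in\{0,1\}^{\mathbb Z}$.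 $\mathrm{KKR}(B)=(\mu,J)$, $J\in\mathcal K(\mu)$, is computed by scanning sites $k$ from the leftmost to the rightmost ball, starting with the empty pair. Vacancy numbers: $p^{[k]}_i=k-2\sum_j\min(\mu^{[k]}_j,i)$; string $s$ of $(\mu^{[k]},J^{[k]})$ is singular if $J^{[k]}_s=p^{[k]}_{\mu^{[k]}_s}$; a singular string of length $0$ is always available. If $b_k=0$, $(\mu^{[k]},J^{[k]})=(\mu^{[k-1]},J^{[k-1]})$; if $b_k=1$, take a longest singular string of $(\mu^{[k-1]},J^{[k-1]})$, increase its length by one and set its rigging to the vacancy number of its new length with respect to $\mu^{[k]}$ and $k$; other riggings are unchanged. Riggings of equal rows are listed in weakly decreasing order. THE MAP $\Upsilon_{\mathrm{col}}$. Given $(P,Q)$, let $(H_1,H_2)=\Phi(P,Q)$ of shape $\mu$, $n'=\max\{\ell(\mu),n\}$, and regard all tableaux as having entries in $\{1,\dots,n'\}$. Then $\mathcal L_{P,Q}(P,Q)=(T,T)$ (computed with alphabet $n'$), where $T=(\bar\rho\preceq\bar\lambda)$ has all labels $1$. Put $B=\bar\lambda'-\bar\rho'$, a box-ball state; let $\nu$ be the signature obtained from the multiset of entries of $\bar\rho$ by removing once each $j$ with $(b_j,b_{j+1})=(0,1)$; let $J$ be the rigging of $\mathrm{KKR}(B)=(\mu,J)$ and $\kappa=J+\mu$. Set $\Upsilon_{\mathrm{col}}(P,Q)=(H_1,H_2,\kappa,\nu)$. -}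

module Defs where

open import Data.Bool.Base using (Bool; true; false; if_then_else_; not; _∧_)
open import Data.Fin.Base using (Fin; toℕ)
open import Data.Integer.Base as ℤ using (ℤ; +_; 0ℤ; 1ℤ)
import Data.Integer.Properties as ℤₚ
open import Data.List.Base as List
  using (List; []; _∷_; _++_; length; concat; concatMap; replicate; upTo; downFrom; applyUpTo)
import Data.List.Properties as Listₚ
open import Data.List.Relation.Binary.Permutation.Propositional using (_↭_)
open import Data.List.Relation.Unary.All using (All)
open import Data.List.Relation.Unary.Linked using (Linked)
open import Data.Maybe.Base as Maybe using (Maybe; just; nothing)
open import Data.Nat.Base
open import Data.Nat.ListAction using (sum)
open import Data.Nat.Properties using (_≟_; _<?_; _≤?_; ≤-decTotalOrder; ≤-trans; m≤n⊔m)
open import Data.Product.Base using (Σ; ∃; ∃-syntax; _×_; _,_; proj₁; proj₂)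
open import Data.Product.Properties using (≡-dec)
open import Data.Vec.Base as Vec using (Vec)
open import Relation.Binary.PropositionalEquality using (_≡_; _≢_)
open import Relation.Nullary using (¬_; does)

open import Data.List.Sort.InsertionSort.Base ≤-decTotalOrder using (sort)

-- interval i j = i, i+1, …, j−1
interval : ℕ → ℕ → List ℕ
interval i j = applyUpTo (_+_ i) (j ∸ i)

record Sig (ℓ : ℕ) : Set where
  constructor sig
  field
    entries     : Vec ℤ ℓ
    .decreasing : ∀ (i j : Fin ℓ) → toℕ j ≡ suc (toℕ i) →
                  Vec.lookup entries j ℤ.≤ Vec.lookup entries i

open Sig public

_‼_ : ∀ {ℓ} → Sig ℓ → Fin ℓ → ℤ
α ‼ j = Vec.lookup (entries α) j

conj : ∀ {ℓ} → Sig ℓ → ℤ → ℕ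
conj α x = Vec.count (x ℤₚ.≤?_) (entries α)

multiplicity : ∀ {ℓ} → ℤ → Sig ℓ → ℕ
multiplicity x α = Vec.count (x ℤₚ.≟_) (entries α)

infix 4 _≼_
record _≼_ {ℓ} (κ μ : Sig ℓ) : Set where
  field
    lower : ∀ j → κ ‼ j ℤ.≤ μ ‼ j
    upper : ∀ i j → toℕ j ≡ suc (toℕ i) → μ ‼ j ℤ.≤ κ ‼ i

-- The number of cells of μ/κ in column x.
gap : ∀ {ℓ} → Sig ℓ → Sig ℓ → ℤ → ℤ
gap κ μ x = + conj μ x ℤ.- + conj κ x

-- FominRule κ μ α ν is the graph of the local rule: ν = F̄(κ, μ, α).  The
-- sequence c is determined by its recursion and its vanishing at −∞, and ν
-- by its conjugate.
record FominRule {ℓ} (κ μ α ν : Sig ℓ) : Set where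
  field
    c         : ℤ → ℤ
    vanishing : ∃[ x₀ ] ∀ x → x ℤ.≤ x₀ → c x ≡ 0ℤ
    recursion : ∀ x → c x ≡ 0ℤ ℤ.⊔ (gap κ μ x ℤ.+ gap κ α x ℤ.+ c (x ℤ.- 1ℤ) ℤ.- 1ℤ)
    conjugate : ∀ x → + conj ν x ≡
                + conj μ x ℤ.+ + conj α x ℤ.- + conj κ x ℤ.+ c (x ℤ.- 1ℤ) ℤ.- c x

-- A map on the cylinder 𝒞ₙ is a map on ℤ² invariant under (x, y) ↦ (x+kn, y−kn).
record FominField (n ℓ : ℕ) : Set where
  field
    at       : ℤ → ℤ → Sig ℓ
    periodic : ∀ k x y → at (x ℤ.+ k ℤ.* + n) (y ℤ.- k ℤ.* + n) ≡ at x y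
    growth₁  : ∀ x y → at x y ≼ at (x ℤ.+ 1ℤ) y
    growth₂  : ∀ x y → at x y ≼ at x (y ℤ.+ 1ℤ)
    local    : ∀ x y → FominRule (at x y) (at (x ℤ.+ 1ℤ) y) (at x (y ℤ.+ 1ℤ))
                                 (at (x ℤ.+ 1ℤ) (y ℤ.+ 1ℤ))

open FominField public using (at)

-- The chain is continued by the constant outer for indices i ≥ n, so that
-- regarding a tableau as one in a larger alphabet leaves the chain unchanged.
record SST {ℓ} (inner outer : Sig ℓ) (n : ℕ) : Set where
  field
    chain : ℕ → Sig ℓ
    start : chain 0 ≡ inner
    step  : ∀ i → chain i ≼ chain (suc i)
    stop  : ∀ i → n ≤ i → chain i ≡ outer

open SST public using (chain)

record Pair (n ℓ : ℕ) : Set where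
  constructor pair
  field
    {inner outer} : Sig ℓ
    P Q           : SST inner outer n

open Pair public

enlarge : ∀ {n m ℓ} → n ≤ m → Pair n ℓ → Pair m ℓ
enlarge n≤m (pair P Q) = pair (widen P) (widen Q)
  where
  widen : ∀ {α β} → SST α β _ → SST α β _
  widen S = record
    { chain = chain S ; start = SST.start S ; step = SST.step S
    ; stop  = λ i m≤i → SST.stop S i (≤-trans n≤m m≤i) }

-- Λ is the field 𝛌[P,Q].
Extends : ∀ {n ℓ} → FominField n ℓ → Pair n ℓ → Set
Extends {n} Λ X = ∀ i → i ≤ n →
  at Λ (+ i) 0ℤ ≡ chain (P X) i × at Λ 0ℤ (+ i) ≡ chain (Q X) i

-- The graphs of cRSK, ι₁ and ι₂.
cRSK ι₁ ι₂ : ∀ {n ℓ} → Pair n ℓ → Pair n ℓ → Set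
cRSK {n} {ℓ} X Y = Σ (FominField n ℓ) λ Λ → Extends Λ X × (∀ i → i ≤ n →
  chain (P Y) i ≡ at Λ (+ (n + i)) 0ℤ × chain (Q Y) i ≡ at Λ (+ n) (+ i))
ι₁ {n} {ℓ} X Y = Σ (FominField n ℓ) λ Λ → Extends Λ X × (∀ i → i ≤ n →
  chain (P Y) i ≡ at Λ (+ (1 + i)) 0ℤ × chain (Q Y) i ≡ at Λ 1ℤ (+ i))
ι₂ {n} {ℓ} X Y = Σ (FominField n ℓ) λ Λ → Extends Λ X × (∀ i → i ≤ n →
  chain (P Y) i ≡ at Λ (+ i) 1ℤ × chain (Q Y) i ≡ at Λ 0ℤ (+ (1 + i)))

Row Filling : Set
Row     = List ℕ
Filling = List Row        -- h₁ ∷ h₂ ∷ …, top row first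

-- Partitions are given by their positive parts, so ℓ(μ) = length μ.
record IsPartition (μ : List ℕ) : Set where
  field
    positive   : All (0 <_) μ
    decreasing : Linked _≥_ μ

record IsHWT (μ : List ℕ) (n : ℕ) (H : Filling) : Set where
  field
    shape      : List.map length H ≡ μ
    increasing : All (Linked _≤_) H
    bounded    : All (All (λ x → 1 ≤ x × x ≤ n)) H

H-max : Filling → Filling
H-max = List.map (List.map (λ _ → 1))

-- Row j counted from 0; empty below the last row.
rowAt : Filling → ℕ → Row
rowAt []      _       = []
rowAt (h ∷ _) zero    = h
rowAt (_ ∷ H) (suc j) = rowAt H j

occurrences : ℕ → Row → ℕ
occurrences i h = length (List.filter (i ≟_) h)

-- All ℓ rows of the skew tableau are listed, including the empty ones.
rows : ∀ {n ℓ} {α β : Sig ℓ} → SST α β n → Filling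
rows {n} S = List.tabulate λ j → concatMap
  (λ i → replicate ℤ.∣ chain S i ‼ j ℤ.- chain S (i ∸ 1) ‼ j ∣ i)
  (interval 1 (suc n))

-- The limit of an integer sequence, in the discrete topology of ℤ.
Limit : (ℕ → ℤ) → ℤ → Set
Limit u L = ∃[ T ] ∀ t → T ≤ t → u t ≡ L

record Φ {n ℓ} (X : Pair n ℓ) (μ : List ℕ) (H₁ H₂ : Filling) : Set where
  field
    field-of  : FominField n ℓ
    extends   : Extends field-of X
    partition : IsPartition μ
    short     : length μ ≤ ℓ
    hwt₁      : IsHWT μ n H₁
    hwt₂      : IsHWT μ n H₂
    limit₁    : ∀ (j : Fin ℓ) i → 1 ≤ i → i ≤ n →
                Limit (λ t → at field-of (+ i) (+ t) ‼ j ℤ.- at field-of (+ (i ∸ 1)) (+ t) ‼ j)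
                      (+ occurrences i (rowAt H₁ (toℕ j)))
    limit₂    : ∀ (j : Fin ℓ) i → 1 ≤ i → i ≤ n →
                Limit (λ t → at field-of (+ t) (+ i) ‼ j ℤ.- at field-of (+ t) (+ (i ∸ 1)) ‼ j)
                      (+ occurrences i (rowAt H₂ (toℕ j)))

data Kind : Set where
  e f : Kind

data Bracket : Set where
  ⟨ ⟩ : Bracket

-- The letters read as ")" and "(" by the operators of index i in alphabet n.
closing opening : (n i : ℕ) → ℕ
closing n zero    = n
closing n (suc i) = suc i
opening n i       = suc i

-- The brackets, with their positions in the word, that remain after deleting
-- adjacent pairs "(" ")".
unpaired : (n i : ℕ) → Row → List (ℕ × Bracket)
unpaired n i w = List.foldr push [] (List.zip (upTo (length w)) w)
  where
  open-at : ℕ → List (ℕ × Bracket) → List (ℕ × Bracket)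
  open-at p ((_ , ⟩) ∷ bs) = bs
  open-at p bs             = (p , ⟨) ∷ bs
  push : ℕ × ℕ → List (ℕ × Bracket) → List (ℕ × Bracket)
  push (p , x) bs =
    if does (x ≟ closing n i) then (p , ⟩) ∷ bs
    else if does (x ≟ opening n i) then open-at p bs
    else bs

openings closings : List (ℕ × Bracket) → List ℕ
openings = List.mapMaybe λ { (p , ⟨) → just p ; (_ , ⟩) → nothing }
closings = List.mapMaybe λ { (p , ⟩) → just p ; (_ , ⟨) → nothing }

replaceAt : ℕ → ℕ → Row → Row
replaceAt _       _ []      = []
replaceAt zero    y (_ ∷ w) = y ∷ w
replaceAt (suc p) y (x ∷ w) = x ∷ replaceAt p y w

actWord : Kind → (n i : ℕ) → Row → Maybe Row
actWord e n i w =
  Maybe.map (λ p → replaceAt p (closing n i) w) (List.head (openings (unpaired n i w)))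
actWord f n i w =
  Maybe.map (λ p → replaceAt p (opening n i) w) (List.last (closings (unpaired n i w)))

cut : List ℕ → Row → Filling
cut []       w = []
cut (k ∷ ks) w = List.take k w ∷ cut ks (List.drop k w)

orient : ℕ → Row → Row
orient zero    = List.reverse
orient (suc _) = λ h → h

-- eᵢ and fᵢ; nothing stands for 𝟎.
kashiwara : Kind → (n i : ℕ) → Filling → Maybe Filling
kashiwara k n i H = Maybe.map
  (λ w → List.reverse (List.map sort (cut (List.map length (List.reverse H)) w)))
  (actWord k n i (concatMap (orient i) (List.reverse H)))

Op Path : Set
Op   = Kind × ℕ
Path = List Op        -- a composition, its first factor to act listed first

run : ℕ → Path → Filling → Maybe Filling
run n []            H = just H
run n ((k , i) ∷ w) H = kashiwara k n i H Maybe.>>= run n w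

lowest : Row → ℕ
lowest = List.foldr _⊔_ 0

delete : ℕ → Row → Row
delete y []      = []
delete y (x ∷ b) = if does (x ≟ y) then b else x ∷ delete y b

-- Boxes are numbered from top to bottom, so strictly higher boxes carry strictly
-- smaller letters.  The result is the list of paired left dots, the list of
-- unpaired left dots, and the number of winding pairs.
pairing : (right left : Row) → Row × Row × ℕ
pairing []      b = [] , b , 0
pairing (x ∷ a) b with List.filter (_<? x) b
... | []           = let y = lowest b
                         (a′ , u , w) = pairing a (delete y b)
                     in y ∷ a′ , u , suc w
... | higher@(_ ∷ _) = let y = lowest higher
                           (a′ , u , w) = pairing a (delete y b)
                       in y ∷ a′ , u , w

-- For |a| ≤ |b|: the pair (b′ , a′) with 𝓡(a ⊗ b) = b′ ⊗ a′, and W(a ⊗ b).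
R≤ : (a b : Row) → (Row × Row) × ℕ
R≤ a b = let (a′ , u , w) = pairing a b in (sort (a ++ u) , sort a′) , w

increasingRows : (n k : ℕ) → List Row
increasingRows n zero    = [] ∷ []
increasingRows n (suc k) =
  List.filter (λ h → Listₚ.≡-dec _≟_ (sort h) h)
    (concatMap (λ x → List.map (x ∷_) (increasingRows n k)) (interval 1 (suc n)))

-- 𝓡 and W on a ⊗ b for rows with entries in {1,…,n}.  For |a| > |b| the
-- inverse of R≤ is found by search among the c ⊗ d with |c| = |b|, |d| = |a|;
-- the last clause of search is never reached, R≤ being a bijection.
combinatorialR : (n : ℕ) (a b : Row) → (Row × Row) × ℕ
combinatorialR n a b =
  if does (length a ≤? length b) then R≤ a b
  else search (List.cartesianProduct (increasingRows n (length b))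
                                     (increasingRows n (length a)))
  where
  search : List (Row × Row) → (Row × Row) × ℕ
  search ((c , d) ∷ cs) =
    if does (≡-dec (Listₚ.≡-dec _≟_) (Listₚ.≡-dec _≟_) (proj₁ (R≤ c d)) (a , b))
    then (c , d) , proj₂ (R≤ c d) else search cs
  search [] = (a , b) , 0

-- σᵢ and Wᵢ, 1 ≤ i < length H; the remaining clauses are junk values.
σ : (n i : ℕ) → Filling → Filling
σ n 1             (h₁ ∷ h₂ ∷ H) =
  let ((h₂′ , h₁′) , _) = combinatorialR n h₂ h₁ in h₁′ ∷ h₂′ ∷ H
σ n (suc (suc i)) (h ∷ H)       = h ∷ σ n (suc i) H
σ n _             H             = H

W : (n i : ℕ) → Filling → ℕ
W n 1             (h₁ ∷ h₂ ∷ H) = proj₂ (combinatorialR n h₂ h₁)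
W n (suc (suc i)) (h ∷ H)       = W n (suc i) H
W n _             H             = 0

-- σ* n (i₁ ∷ … ∷ iₖ ∷ []) = σ_{i₁} ∘ ⋯ ∘ σ_{iₖ}
σ* : ℕ → List ℕ → Filling → Filling
σ* n is H = List.foldr (σ n) H is

D : ℕ → Filling → ℕ
D n H = sum (concatMap
  (λ j → List.map (λ i → W n i (σ* n (interval (suc i) j) H)) (interval 1 j))
  (interval 1 (suc (length H))))

σ⁻ : ℕ → Filling → Filling
σ⁻ n H = σ* n (concatMap (λ m → interval 1 (suc m)) (List.map suc (downFrom (length H ∸ 1)))) H

η : ℕ → Filling → Filling
η n H = List.reverse (List.map (λ h → sort (List.map (suc n ∸_) h)) (σ⁻ n H))

D′ : ℕ → Filling → ℕ
D′ n H = D n (η n H)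

IsRaising IsClassical : ℕ → Op → Set
IsRaising   n (k , i) = k ≡ e × 1 ≤ i × i < n
IsClassical n (_ , i) = 1 ≤ i × i < n

minEntry : Filling → ℕ
minEntry H with concat H
... | []    = 1
... | x ∷ w = List.foldr _⊓_ x w

lowered : Filling → Filling
lowered H = List.map (List.map (_∸ (minEntry H ∸ 1))) H

-- The classical component of H consists of the fillings reached from H by
-- classical paths, eᵢ and fᵢ being mutually inverse.
record LowestWeight (n : ℕ) (H L : Filling) : Set where
  field
    path      : Path
    classical : All (IsClassical n) path
    connects  : run n path H ≡ just L
    killed    : ∀ i → 1 ≤ i → i < n → kashiwara f n i L ≡ nothing

-- LeadingPath n H w: the composition w is a possible choice of 𝓛_H.
data LeadingPath (n : ℕ) (H : Filling) : Path → Set where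
  base : ∀ {w} →
         D′ n H ≡ D′ n (H-max H) →
         All (IsRaising n) w →
         run n w H ≡ just (H-max H) →
         LeadingPath n H w
  next : ∀ {L g H′ w} →
         D′ n H ≢ D′ n (H-max H) →
         LowestWeight n H L →
         All (IsClassical n) g →
         run n g H ≡ just (lowered L) →
         kashiwara e n 0 (lowered L) ≡ just H′ →
         LeadingPath n H′ w →
         LeadingPath n H (g ++ (e , 0) ∷ w)

data Side : Set where
  ① ② : Side

ι : Side → ∀ {n ℓ} → Pair n ℓ → Pair n ℓ → Set
ι ① = ι₁
ι ② = ι₂

-- Equality of tableaux with possibly different types.
_≈_ : ∀ {n ℓ} {α β γ δ : Sig ℓ} → SST α β n → SST γ δ n → Set
S ≈ T = ∀ i → chain S i ≡ chain T i

-- The graph of eᵢ or fᵢ, 1 ≤ i ≤ n−1, on skew tableaux.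
OnTableau : ∀ {n ℓ} {α β γ δ : Sig ℓ} → Kind → ℕ → SST α β n → SST γ δ n → Set
OnTableau {n} {α = α} {γ = γ} k i S T =
  γ ≡ α × kashiwara k n i (rows S) ≡ just (rows T)

-- The graph of E⁽ˢ⁾ᵢ (k = e) or F⁽ˢ⁾ᵢ (k = f), first for 1 ≤ i ≤ n−1, then for all i.
OnComponent : Side → Kind → ℕ → ∀ {n ℓ} → Pair n ℓ → Pair n ℓ → Set
OnComponent ① k i X Y = OnTableau k i (P X) (P Y) × Q Y ≈ Q X
OnComponent ② k i X Y = P Y ≈ P X × OnTableau k i (Q X) (Q Y)

-- For i = 0, X₁ = ι⁻¹(X) and Y = ι(Y₁).
OnPair : Side → Kind → ℕ → ∀ {n ℓ} → Pair n ℓ → Pair n ℓ → Set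
OnPair s k zero      X Y = ∃[ X₁ ] ∃[ Y₁ ] ι s X₁ X × OnComponent s k 1 X₁ Y₁ × ι s Y₁ Y
OnPair s k i@(suc _) X Y = OnComponent s k i X Y

data RunOnPair (s : Side) {n ℓ} : Path → Pair n ℓ → Pair n ℓ → Set where
  []  : ∀ {X Y} → P X ≈ P Y → Q X ≈ Q Y → RunOnPair s [] X Y
  _∷_ : ∀ {k i w X Y Z} → OnPair s k i X Y → RunOnPair s w Y Z →
        RunOnPair s ((k , i) ∷ w) X Z

State : Set
State = ℤ → Bool

bit : Bool → ℕ
bit b = if b then 1 else 0

-- Strings (length , rigging), as a multiset.
RC : Set
RC = List (ℕ × ℤ)

vacancy : ℤ → List ℕ → ℕ → ℤ
vacancy k μ i = k ℤ.- + (2 * sum (List.map (_⊓ i) μ))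

Singular : ℤ → RC → ℕ × ℤ → Set
Singular k rc (s , j) = j ≡ vacancy k (List.map proj₁ rc) s

-- Reading the value of site k takes (μ^[k−1], J^[k−1]) to (μ^[k], J^[k]).
data Step (k : ℤ) : Bool → RC → RC → Set where
  empty  : ∀ {rc} → Step k false rc rc
  extend : ∀ {rc s j rest} →
           rc ↭ (s , j) ∷ rest →
           Singular (ℤ.pred k) rc (s , j) →
           All (λ t → Singular (ℤ.pred k) rc t → proj₁ t ≤ s) rest →
           Step k true rc ((suc s , vacancy k (suc s ∷ List.map proj₁ rest) (suc s)) ∷ rest)
  create : ∀ {rc} →
           All (λ t → ¬ Singular (ℤ.pred k) rc t) rc →
           Step k true rc ((1 , vacancy k (1 ∷ List.map proj₁ rc) 1) ∷ rc)

-- Empty sites change nothing, so the scan may start at any point left of all balls.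
data Scan (B : State) : ℤ → RC → Set where
  start : ∀ {k} → (∀ x → x ℤ.≤ k → B x ≡ false) → Scan B k []
  read  : ∀ {k rc rc′} → Scan B (ℤ.pred k) rc → Step k (B k) rc rc′ → Scan B k rc′

𝒦 : (μ : List ℕ) → Vec ℤ (length μ) → Set
𝒦 μ κ = ∀ i j → toℕ j ≡ suc (toℕ i) → List.lookup μ i ≡ List.lookup μ j →
        Vec.lookup κ j ℤ.≤ Vec.lookup κ i

record KKR (B : State) (μ : List ℕ) (J : Vec ℤ (length μ)) : Set where
  field
    partition : IsPartition μ
    ordered   : 𝒦 μ J
    {site}    : ℤ
    {rc}      : RC
    scan      : Scan B site rc
    finished  : ∀ x → site ℤ.< x → B x ≡ false
    result    : rc ↭ List.zip μ (Vec.toList J)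

translate : (μ : List ℕ) → Vec ℤ (length μ) → Vec ℤ (length μ)
translate μ κ = Vec.zipWith ℤ._+_ κ (Vec.map +_ (Vec.fromList μ))

-- The graph of Υ_col: Υ_col (P , Q) = (H₁ , H₂ , κ , ν), with H₁ and H₂ of shape μ.
-- Leading paths are not unique; 𝓛 n H is the one chosen for H in alphabet n.
record Υcol (𝓛 : ℕ → Filling → Path) {n ℓ : ℕ} (X : Pair n ℓ)
            (μ : List ℕ) (H₁ H₂ : Filling) (κ : Vec ℤ (length μ))
            {m : ℕ} (ν : Sig m) : Set where
  n′ : ℕ
  n′ = length μ ⊔ n
  field
    solitons : Φ X μ H₁ H₂
    leading₁ : LeadingPath n′ H₁ (𝓛 n′ H₁)
    leading₂ : LeadingPath n′ H₂ (𝓛 n′ H₂)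
    {Y Z}    : Pair n′ ℓ
    run₁     : RunOnPair ① (𝓛 n′ H₁) (enlarge (m≤n⊔m (length μ) n) X) Y
    run₂     : RunOnPair ② (𝓛 n′ H₂) Y Z
    -- Z = (T , T) with T = (inner Z ≼ outer Z) having all labels 1
    labels₁  : ∀ i → 1 ≤ i → chain (P Z) i ≡ outer Z
    labels₂  : ∀ i → 1 ≤ i → chain (Q Z) i ≡ outer Z
    B        : State
    balls    : ∀ x → conj (outer Z) x ≡ conj (inner Z) x + bit (B x)
    {J}      : Vec ℤ (length μ)
    kkr      : KKR B μ J
    riggings : κ ≡ translate μ J
    vacuum   : ∀ x → multiplicity x (inner Z) ≡
               multiplicity x ν + bit (not (B x) ∧ B (ℤ.suc x))

-- cRSK is computed by the local rule on the square [0,n]², and each leading path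
-- can be carried along the columns of the growth diagram.  In row coordinates,
-- counted from the bottom, the rule is ν k = min (κ (k + 1), μ k + α k − κ k + c k)
-- with a carry c running upwards.  If eᵢ raises row k₀ of the middle term of
-- κ₀ ≼ κ₁ ≼ κ₂, the extra unit is carried to the first row k₁ ≥ k₀ that is not
-- saturated; there it raises λ₁, by eᵢ again, while λ₂ is unchanged.  Operators
-- of index 0 are conjugates by shifts of the field, which commute with cRSK.
-- So the leading path of (P , Q) takes cRSK (P , Q) to cRSK (T , T), which is
-- given by λ̄ ≼ F̄ (ρ̄, λ̄, λ̄): one step of the box-ball system with a carrier of
-- infinite capacity.
--
-- For the riggings, scan both box-ball states at once.  The invariant is that
-- emptying the carrier after site k would turn the strings of the new state into
-- those of the old one, with every rigging raised by the length of its string.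
-- When the carrier loads a ball, one has to compare the words 1ᶜ and 0 1ᶜ⁺¹ read
-- from the same strings: the results differ in one string, which is longer by
-- one after the second word, and that string is a longest singular one.
module Submission where

open import Defs hiding ([]; _∷_; e; f; base; next; empty)
open import Data.Bool.Base using (Bool; true; false; if_then_else_; not; _∧_)
open import Data.Bool.Properties using (∧-zeroʳ)
open import Data.Fin.Base as Fin using (Fin; toℕ)
import Data.Fin.Properties as Fin
open import Data.Integer.Base as ℤ using (ℤ; +_; 0ℤ; 1ℤ; _+_; _-_; _*_; _⊓_; _⊔_)
import Data.Integer.Properties as ℤ
open import Data.Integer.Tactic.RingSolver using (solve)
open import Data.List.Base as List
  using (List; []; _∷_; _++_; length; concat; concatMap; zip; foldr; upTo; applyUpTo; applyDownFrom; reverse; replicate)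
open import Data.List.Membership.Propositional using (_∈_)
import Data.List.Membership.Propositional.Properties as ∈ₚ
import Data.List.Properties as List
open import Data.List.Relation.Binary.Permutation.Propositional as Perm
  using (_↭_; ↭-refl; ↭-sym; ↭-trans; ↭-reflexive)
import Data.List.Relation.Binary.Permutation.Propositional.Properties as ↭ₚ
open import Data.List.Relation.Unary.All as All using (All)
import Data.List.Relation.Unary.All.Properties as All
open import Data.List.Relation.Unary.AllPairs as AllPairs using (AllPairs)
import Data.List.Relation.Unary.AllPairs.Properties as AllPairs
open import Data.List.Relation.Unary.Any using (here; there)
open import Data.Maybe.Base as Maybe using (Maybe; just)
open import Data.Maybe.Properties using (just-injective)
open import Data.Nat.Base as ℕ using (ℕ; zero; suc; _≤_; _<_; z≤n; s≤s; _∸_; pred)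
open import Data.Nat.ListAction using (sum)
open import Data.Nat.ListAction.Properties using (sum-↭)
import Data.Nat.Properties as ℕ
open import Data.Product.Base using (Σ; ∃-syntax; _×_; _,_; proj₁; proj₂)
open import Data.Sum.Base using (_⊎_; inj₁; inj₂)
open import Data.Vec.Base as Vec using (Vec)
open import Function.Base using (_∘_; case_of_)
open import Relation.Binary.Definitions using (tri<; tri≈; tri>)
open import Relation.Binary.PropositionalEquality
open import Relation.Nullary using (Dec; yes; no; does; contradiction; ¬_; recompute)
open import Relation.Nullary.Decidable using (dec-true; dec-false)

open import Data.List.Sort.InsertionSort.Base ℕ.≤-decTotalOrder using (sort; insert)
open import Data.List.Sort.InsertionSort.Properties ℕ.≤-decTotalOrder using (sort-↭)

-- Integers and row coordinates

-- Every map is given by its graph, so each operator applied after `cRSK` has to come with a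
-- witness, and for index 0 the witness contains two fields on the cylinder. No such field is ever
-- built: the operator on the original pair supplies both, uniqueness of growth shows that they
-- carry the images as well, n steps further on, and `shift` moves the origin there. The cylinder is
-- left behind in `Forward`, because the alphabet of the leading paths has another period than the
-- given field; chains that stay constant after n give one and the same growth diagram for both. The
-- local rule is defined by a sequence over columns, whereas an operator changes a single row. The
-- bridge is `potential`: the carry at column x is a sum over rows of parts clipped at x, and at x =
-- κ k it is the carry into row k. Only e is analysed row by row; f follows from the uniqueness of
-- cells.

≤-by : ∀ {a b e} → 0ℤ ℤ.≤ e → b - a ≡ e → a ℤ.≤ b
≤-by {a} {b} h eq = ℤ.0≤i-j⇒j≤i (subst (0ℤ ℤ.≤_) (sym eq) h)

-- Linear arithmetic throughout has this shape: `Δ` turns hypotheses into nonnegative differences,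
-- `⊕` adds them, and the ring solver identifies the sum with the difference in the goal of `≤-by`.
Δ : ∀ {a b} → a ℤ.≤ b → 0ℤ ℤ.≤ b - a
Δ = ℤ.i≤j⇒0≤j-i

infixl 6 _⊕_
_⊕_ : ∀ {a b} → 0ℤ ℤ.≤ a → 0ℤ ℤ.≤ b → 0ℤ ℤ.≤ a + b
_⊕_ = ℤ.+-mono-≤

0≤1 : 0ℤ ℤ.≤ 1ℤ
0≤1 = ℤ.+≤+ z≤n

1≰0 : ¬ (1ℤ ℤ.≤ 0ℤ)
1≰0 (ℤ.+≤+ ())

≤-or-> : ∀ x y → x ℤ.≤ y ⊎ y + 1ℤ ℤ.≤ x
≤-or-> x y with x ℤ.≤? y
... | yes p = inj₁ p
... | no ¬p = inj₂ (subst (ℤ._≤ x) (ℤ.+-comm 1ℤ y) (ℤ.i<j⇒suc[i]≤j (ℤ.≰⇒> ¬p)))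

≤-not-> : ∀ {x y} → x ℤ.≤ y → ¬ (y + 1ℤ ℤ.≤ x)
≤-not-> {x} {y} p q = 1≰0 (≤-by (Δ p ⊕ Δ q) (solve (x ∷ y ∷ [])))

x≤x+1 : ∀ x → x ℤ.≤ x + 1ℤ
x≤x+1 x = ≤-by 0≤1 (solve (x ∷ []))

x-1≤x : ∀ x → x - 1ℤ ℤ.≤ x
x-1≤x x = ≤-by 0≤1 (solve (x ∷ []))

weaken : ∀ {x y} → x + 1ℤ ℤ.≤ y → x ℤ.≤ y
weaken {x} = ℤ.≤-trans (x≤x+1 x)

-- Carry sequences are fixed by a recursion and by vanishing near minus infinity; this is the
-- matching induction.
from-bound : ∀ {p} (R : ℤ → Set p) b → (∀ x → x ℤ.≤ b → R x) →
             (∀ x → R (x - 1ℤ) → R x) → ∀ x → R x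
from-bound R b base step x with ≤-or-> x b
... | inj₁ x≤b = base x x≤b
... | inj₂ b<x = subst R x≡ (up ℤ.∣ x - b ∣)
  where
  up : ∀ n → R (b + + n)
  up zero    = base _ (ℤ.≤-reflexive (ℤ.+-identityʳ b))
  up (suc n) = step _ (subst R (lem b (+ n)) (up n))
    where
    lem : ∀ b n → b + n ≡ b + (1ℤ + n) - 1ℤ
    lem b n = solve (b ∷ n ∷ [])
  lem′ : ∀ b x → b + (x - b) ≡ x
  lem′ b x = solve (b ∷ x ∷ [])
  x≡ : b + + ℤ.∣ x - b ∣ ≡ x
  x≡ = trans (cong (λ z → b + z) (ℤ.0≤i⇒+∣i∣≡i (Δ (weaken b<x)))) (lem′ b x)

sumTo : (ℕ → ℤ) → ℕ → ℤ
sumTo f zero    = 0ℤ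
sumTo f (suc k) = sumTo f k + f k

sumTo-cong : ∀ {f g} k → (∀ m → m < k → f m ≡ g m) → sumTo f k ≡ sumTo g k
sumTo-cong zero    eq = refl
sumTo-cong (suc k) eq =
  cong₂ _+_ (sumTo-cong k (λ m m<k → eq m (ℕ.m<n⇒m<1+n m<k))) (eq k ℕ.≤-refl)

sumTo-truncate : ∀ f k l → k ≤ l → (∀ m → k ≤ m → m < l → f m ≡ 0ℤ) → sumTo f l ≡ sumTo f k
sumTo-truncate f k l k≤l z with ℕ.m≤n⇒m<n∨m≡n k≤l
... | inj₂ refl = refl
sumTo-truncate f k (suc l) _ z | inj₁ (s≤s k≤l) =
  trans (cong₂ _+_ (sumTo-truncate f k l k≤l (λ m k≤m m<l → z m k≤m (ℕ.m<n⇒m<1+n m<l)))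
                   (z l k≤l ℕ.≤-refl))
        (ℤ.+-identityʳ _)

sumTo-nonneg : ∀ f k → (∀ m → m < k → 0ℤ ℤ.≤ f m) → 0ℤ ℤ.≤ sumTo f k
sumTo-nonneg f zero    h = ℤ.≤-refl
sumTo-nonneg f (suc k) h = sumTo-nonneg f k (λ m m<k → h m (ℕ.m<n⇒m<1+n m<k)) ⊕ h k ℕ.≤-refl

ind : ℤ → ℤ → ℤ
ind x y = if does (x ℤ.≤? y) then 1ℤ else 0ℤ

ind-≤ : ∀ {x y} → x ℤ.≤ y → ind x y ≡ 1ℤ
ind-≤ {x} {y} p rewrite dec-true (x ℤ.≤? y) p = refl

ind-> : ∀ {x y} → y + 1ℤ ℤ.≤ x → ind x y ≡ 0ℤ
ind-> {x} {y} p rewrite dec-false (x ℤ.≤? y) (λ q → ≤-not-> q p) = refl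

ind-≥0 : ∀ x y → 0ℤ ℤ.≤ ind x y
ind-≥0 x y with does (x ℤ.≤? y)
... | true  = 0≤1
... | false = ℤ.≤-refl

ind-mono : ∀ x {y z} → y ℤ.≤ z → ind x y ℤ.≤ ind x z
ind-mono x {y} {z} y≤z with ≤-or-> x y
... | inj₁ p = ℤ.≤-reflexive (trans (ind-≤ p) (sym (ind-≤ (ℤ.≤-trans p y≤z))))
... | inj₂ p = subst (ℤ._≤ ind x z) (sym (ind-> p)) (ind-≥0 x z)

-- As a function of `x`, `x ⊓ y` is the discrete antiderivative of the indicator of `x ≤ y`. Summed
-- over rows, this turns column counts into clipped parts.
⊓-step : ∀ x y → x ⊓ y ≡ (x - 1ℤ) ⊓ y + ind x y
⊓-step x y with ≤-or-> x y
... | inj₁ p = begin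
  x ⊓ y                       ≡⟨ ℤ.i≤j⇒i⊓j≡i p ⟩
  x                           ≡⟨ solve (x ∷ []) ⟩
  x - 1ℤ + 1ℤ                 ≡⟨ cong₂ _+_ (ℤ.i≤j⇒i⊓j≡i (ℤ.≤-trans (x-1≤x x) p)) (ind-≤ p) ⟨
  (x - 1ℤ) ⊓ y + ind x y      ∎
  where open ≡-Reasoning
... | inj₂ p = begin
  x ⊓ y                       ≡⟨ ℤ.i≥j⇒i⊓j≡j (weaken p) ⟩
  y                           ≡⟨ solve (y ∷ []) ⟩
  y + 0ℤ                      ≡⟨ cong₂ _+_ (ℤ.i≥j⇒i⊓j≡j y≤x-1) (ind-> p) ⟨
  (x - 1ℤ) ⊓ y + ind x y      ∎
  where
  open ≡-Reasoning
  y≤x-1 : y ℤ.≤ x - 1ℤ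
  y≤x-1 = ≤-by (Δ p) (solve (x ∷ y ∷ []))

countTo : (ℕ → ℤ) → ℕ → ℤ → ℤ
countTo f l x = sumTo (λ k → ind x (f k)) l

countTo-lower : ∀ f l k x → k ≤ l → (∀ m → k ≤ m → m < l → x ℤ.≤ f m) →
                + l - + k ℤ.≤ countTo f l x
countTo-lower f l k x k≤l h with ℕ.m≤n⇒m<n∨m≡n k≤l
... | inj₂ refl = subst (ℤ._≤ countTo f l x) (sym (ℤ.+-inverseʳ (+ l))) (sumTo-nonneg (λ m → ind x (f m)) l λ m _ → ind-≥0 x (f m))
countTo-lower f (suc l) k x _ h | inj₁ (s≤s k≤l) = lem (+ l) (+ k) _ _
  (countTo-lower f l k x k≤l λ m k≤m m<l → h m k≤m (ℕ.m<n⇒m<1+n m<l))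
  (ind-≤ (h l k≤l ℕ.≤-refl))
  where
  lem : ∀ a b c d → a - b ℤ.≤ c → d ≡ 1ℤ → 1ℤ + a - b ℤ.≤ c + d
  lem a b c _ p refl = ≤-by (Δ p) (solve (a ∷ b ∷ c ∷ []))

countTo-upper : ∀ f l k x → k ≤ l → (∀ m → m < k → f m + 1ℤ ℤ.≤ x) →
                countTo f l x ℤ.≤ + l - + k
countTo-upper f l k x k≤l h with ℕ.m≤n⇒m<n∨m≡n k≤l
... | inj₂ refl = ℤ.≤-reflexive (trans {j = 0ℤ}
  (sumTo-truncate (λ m → ind x (f m)) 0 l z≤n λ m _ m<l → ind-> (h m m<l)) (sym (ℤ.+-inverseʳ (+ l))))
countTo-upper f (suc l) k x _ h | inj₁ (s≤s k≤l) = lem (+ l) (+ k) _ _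
  (countTo-upper f l k x k≤l h) (ind≤1 x (f l))
  where
  lem : ∀ a b c d → c ℤ.≤ a - b → d ℤ.≤ 1ℤ → c + d ℤ.≤ 1ℤ + a - b
  lem a b c d p q = ≤-by (Δ p ⊕ Δ q) (solve (a ∷ b ∷ c ∷ d ∷ []))
  ind≤1 : ∀ x y → ind x y ℤ.≤ 1ℤ
  ind≤1 x y with does (x ℤ.≤? y)
  ... | true  = ℤ.≤-refl
  ... | false = 0≤1

countTo-mono : ∀ {f g} l x → (∀ m → m < l → f m ℤ.≤ g m) → countTo f l x ℤ.≤ countTo g l x
countTo-mono zero    x h = ℤ.≤-refl
countTo-mono (suc l) x h = ℤ.+-mono-≤
  (countTo-mono l x λ m m<l → h m (ℕ.m<n⇒m<1+n m<l)) (ind-mono x (h l ℕ.≤-refl))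

record Interlaced (l : ℕ) (f g : ℕ → ℤ) : Set where
  field
    below : ∀ k → k < l → f k ℤ.≤ g k
    above : ∀ k → suc k < l → g k ℤ.≤ f (suc k)

Increasing : ℕ → (ℕ → ℤ) → Set
Increasing l f = ∀ k → suc k < l → f k ℤ.≤ f (suc k)

increasing-≤ : ∀ {l f} → Increasing l f → ∀ {j k} → j ≤ k → k < l → f j ℤ.≤ f k
increasing-≤ inc {j} {k} j≤k k<l with ℕ.m≤n⇒m<n∨m≡n j≤k
... | inj₂ refl = ℤ.≤-refl
increasing-≤ inc {j} {suc k} _ k<l | inj₁ (s≤s j≤k) =
  ℤ.≤-trans (increasing-≤ inc j≤k (ℕ.<-trans ℕ.≤-refl k<l)) (inc k k<l)

lowerBound : ∀ (f : ℕ → ℤ) l → ∃[ b ] ∀ k → k < l → b ℤ.≤ f k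
lowerBound f zero    = 0ℤ , λ _ ()
lowerBound f (suc l) with b , h ← lowerBound f l = b ⊓ f l , bound
  where
  bound : ∀ k → k < suc l → b ⊓ f l ℤ.≤ f k
  bound k (s≤s k≤l) with ℕ.m≤n⇒m<n∨m≡n k≤l
  ... | inj₁ k<l  = ℤ.≤-trans (ℤ.i⊓j≤i b (f l)) (h k k<l)
  ... | inj₂ refl = ℤ.i⊓j≤j b (f l)

upperBound : ∀ (f : ℕ → ℤ) l → ∃[ b ] ∀ k → k < l → f k ℤ.≤ b
upperBound f zero    = 0ℤ , λ _ ()
upperBound f (suc l) with b , h ← upperBound f l = b ⊔ f l , bound
  where
  bound : ∀ k → k < suc l → f k ℤ.≤ b ⊔ f l
  bound k (s≤s k≤l) with ℕ.m≤n⇒m<n∨m≡n k≤l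
  ... | inj₁ k<l  = ℤ.≤-trans (h k k<l) (ℤ.i≤i⊔j b (f l))
  ... | inj₂ refl = ℤ.i≤j⊔i b (f l)

-- What the rows below k hand on: cells that μ and α add to κ there and that ν does not keep. In
-- these terms the minimum in `RowRule` becomes two bounds, `capped` and `nonneg` at k + 1, one of
-- which is attained by `tight`; the top row has no cap, whence `total`.
carry : (κ μ α ν : ℕ → ℤ) → ℕ → ℤ
carry κ μ α ν = sumTo λ k → μ k + α k - κ k - ν k

-- The local rule in row coordinates, rows being counted from the bottom:
-- ν k = min (κ (k + 1), μ k + α k − κ k + carry k).
record RowRule (l : ℕ) (κ μ α ν : ℕ → ℤ) : Set where
  field
    nonneg : ∀ k → k ≤ l → 0ℤ ℤ.≤ carry κ μ α ν k
    total  : carry κ μ α ν l ≡ 0ℤ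
    capped : ∀ k → suc k < l → ν k ℤ.≤ κ (suc k)
    tight  : ∀ k → suc k < l → ν k ≡ κ (suc k) ⊎ carry κ μ α ν (suc k) ≡ 0ℤ

interlaced-↑ˡ : ∀ {l f g} → Interlaced l f g → Increasing l f
interlaced-↑ˡ fg k k<l = ℤ.≤-trans (below fg k (ℕ.<⇒≤ k<l)) (above fg k k<l)
  where open Interlaced

interlaced-↑ʳ : ∀ {l f g} → Interlaced l f g → Increasing l g
interlaced-↑ʳ fg k k<l = ℤ.≤-trans (above fg k k<l) (below fg (suc k) k<l)
  where open Interlaced

-- The local rule in row coordinates

-- Still Fomin's rule by columns, but for functions on rows: `countTo f l` is the conjugate of `f`.
record Rule (l : ℕ) (κ μ α ν : ℕ → ℤ) (c : ℤ → ℤ) : Set where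
  field
    vanishing : ∃[ x₀ ] ∀ x → x ℤ.≤ x₀ → c x ≡ 0ℤ
    recursion : ∀ x → c x ≡ 0ℤ ⊔ (countTo μ l x - countTo κ l x + (countTo α l x - countTo κ l x)
                                  + c (x - 1ℤ) - 1ℤ)
    conjugate : ∀ x → countTo ν l x ≡
                countTo μ l x + countTo α l x - countTo κ l x + c (x - 1ℤ) - c x

zone : ∀ f l → Increasing l f → ∀ x →
       ∃[ k ] k ≤ l × (∀ m → m < k → f m + 1ℤ ℤ.≤ x) × (∀ m → k ≤ m → m < l → x ℤ.≤ f m)
zone f zero    inc x = 0 , z≤n , (λ _ ()) , λ _ _ ()
zone f (suc l) inc x with zone f l (λ k p → inc k (ℕ.m<n⇒m<1+n p)) x
... | k , k≤l , lo , hi with ≤-or-> x (f l)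
...   | inj₁ p = k , ℕ.m≤n⇒m≤1+n k≤l , lo , hi′
  where
  hi′ : ∀ m → k ≤ m → m < suc l → x ℤ.≤ f m
  hi′ m k≤m (s≤s m≤l) with ℕ.m≤n⇒m<n∨m≡n m≤l
  ... | inj₁ m<l  = hi m k≤m m<l
  ... | inj₂ refl = p
...   | inj₂ p = suc l , ℕ.≤-refl , lo′ , λ m l<m m≤l → contradiction l<m (ℕ.<⇒≱ m≤l)
  where
  lo′ : ∀ m → m < suc l → f m + 1ℤ ℤ.≤ x
  lo′ m (s≤s m≤l) =
    ℤ.≤-trans (ℤ.+-monoˡ-≤ 1ℤ (increasing-≤ inc m≤l ℕ.≤-refl)) p

-- If `x ≤ m` or `x ≤ a`, that clipped term cancels `x ⊓ ν = x` and the other one is at least κ.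
-- Otherwise nothing but ν is clipped, and clipping ν only enlarges the full sum.
clipped-nonneg : ∀ C x m a κ ν → 0ℤ ℤ.≤ C → κ ℤ.≤ x → κ ℤ.≤ m → κ ℤ.≤ a → x ℤ.≤ ν →
  0ℤ ℤ.≤ C + (m + a - κ - ν) → 0ℤ ℤ.≤ C + (x ⊓ m + x ⊓ a - x ⊓ κ - x ⊓ ν)
clipped-nonneg C x m a κ ν C≥0 κ≤x κ≤m κ≤a x≤ν C′≥0 =
  subst (λ z → 0ℤ ℤ.≤ C + z)
    (cong₂ (λ y z → x ⊓ m + x ⊓ a - y - z) (sym (ℤ.i≥j⇒i⊓j≡j κ≤x)) (sym (ℤ.i≤j⇒i⊓j≡i x≤ν)))
    (go (≤-or-> x m) (≤-or-> x a))
  where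
  lem₁ : ∀ C x a κ → 0ℤ ℤ.≤ C → κ ℤ.≤ a → 0ℤ ℤ.≤ C + (x + a - κ - x)
  lem₁ C x a κ p q = ≤-by (p ⊕ Δ q) (solve (C ∷ x ∷ a ∷ κ ∷ []))
  lem₂ : ∀ C x a κ → 0ℤ ℤ.≤ C → κ ℤ.≤ a → 0ℤ ℤ.≤ C + (a + x - κ - x)
  lem₂ C x a κ p q = ≤-by (p ⊕ Δ q) (solve (C ∷ x ∷ a ∷ κ ∷ []))
  lem₃ : ∀ C x m a κ ν → 0ℤ ℤ.≤ C + (m + a - κ - ν) → x ℤ.≤ ν → 0ℤ ℤ.≤ C + (m + a - κ - x)
  lem₃ C x m a κ ν p q = ≤-by (p ⊕ Δ q) (solve (C ∷ x ∷ m ∷ a ∷ κ ∷ ν ∷ []))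
  go : x ℤ.≤ m ⊎ m + 1ℤ ℤ.≤ x → x ℤ.≤ a ⊎ a + 1ℤ ℤ.≤ x → 0ℤ ℤ.≤ C + (x ⊓ m + x ⊓ a - κ - x)
  go (inj₁ p) _ = subst (λ z → 0ℤ ℤ.≤ C + (z + x ⊓ a - κ - x)) (sym (ℤ.i≤j⇒i⊓j≡i p))
    (lem₁ C x (x ⊓ a) κ C≥0 (ℤ.⊓-glb κ≤x κ≤a))
  go (inj₂ _) (inj₁ p) = subst (λ z → 0ℤ ℤ.≤ C + (x ⊓ m + z - κ - x)) (sym (ℤ.i≤j⇒i⊓j≡i p))
    (lem₂ C x (x ⊓ m) κ C≥0 (ℤ.⊓-glb κ≤x κ≤m))
  go (inj₂ p) (inj₂ q) = subst (λ z → 0ℤ ℤ.≤ C + (z - κ - x))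
    (cong₂ _+_ (sym (ℤ.i≥j⇒i⊓j≡j (weaken p))) (sym (ℤ.i≥j⇒i⊓j≡j (weaken q))))
    (lem₃ C x m a κ ν C′≥0 x≤ν)

module Potential (l : ℕ) (κ μ α ν : ℕ → ℤ) where

  cell : ℤ → ℕ → ℤ
  cell x k = x ⊓ μ k + x ⊓ α k - x ⊓ κ k - x ⊓ ν k

  -- The closed form of the sequence c. By `conjugate`, c x - c (x - 1) is the count of μ and α
  -- minus that of κ and ν in column x; summed over all columns up to x, each row contributes its
  -- clipped parts.
  potential : ℤ → ℤ
  potential x = sumTo (cell x) l

  potential-step : ∀ x → potential x ≡
    potential (x - 1ℤ) + (countTo μ l x + countTo α l x - countTo κ l x - countTo ν l x)
  potential-step x = go l
    where
    go : ∀ k → sumTo (cell x) k ≡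
      sumTo (cell (x - 1ℤ)) k + (countTo μ k x + countTo α k x - countTo κ k x - countTo ν k x)
    go zero    = refl
    go (suc k)
      rewrite go k | ⊓-step x (μ k) | ⊓-step x (α k) | ⊓-step x (κ k) | ⊓-step x (ν k) =
      lem (sumTo (cell (x - 1ℤ)) k) (countTo μ k x) (countTo α k x) (countTo κ k x) (countTo ν k x)
          ((x - 1ℤ) ⊓ μ k) ((x - 1ℤ) ⊓ α k) ((x - 1ℤ) ⊓ κ k) ((x - 1ℤ) ⊓ ν k)
          (ind x (μ k)) (ind x (α k)) (ind x (κ k)) (ind x (ν k))
      where
      lem : ∀ s a b c d a′ b′ c′ d′ i j k l →
        s + (a + b - c - d) + (a′ + i + (b′ + j) - (c′ + k) - (d′ + l)) ≡
        s + (a′ + b′ - c′ - d′) + (a + i + (b + j) - (c + k) - (d + l))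
      lem s a b c d a′ b′ c′ d′ i j k l =
        solve (s ∷ a ∷ b ∷ c ∷ d ∷ a′ ∷ b′ ∷ c′ ∷ d′ ∷ i ∷ j ∷ k ∷ l ∷ [])

  cell-full : ∀ {x} k → κ k ℤ.≤ x → μ k ℤ.≤ x → α k ℤ.≤ x → ν k ℤ.≤ x →
              cell x k ≡ μ k + α k - κ k - ν k
  cell-full k p q r s
    rewrite ℤ.i≥j⇒i⊓j≡j p | ℤ.i≥j⇒i⊓j≡j q | ℤ.i≥j⇒i⊓j≡j r | ℤ.i≥j⇒i⊓j≡j s = refl

  cell-empty : ∀ {x} k → x ℤ.≤ κ k → x ℤ.≤ μ k → x ℤ.≤ α k → x ℤ.≤ ν k → cell x k ≡ 0ℤ
  cell-empty {x} k p q r s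
    rewrite ℤ.i≤j⇒i⊓j≡i p | ℤ.i≤j⇒i⊓j≡i q | ℤ.i≤j⇒i⊓j≡i r | ℤ.i≤j⇒i⊓j≡i s = solve (x ∷ [])

module Local (l : ℕ) (κ μ α ν : ℕ → ℤ) 
             (κμ : Interlaced l κ μ) (κα : Interlaced l κ α) (μν : Interlaced l μ ν) (αν : Interlaced l α ν) where

  open Potential l κ μ α ν public
  open Interlaced

  κ↑ : Increasing l κ
  κ↑ = interlaced-↑ˡ κμ

  ν↑ : Increasing l ν
  ν↑ = interlaced-↑ʳ μν

  κ≤ν : ∀ k → k < l → κ k ℤ.≤ ν k
  κ≤ν k k<l = ℤ.≤-trans (below κμ k k<l) (below μν k k<l)

  empty-above : ∀ x k → (∀ m → k ≤ m → m < l → x ℤ.≤ κ m) → ∀ m → k ≤ m → m < l → cell x m ≡ 0ℤ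
  empty-above x k h m k≤m m<l = cell-empty m p (ℤ.≤-trans p (below κμ m m<l))
    (ℤ.≤-trans p (below κα m m<l)) (ℤ.≤-trans p (κ≤ν m m<l))
    where
    p : x ℤ.≤ κ m
    p = h m k≤m m<l

  -- Below row k all four parts are at most κ k, by interlacing and the cap, so clipping at
  -- `x ≥ κ k` does nothing.
  full-below : (∀ k → suc k < l → ν k ℤ.≤ κ (suc k)) →
               ∀ x k → k < l → κ k ℤ.≤ x → sumTo (cell x) k ≡ carry κ μ α ν k
  full-below cap x k k<l κ≤x = sumTo-cong k λ m m<k →
    let sm<l = ℕ.≤-<-trans m<k k<l
        κm≤x = ℤ.≤-trans (increasing-≤ κ↑ m<k k<l) κ≤x
    in cell-full m (ℤ.≤-trans (κ↑ m sm<l) κm≤x) (ℤ.≤-trans (above κμ m sm<l) κm≤x)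
         (ℤ.≤-trans (above κα m sm<l) κm≤x) (ℤ.≤-trans (cap m sm<l) κm≤x)

  module FromRule (c : ℤ → ℤ) (R : Rule l κ μ α ν c) where

    open Rule R

    closed : ∀ x → c x ≡ potential x
    closed = from-bound _ (x₁ ⊓ b) small step
      where
      x₁ = proj₁ vanishing
      b  = proj₁ (lowerBound κ l)
      small : ∀ x → x ℤ.≤ x₁ ⊓ b → c x ≡ potential x
      small x p = trans (proj₂ vanishing x (ℤ.≤-trans p (ℤ.i⊓j≤i x₁ b)))
        (sym (sumTo-truncate (cell x) 0 l z≤n (empty-above x 0 λ m _ m<l →
          ℤ.≤-trans p (ℤ.≤-trans (ℤ.i⊓j≤j x₁ b) (proj₂ (lowerBound κ l) m m<l)))))
      lem : ∀ c c′ s s′ a b k n → n ≡ a + b - k + c′ - c → c′ ≡ s′ → s ≡ s′ + (a + b - k - n) → c ≡ s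
      lem c c′ _ _ a b k _ refl refl refl = solve (c ∷ c′ ∷ a ∷ b ∷ k ∷ [])
      step : ∀ x → c (x - 1ℤ) ≡ potential (x - 1ℤ) → c x ≡ potential x
      step x p = lem (c x) (c (x - 1ℤ)) (potential x) (potential (x - 1ℤ))
        (countTo μ l x) (countTo α l x) (countTo κ l x) (countTo ν l x) (conjugate x) p (potential-step x)

    input : ℤ → ℤ
    input x = countTo μ l x - countTo κ l x + (countTo α l x - countTo κ l x) + c (x - 1ℤ)

    c≥0 : ∀ x → 0ℤ ℤ.≤ c x
    c≥0 x = subst (0ℤ ℤ.≤_) (sym (recursion x)) (ℤ.i≤i⊔j 0ℤ (input x - 1ℤ))

    count-ν : ∀ x → countTo ν l x - countTo κ l x ≡ input x - c x
    count-ν x = lem (countTo ν l x) (countTo μ l x) (countTo α l x) (countTo κ l x) (c (x - 1ℤ)) (c x) (conjugate x)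
      where
      lem : ∀ n a b k c′ c → n ≡ a + b - k + c′ - c → n - k ≡ a - k + (b - k) + c′ - c
      lem _ a b k c′ c refl = solve (a ∷ b ∷ k ∷ c′ ∷ c ∷ [])

    -- The carry keeps all but at most one unit of the input, and what it does not keep is the
    -- column of ν over κ.
    at-most-one : ∀ x → countTo ν l x ℤ.≤ countTo κ l x + 1ℤ
    at-most-one x = lem (countTo ν l x) (countTo κ l x) (input x) (c x) (count-ν x)
      (subst (input x - 1ℤ ℤ.≤_) (sym (recursion x)) (ℤ.i≤j⊔i 0ℤ (input x - 1ℤ)))
      where
      lem : ∀ n k i c → n - k ≡ i - c → i - 1ℤ ℤ.≤ c → n ℤ.≤ k + 1ℤ
      lem n k i c eq h = ≤-by (Δ h) (trans (lem₁ n k) (trans (cong (1ℤ -_) eq) (lem₂ i c)))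
        where
        lem₁ : ∀ n k → k + 1ℤ - n ≡ 1ℤ - (n - k)
        lem₁ n k = solve (n ∷ k ∷ [])
        lem₂ : ∀ i c → 1ℤ - (i - c) ≡ c - (i - 1ℤ)
        lem₂ i c = solve (i ∷ c ∷ [])

    capped : ∀ k → suc k < l → ν k ℤ.≤ κ (suc k)
    capped k k<l with ≤-or-> (ν k) (κ (suc k))
    ... | inj₁ p = p
    ... | inj₂ p = contradiction (at-most-one x) (lem (+ l) (+ k) lo hi)
      where
      -- In this column ν has all rows from k on, κ only rows from k + 2 on: a difference of at
      -- least two.
      x : ℤ
      x = ν k
      lo : + l - + k ℤ.≤ countTo ν l x
      lo = countTo-lower ν l k x (ℕ.<⇒≤ (ℕ.<⇒≤ k<l)) λ m → increasing-≤ ν↑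
      hi : countTo κ l x ℤ.≤ + l - + suc (suc k)
      hi = countTo-upper κ l (suc (suc k)) x k<l λ m m<k →
        ℤ.≤-trans (ℤ.+-monoˡ-≤ 1ℤ (increasing-≤ κ↑ (ℕ.s≤s⁻¹ m<k) k<l)) p
      lem : ∀ l k {n o} → l - k ℤ.≤ n → o ℤ.≤ l - (1ℤ + (1ℤ + k)) → ¬ (n ℤ.≤ o + 1ℤ)
      lem l k {n} {o} p q r = 1≰0 (≤-by (Δ p ⊕ Δ q ⊕ Δ r) (solve (l ∷ k ∷ n ∷ o ∷ [])))

    c-at : ∀ k → k < l → c (κ k) ≡ carry κ μ α ν k
    c-at k k<l = trans (closed (κ k)) (trans
      (sumTo-truncate (cell (κ k)) k l (ℕ.<⇒≤ k<l) (empty-above (κ k) k λ m → increasing-≤ κ↑))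
      (full-below capped (κ k) k k<l ℤ.≤-refl))

    -- An empty column of ν over κ means input = c = max (0, input - 1), which forces both to
    -- vanish.
    no-input : ∀ x → countTo ν l x ≡ countTo κ l x → input x ≡ 0ℤ × c x ≡ 0ℤ
    no-input x eq = zero-fix (input x) (c x) (recursion x)
      (ℤ.i-j≡0⇒i≡j (input x) (c x) (trans (sym (count-ν x)) (ℤ.i≡j⇒i-j≡0 eq)))
      where
      zero-fix : ∀ i c → c ≡ 0ℤ ⊔ (i - 1ℤ) → i ≡ c → i ≡ 0ℤ × c ≡ 0ℤ
      zero-fix i _ eq refl with ≤-or-> i 0ℤ
      ... | inj₁ p = let z = trans eq (ℤ.i≥j⇒i⊔j≡i (ℤ.≤-trans (x-1≤x i) p)) in z , z
      ... | inj₂ p = contradiction (≤-by (Δ (ℤ.≤-reflexive i≡)) (solve (i ∷ []))) 1≰0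
        where
        i≡ : i ≡ i - 1ℤ
        i≡ = trans eq (ℤ.i≤j⇒i⊔j≡j (≤-by (Δ p) (solve (i ∷ []))))

    tight : ∀ k → suc k < l → ν k ≡ κ (suc k) ⊎ carry κ μ α ν (suc k) ≡ 0ℤ
    tight k k<l with ≤-or-> (κ (suc k)) (ν k)
    ... | inj₁ p = inj₁ (ℤ.≤-antisym (capped k k<l) p)
    ... | inj₂ p = inj₂ (trans (sym carry≡) (proj₂ none))
      where
      -- The first column that row k of ν misses; row k + 1 of κ still reaches it. There ν and κ
      -- have equal counts, so the carry is zero and μ and α have no gap, which makes every row up
      -- to k full.
      x = ν k + 1ℤ
      k≤l = ℕ.<⇒≤ k<l
      κ≥ : ∀ m → suc k ≤ m → m < l → x ℤ.≤ κ m
      κ≥ m k<m m<l = ℤ.≤-trans p (increasing-≤ κ↑ k<m m<l)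
      κ≤x : ∀ m → m < suc k → κ m + 1ℤ ℤ.≤ x
      κ≤x m (s≤s m≤k) = ℤ.+-monoˡ-≤ 1ℤ (ℤ.≤-trans (increasing-≤ κ↑ m≤k k≤l) (κ≤ν k k≤l))
      count-κ : countTo κ l x ≡ + l - + suc k
      count-κ = ℤ.≤-antisym (countTo-upper κ l (suc k) x k≤l κ≤x)
                             (countTo-lower κ l (suc k) x k≤l κ≥)
      none : input x ≡ 0ℤ × c x ≡ 0ℤ
      none = no-input x (ℤ.≤-antisym
        (ℤ.≤-trans (countTo-upper ν l (suc k) x k≤l λ m m≤k →
          ℤ.+-monoˡ-≤ 1ℤ (increasing-≤ ν↑ (ℕ.s≤s⁻¹ m≤k) k≤l)) (ℤ.≤-reflexive (sym count-κ)))
        (countTo-mono l x κ≤ν))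
      μ-gap : 0ℤ ℤ.≤ countTo μ l x - countTo κ l x
      μ-gap = Δ (countTo-mono l x (below κμ))
      α-gap : 0ℤ ℤ.≤ countTo α l x - countTo κ l x
      α-gap = Δ (countTo-mono l x (below κα))
      small : ∀ f → Interlaced l κ f → countTo f l x - countTo κ l x ℤ.≤ 0ℤ → f k ℤ.≤ x
      small f κf gap≤0 with ≤-or-> x (f k)
      ... | inj₂ q = weaken q
      ... | inj₁ q = contradiction gap≤0 (lem (+ l) (+ k) _ _
        (countTo-lower f l k x (ℕ.<⇒≤ k≤l) λ m k≤m m<l → ℤ.≤-trans q (increasing-≤ (interlaced-↑ʳ κf) k≤m m<l))
        (ℤ.≤-reflexive count-κ))
        where
        lem : ∀ l k n o → l - k ℤ.≤ n → o ℤ.≤ l - (1ℤ + k) → ¬ (n - o ℤ.≤ 0ℤ)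
        lem l k n o p q r = 1≰0 (≤-by (Δ p ⊕ Δ q ⊕ Δ r) (solve (l ∷ k ∷ n ∷ o ∷ [])))
      split : ∀ a b c → 0ℤ ℤ.≤ a → 0ℤ ℤ.≤ b → 0ℤ ℤ.≤ c → a + b + c ≡ 0ℤ → a ℤ.≤ 0ℤ × b ℤ.≤ 0ℤ
      split a b c p q r eq =
        ≤-by (q ⊕ r) (lem₁ a b c eq) , ≤-by (p ⊕ r) (lem₂ a b c eq)
        where
        lem₁ : ∀ a b c → a + b + c ≡ 0ℤ → 0ℤ - a ≡ b + c
        lem₁ a b c eq = trans (cong (_- a) (sym eq)) (solve (a ∷ b ∷ c ∷ []))
        lem₂ : ∀ a b c → a + b + c ≡ 0ℤ → 0ℤ - b ≡ a + c
        lem₂ a b c eq = trans (cong (_- b) (sym eq)) (solve (a ∷ b ∷ c ∷ []))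
      gaps : countTo μ l x - countTo κ l x ℤ.≤ 0ℤ × countTo α l x - countTo κ l x ℤ.≤ 0ℤ
      gaps = split _ _ _ μ-gap α-gap (c≥0 (x - 1ℤ)) (proj₁ none)
      carry≡ : c x ≡ carry κ μ α ν (suc k)
      carry≡ = trans (closed x) (trans (sumTo-truncate (cell x) (suc k) l k≤l (empty-above x (suc k) κ≥))
        (cong₂ _+_ (full-below capped x k k≤l (ℤ.≤-trans (κ≤ν k k≤l) (x≤x+1 (ν k))))
          (cell-full k (ℤ.≤-trans (κ≤ν k k≤l) (x≤x+1 (ν k)))
            (small μ κμ (proj₁ gaps)) (small α κα (proj₂ gaps)) (x≤x+1 (ν k)))))

    total : carry κ μ α ν l ≡ 0ℤ
    total = trans (sym full) (proj₂ (no-input x (trans (zeros ν ν≤) (sym (zeros κ κ≤)))))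
      where
      b = proj₁ (upperBound ν l)
      x = b + 1ℤ
      ν≤ : ∀ m → m < l → ν m + 1ℤ ℤ.≤ x
      ν≤ m m<l = ℤ.+-monoˡ-≤ 1ℤ (proj₂ (upperBound ν l) m m<l)
      κ≤ : ∀ m → m < l → κ m + 1ℤ ℤ.≤ x
      κ≤ m m<l = ℤ.≤-trans (ℤ.+-monoˡ-≤ 1ℤ (κ≤ν m m<l)) (ν≤ m m<l)
      zeros : ∀ f → (∀ m → m < l → f m + 1ℤ ℤ.≤ x) → countTo f l x ≡ 0ℤ
      zeros f h = sumTo-truncate (λ m → ind x (f m)) 0 l z≤n λ m _ m<l → ind-> (h m m<l)
      full : c x ≡ carry κ μ α ν l
      full = trans (closed x) (sumTo-cong l λ m m<l → cell-full m (weaken (κ≤ m m<l))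
        (ℤ.≤-trans (below μν m m<l) (weaken (ν≤ m m<l)))
        (ℤ.≤-trans (below αν m m<l) (weaken (ν≤ m m<l))) (weaken (ν≤ m m<l)))

    nonneg : ∀ k → k ≤ l → 0ℤ ℤ.≤ carry κ μ α ν k
    nonneg k k≤l with ℕ.m≤n⇒m<n∨m≡n k≤l
    ... | inj₁ k<l  = subst (0ℤ ℤ.≤_) (c-at k k<l) (c≥0 (κ k))
    ... | inj₂ refl = ℤ.≤-reflexive (sym total)

    rowRule : RowRule l κ μ α ν
    rowRule = record { nonneg = nonneg ; total = total ; capped = capped ; tight = tight }

  module ToRule (R : RowRule l κ μ α ν) where

    open RowRule R

    -- At most row k is cut by column `x`: the rows below it are full, those above it are empty.
    partial : ∀ x k → k < l → κ k ℤ.≤ x → (∀ m → suc k ≤ m → m < l → x ℤ.≤ κ m) →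
              potential x ≡ carry κ μ α ν k + cell x k
    partial x k k<l κ≤x hi = trans (sumTo-truncate (cell x) (suc k) l k<l (empty-above x (suc k) hi))
      (cong (λ z → z + cell x k) (full-below capped x k k<l κ≤x))

    -- With d the count of ν minus that of κ and p the potential, the recursion reads p = max (0, d
    -- + p - 1). It holds if d = 1 and p ≥ 0, and if d = 0 and p = 0.
    Good : ℤ → Set
    Good x = countTo ν l x ≡ countTo κ l x + 1ℤ × 0ℤ ℤ.≤ potential x
           ⊎ countTo ν l x ≡ countTo κ l x × potential x ≡ 0ℤ

    count : ∀ f x k → k ≤ l → (∀ m → m < k → f m + 1ℤ ℤ.≤ x) →
            (∀ m → k ≤ m → m < l → x ℤ.≤ f m) → countTo f l x ≡ + l - + k
    count f x k k≤l lo hi = ℤ.≤-antisym (countTo-upper f l k x k≤l lo) (countTo-lower f l k x k≤l hi)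

    good : ∀ x → Good x
    good x with zone κ l κ↑ x
    ... | zero , _ , lo , hi = inj₂
      ( trans (count ν x 0 z≤n (λ _ ()) (λ m z m<l → ℤ.≤-trans (hi m z m<l) (κ≤ν m m<l)))
              (sym (count κ x 0 z≤n (λ _ ()) hi))
      , sumTo-truncate (cell x) 0 l z≤n (empty-above x 0 hi))
    ... | suc k , k<l , lo , hi with ≤-or-> x (ν k)
    ...   | inj₁ x≤ν = inj₁ (counts , subst (0ℤ ℤ.≤_) (sym (partial x k k<l κ≤x hi)) c≥0)
      where
      κ<x : κ k + 1ℤ ℤ.≤ x
      κ<x = lo k ℕ.≤-refl
      κ≤x = weaken κ<x
      ν<x : ∀ m → m < k → ν m + 1ℤ ℤ.≤ x
      ν<x m m<k = ℤ.≤-trans (ℤ.+-monoˡ-≤ 1ℤ (ℤ.≤-trans (capped m (ℕ.≤-<-trans m<k k<l))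
        (increasing-≤ κ↑ m<k k<l))) κ<x
      ν≥x : ∀ m → k ≤ m → m < l → x ℤ.≤ ν m
      ν≥x m k≤m m<l = ℤ.≤-trans x≤ν (increasing-≤ ν↑ k≤m m<l)
      counts : countTo ν l x ≡ countTo κ l x + 1ℤ
      counts = trans (count ν x k (ℕ.<⇒≤ k<l) ν<x ν≥x) (trans (lem (+ l) (+ k))
        (cong (λ z → z + 1ℤ) (sym (count κ x (suc k) k<l lo hi))))
        where
        lem : ∀ l k → l - k ≡ l - (1ℤ + k) + 1ℤ
        lem l k = solve (l ∷ k ∷ [])
      c≥0 : 0ℤ ℤ.≤ carry κ μ α ν k + cell x k
      c≥0 = clipped-nonneg (carry κ μ α ν k) x (μ k) (α k) (κ k) (ν k)
        (nonneg k (ℕ.<⇒≤ k<l)) κ≤x (below κμ k k<l) (below κα k k<l) x≤ν (nonneg (suc k) k<l)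
    ...   | inj₂ ν<x = inj₂
      ( trans (count ν x (suc k) k<l ν<x′ (λ m k<m m<l → ℤ.≤-trans (hi m k<m m<l) (κ≤ν m m<l)))
              (sym (count κ x (suc k) k<l lo hi))
      , trans (partial x k k<l κ≤x hi) (trans (cong (λ z → carry κ μ α ν k + z) full) no-carry))
      where
      κ≤x : κ k ℤ.≤ x
      κ≤x = weaken (lo k ℕ.≤-refl)
      ν<x′ : ∀ m → m < suc k → ν m + 1ℤ ℤ.≤ x
      ν<x′ m (s≤s m≤k) = ℤ.≤-trans (ℤ.+-monoˡ-≤ 1ℤ (increasing-≤ ν↑ m≤k k<l)) ν<x
      ν≤x = weaken ν<x
      full : cell x k ≡ μ k + α k - κ k - ν k
      full = cell-full k κ≤x (ℤ.≤-trans (below μν k k<l) ν≤x) (ℤ.≤-trans (below αν k k<l) ν≤x) ν≤x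
      no-carry : carry κ μ α ν (suc k) ≡ 0ℤ
      no-carry with ℕ.m≤n⇒m<n∨m≡n k<l
      ... | inj₂ refl = total
      ... | inj₁ k<l′ with tight k k<l′
      ...   | inj₂ z  = z
      ...   | inj₁ eq = contradiction (subst (λ z → z + 1ℤ ℤ.≤ x) eq ν<x)
                          (≤-not-> (hi (suc k) ℕ.≤-refl k<l′))

    rule : Rule l κ μ α ν potential
    rule = record
      { vanishing = b , λ x x≤b → sumTo-truncate (cell x) 0 l z≤n
          (empty-above x 0 λ m _ m<l → ℤ.≤-trans x≤b (proj₂ (lowerBound κ l) m m<l))
      ; recursion = λ x → fix x (good x)
      ; conjugate = conj-eq
      }
      where
      b = proj₁ (lowerBound κ l)
      conj-eq : ∀ x → countTo ν l x ≡
        countTo μ l x + countTo α l x - countTo κ l x + potential (x - 1ℤ) - potential x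
      conj-eq x = lem (potential x) (potential (x - 1ℤ)) (countTo μ l x) (countTo α l x)
                      (countTo κ l x) (countTo ν l x) (potential-step x)
        where
        lem : ∀ s s′ a b k n → s ≡ s′ + (a + b - k - n) → n ≡ a + b - k + s′ - s
        lem _ s′ a b k n refl = solve (s′ ∷ a ∷ b ∷ k ∷ n ∷ [])
      input : ∀ x → countTo μ l x - countTo κ l x + (countTo α l x - countTo κ l x)
                    + potential (x - 1ℤ) ≡ countTo ν l x - countTo κ l x + potential x
      input x = lem (potential x) (potential (x - 1ℤ)) (countTo μ l x) (countTo α l x)
                    (countTo κ l x) (countTo ν l x) (potential-step x)
        where
        lem : ∀ s s′ a b k n → s ≡ s′ + (a + b - k - n) → a - k + (b - k) + s′ ≡ n - k + s
        lem _ s′ a b k n refl = solve (s′ ∷ a ∷ b ∷ k ∷ n ∷ [])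
      fix : ∀ x → Good x → potential x ≡ 0ℤ ⊔ (countTo μ l x - countTo κ l x
              + (countTo α l x - countTo κ l x) + potential (x - 1ℤ) - 1ℤ)
      fix x g = trans (fix′ g) (cong (λ z → 0ℤ ⊔ (z - 1ℤ)) (sym (input x)))
        where
        fix′ : Good x → potential x ≡ 0ℤ ⊔ (countTo ν l x - countTo κ l x + potential x - 1ℤ)
        fix′ (inj₁ (eq , p)) = sym (trans (cong (0ℤ ⊔_)
            (trans (cong (λ z → z - countTo κ l x + potential x - 1ℤ) eq)
                   (lem (countTo κ l x) (potential x))))
          (ℤ.i≤j⇒i⊔j≡j p))
          where
          lem : ∀ k p → k + 1ℤ - k + p - 1ℤ ≡ p
          lem k p = solve (k ∷ p ∷ [])
        fix′ (inj₂ (eq , p)) = trans p (sym (trans (cong (0ℤ ⊔_)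
          (trans (cong₂ (λ y z → y - countTo κ l x + z - 1ℤ) eq p) (lem (countTo κ l x))))
          refl))
          where
          lem : ∀ k → k - k + 0ℤ - 1ℤ ≡ 0ℤ - 1ℤ
          lem k = solve (k ∷ [])

-- Uniqueness, symmetry and existence for the rule by rows

module _ {l : ℕ} {κ μ α : ℕ → ℤ} where

  open RowRule

  spent-≤ : ∀ {ν ν′} k → carry κ μ α ν k ≡ carry κ μ α ν′ k → 0ℤ ℤ.≤ carry κ μ α ν (suc k) →
            carry κ μ α ν′ (suc k) ≡ 0ℤ → ν k ℤ.≤ ν′ k
  spent-≤ {ν} {ν′} k = lem _ _ (μ k + α k - κ k) (ν k) (ν′ k)
    where
    lem : ∀ c c′ x ν ν′ → c ≡ c′ → 0ℤ ℤ.≤ c + (x - ν) → c′ + (x - ν′) ≡ 0ℤ → ν ℤ.≤ ν′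
    lem c _ x ν ν′ refl p q = ≤-by (p ⊕ Δ (ℤ.≤-reflexive q)) (solve (c ∷ x ∷ ν ∷ ν′ ∷ []))

  -- `ν′ k` attains the cap or spends the whole carry, and `ν k` can exceed neither.
  rowRule-≤ : ∀ {ν ν′} → RowRule l κ μ α ν → RowRule l κ μ α ν′ → ∀ k → k < l →
              carry κ μ α ν k ≡ carry κ μ α ν′ k → ν k ℤ.≤ ν′ k
  rowRule-≤ {ν} R R′ k k<l eq with ℕ.m≤n⇒m<n∨m≡n k<l
  ... | inj₂ refl = spent-≤ k eq (nonneg R (suc k) k<l) (total R′)
  ... | inj₁ k<l′ with tight R′ k k<l′
  ...   | inj₁ p = subst (ν k ℤ.≤_) (sym p) (capped R k k<l′)
  ...   | inj₂ p = spent-≤ k eq (nonneg R (suc k) k<l) p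

  rowRule-unique : ∀ {ν ν′} → RowRule l κ μ α ν → RowRule l κ μ α ν′ → ∀ k → k < l → ν k ≡ ν′ k
  rowRule-unique {ν} {ν′} R R′ k k<l =
    ℤ.≤-antisym (rowRule-≤ R R′ k k<l (carries k (ℕ.<⇒≤ k<l)))
                 (rowRule-≤ R′ R k k<l (sym (carries k (ℕ.<⇒≤ k<l))))
    where
    carries : ∀ k → k ≤ l → carry κ μ α ν k ≡ carry κ μ α ν′ k
    carries zero    _   = refl
    carries (suc k) k<l = cong₂ (λ c z → c + (μ k + α k - κ k - z)) eq
      (ℤ.≤-antisym (rowRule-≤ R R′ k k<l eq) (rowRule-≤ R′ R k k<l (sym eq)))
      where
      eq = carries k (ℕ.<⇒≤ k<l)

  rowRule-interlaced : ∀ {ν} → RowRule l κ μ α ν → Interlaced l κ μ → Interlaced l κ α →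
                       Interlaced l μ ν
  rowRule-interlaced {ν} R κμ κα = record
    { below = λ k k<l → low k k<l
    ; above = λ k k<l → ℤ.≤-trans (capped R k k<l) (below κμ (suc k) k<l) }
    where
    open Interlaced
    lem : ∀ c m a κ ν → 0ℤ ℤ.≤ c → κ ℤ.≤ a → c + (m + a - κ - ν) ≡ 0ℤ → m ℤ.≤ ν
    lem c m a κ ν p q r =
      ≤-by (p ⊕ Δ q ⊕ Δ (ℤ.≤-reflexive r)) (solve (c ∷ m ∷ a ∷ κ ∷ ν ∷ []))
    zero-carry : ∀ k → k < l → carry κ μ α ν (suc k) ≡ 0ℤ → μ k ℤ.≤ ν k
    zero-carry k k<l = lem (carry κ μ α ν k) (μ k) (α k) (κ k) (ν k)
      (nonneg R k (ℕ.<⇒≤ k<l)) (below κα k k<l)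
    low : ∀ k → k < l → μ k ℤ.≤ ν k
    low k k<l with ℕ.m≤n⇒m<n∨m≡n k<l
    ... | inj₂ refl = zero-carry k k<l (total R)
    ... | inj₁ k<l′ with tight R k k<l′
    ...   | inj₂ z = zero-carry k k<l z
    ...   | inj₁ p = subst (μ k ℤ.≤_) (sym p) (above κμ k k<l′)

  rowRule-sym : ∀ {ν} → RowRule l κ μ α ν → RowRule l κ α μ ν
  rowRule-sym {ν} R = record
    { nonneg = λ k k≤l → subst (0ℤ ℤ.≤_) (swap k) (nonneg R k k≤l)
    ; total  = trans (sym (swap l)) (total R)
    ; capped = capped R
    ; tight  = λ k k<l → case tight R k k<l of λ where
        (inj₁ p) → inj₁ p
        (inj₂ p) → inj₂ (trans (sym (swap (suc k))) p)
    }
    where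
    swap : ∀ k → carry κ μ α ν k ≡ carry κ α μ ν k
    swap k = sumTo-cong k λ m _ → cong (λ z → z - κ m - ν m) (ℤ.+-comm (μ m) (α m))

  -- The top row has no cap, so all that is still carried ends there.
  capAt : ℕ → ℤ → ℤ
  capAt k x with suc k ℕ.<? l
  ... | yes _ = x ⊓ κ (suc k)
  ... | no  _ = x

  local-carry : ℕ → ℤ
  local-row : ℕ → ℤ

  local-carry zero    = 0ℤ
  local-carry (suc k) = local-carry k + (μ k + α k - κ k - local-row k)
  local-row k = capAt k (local-carry k + (μ k + α k - κ k))

  rowRule-exists : RowRule l κ μ α local-row
  rowRule-exists = record
    { nonneg = λ k _ → subst (0ℤ ℤ.≤_) (sym (carry≡ k)) (carry≥0 k)
    ; total  = trans (carry≡ l) (top l ℕ.≤-refl)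
    ; capped = λ k → cap k _
    ; tight  = λ k k<l → case tight′ k _ k<l of λ where
        (inj₁ p) → inj₁ p
        (inj₂ p) → inj₂ (trans (carry≡ (suc k)) (lem (local-carry k) (μ k + α k - κ k) (local-row k) p))
    }
    where
    lem : ∀ c x y → y ≡ c + x → c + (x - y) ≡ 0ℤ
    lem c x _ refl = solve (c ∷ x ∷ [])
    carry≡ : ∀ k → carry κ μ α local-row k ≡ local-carry k
    carry≡ zero    = refl
    carry≡ (suc k) = cong (λ z → z + (μ k + α k - κ k - local-row k)) (carry≡ k)
    capAt-≤ : ∀ k x → capAt k x ℤ.≤ x
    capAt-≤ k x with suc k ℕ.<? l
    ... | yes _ = ℤ.i⊓j≤i x _
    ... | no  _ = ℤ.≤-refl
    carry≥0 : ∀ k → 0ℤ ℤ.≤ local-carry k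
    carry≥0 zero    = ℤ.≤-refl
    carry≥0 (suc k) = lem′ (local-carry k) (μ k + α k - κ k) _ (capAt-≤ k _)
      where
      lem′ : ∀ c x y → y ℤ.≤ c + x → 0ℤ ℤ.≤ c + (x - y)
      lem′ c x y p = ≤-by (Δ p) (solve (c ∷ x ∷ y ∷ []))
    top : ∀ k → l ≤ k → local-carry k ≡ 0ℤ
    top zero    _   = refl
    top (suc k) l≤k with suc k ℕ.<? l
    ... | yes k<l = contradiction l≤k (ℕ.<⇒≱ k<l)
    ... | no  _   = lem (local-carry k) (μ k + α k - κ k) _ refl
    cap : ∀ k x → suc k < l → capAt k x ℤ.≤ κ (suc k)
    cap k x k<l with suc k ℕ.<? l
    ... | yes _  = ℤ.i⊓j≤j x _
    ... | no ¬lt = contradiction k<l ¬lt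
    tight′ : ∀ k x → suc k < l → capAt k x ≡ κ (suc k) ⊎ capAt k x ≡ x
    tight′ k x k<l with suc k ℕ.<? l
    ... | no ¬lt = contradiction k<l ¬lt
    ... | yes _ with ≤-or-> x (κ (suc k))
    ...   | inj₁ p = inj₂ (ℤ.i≤j⇒i⊓j≡i p)
    ...   | inj₂ p = inj₁ (ℤ.i≥j⇒i⊓j≡j (weaken p))

-- Raising operators and the local rule

δ : ℕ → ℕ → ℤ
δ a k = if does (a ℕ.≟ k) then 1ℤ else 0ℤ

δ-≡ : ∀ a → δ a a ≡ 1ℤ
δ-≡ a rewrite dec-true (a ℕ.≟ a) refl = refl

δ-≢ : ∀ {a k} → a ≢ k → δ a k ≡ 0ℤ
δ-≢ {a} {k} a≢k rewrite dec-false (a ℕ.≟ k) a≢k = refl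

δ≥0 : ∀ a k → 0ℤ ℤ.≤ δ a k
δ≥0 a k with does (a ℕ.≟ k)
... | true  = 0≤1
... | false = ℤ.≤-refl

jump : ℕ → ℕ → ℤ
jump a = sumTo (δ a)

jump-≤ : ∀ {a} k → k ≤ a → jump a k ≡ 0ℤ
jump-≤ zero    _   = refl
jump-≤ (suc k) k<a = cong₂ _+_ (jump-≤ k (ℕ.<⇒≤ k<a)) (δ-≢ (ℕ.<⇒≢ k<a ∘ sym))

jump-> : ∀ {a} k → a < k → jump a k ≡ 1ℤ
jump-> {a} (suc k) (s≤s a≤k) with ℕ.m≤n⇒m<n∨m≡n a≤k
... | inj₁ a<k  = cong₂ _+_ (jump-> k a<k) (δ-≢ (ℕ.<⇒≢ a<k))
... | inj₂ refl = cong₂ _+_ (jump-≤ a ℕ.≤-refl) (δ-≡ a)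

-- For the rows of a two-letter skew tableau, the excess of closing over
-- opening brackets in the word read up to the end of the closing ones of row k.
score : (κ₀ κ₁ κ₂ : ℕ → ℤ) → ℕ → ℤ
score κ₀ κ₁ κ₂ k = sumTo (λ m → κ₁ m - κ₀ m - (κ₂ m - κ₁ m)) k + (κ₁ k - κ₀ k)

-- e acts on row k₀ of the middle term of κ₀ ≼ κ₁ ≼ κ₂, turning κ₁ into κ₁⁺.
record Raise (l : ℕ) (κ₀ κ₁ κ₂ κ₁⁺ : ℕ → ℤ) : Set where
  field
    k₀     : ℕ
    k₀<l   : k₀ < l
    raised : ∀ k → k < l → κ₁⁺ k ≡ κ₁ k + δ k₀ k
    lower  : ∀ k → k < k₀ → score κ₀ κ₁ κ₂ k ℤ.≤ score κ₀ κ₁ κ₂ k₀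
    upper  : ∀ k → k₀ < k → k < l → score κ₀ κ₁ κ₂ k + 1ℤ ℤ.≤ score κ₀ κ₁ κ₂ k₀

module Commute {l} {κ₀ κ₁ κ₂ κ₁⁺ λ₀ λ₁ λ₂ : ℕ → ℤ} (E : Raise l κ₀ κ₁ κ₂ κ₁⁺)
               (R₁ : RowRule l κ₀ κ₁ λ₀ λ₁) (R₂ : RowRule l κ₁ κ₂ λ₁ λ₂) where

  open Raise E
  open RowRule

  c d G : ℕ → ℤ
  c = carry κ₀ κ₁ λ₀ λ₁
  d = carry κ₁ κ₂ λ₁ λ₂
  G = score κ₀ κ₁ κ₂

  Open : ℕ → Set
  Open k = suc k < l → λ₁ k + 1ℤ ℤ.≤ κ₀ (suc k)

  find : ∀ fuel k → k < l → fuel ℕ.+ k ≡ l →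
         ∃[ k₁ ] k ≤ k₁ × k₁ < l × (∀ m → k ≤ m → m < k₁ → λ₁ m ≡ κ₀ (suc m)) × Open k₁
  find zero       k k<l eq = contradiction eq (ℕ.<⇒≢ k<l)
  find (suc fuel) k k<l eq with ℕ.m≤n⇒m<n∨m≡n k<l
  ... | inj₂ refl = k , ℕ.≤-refl , k<l , (λ m p q → contradiction p (ℕ.<⇒≱ q)) ,
                    λ lt → contradiction lt (ℕ.<-irrefl refl)
  ... | inj₁ k<l′ with ≤-or-> (κ₀ (suc k)) (λ₁ k)
  ...   | inj₂ p = k , ℕ.≤-refl , k<l , (λ m p q → contradiction p (ℕ.<⇒≱ q)) , λ _ → p
  ...   | inj₁ p with find fuel (suc k) k<l′ (trans (ℕ.+-suc fuel k) eq)
  ...     | k₁ , k<k₁ , k₁<l , sat , op = k₁ , ℕ.<⇒≤ k<k₁ , k₁<l , sat′ , op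
    where
    sat′ : ∀ m → k ≤ m → m < k₁ → λ₁ m ≡ κ₀ (suc m)
    sat′ m k≤m m<k₁ with ℕ.m≤n⇒m<n∨m≡n k≤m
    ... | inj₁ k<m  = sat m k<m m<k₁
    ... | inj₂ refl = ℤ.≤-antisym (capped R₁ k k<l′) p

  found = find (l ∸ k₀) k₀ k₀<l (ℕ.m∸n+n≡m (ℕ.<⇒≤ k₀<l))

  k₁ : ℕ
  k₁ = proj₁ found

  k₀≤k₁ : k₀ ≤ k₁
  k₀≤k₁ = proj₁ (proj₂ found)

  k₁<l : k₁ < l
  k₁<l = proj₁ (proj₂ (proj₂ found))

  saturated : ∀ m → k₀ ≤ m → m < k₁ → λ₁ m ≡ κ₀ (suc m)
  saturated = proj₁ (proj₂ (proj₂ (proj₂ found)))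

  unsaturated : Open k₁
  unsaturated = proj₂ (proj₂ (proj₂ (proj₂ found)))

  λ₁⁺ : ℕ → ℤ
  λ₁⁺ k = λ₁ k + δ k₁ k

  G≤ : ∀ k → k ≤ k₀ → G k ℤ.≤ G k₀
  G≤ k k≤k₀ with ℕ.m≤n⇒m<n∨m≡n k≤k₀
  ... | inj₁ k<k₀ = lower k k<k₀
  ... | inj₂ refl = ℤ.≤-refl

  -- The quantity to follow is d + G. Where λ₂ is at its cap, it changes by `λ₁ k - κ₀ (suc k)`,
  -- which is at most 0 and vanishes on saturated rows; at any other row d returns to 0 and the
  -- quantity restarts from G.
  advance : ∀ k → λ₂ k ≡ κ₁ (suc k) → d (suc k) + G (suc k) ≡ d k + G k + (λ₁ k - κ₀ (suc k))
  advance k eq = lem (d k) (κ₂ k) (λ₁ k) (κ₁ k) (λ₂ k) (κ₁ (suc k))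
    (sumTo (λ m → κ₁ m - κ₀ m - (κ₂ m - κ₁ m)) k) (κ₀ k) (κ₀ (suc k)) eq
    where
    lem : ∀ d k₂ l₁ k₁ l₂ k₁′ s k₀ k₀′ → l₂ ≡ k₁′ →
      d + (k₂ + l₁ - k₁ - l₂) + (s + (k₁ - k₀ - (k₂ - k₁)) + (k₁′ - k₀′)) ≡
      d + (s + (k₁ - k₀)) + (l₁ - k₀′)
    lem d k₂ l₁ k₁ l₂ _ s k₀ k₀′ refl =
      solve (d ∷ k₂ ∷ l₁ ∷ k₁ ∷ l₂ ∷ s ∷ k₀ ∷ k₀′ ∷ [])

  advance-≥ : ∀ k → suc k < l → d k + G k + (λ₁ k - κ₀ (suc k)) ℤ.≤ d (suc k) + G (suc k)
  advance-≥ k k<l = lem (d k) (κ₂ k) (λ₁ k) (κ₁ k) (λ₂ k) (κ₁ (suc k))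
    (sumTo (λ m → κ₁ m - κ₀ m - (κ₂ m - κ₁ m)) k) (κ₀ k) (κ₀ (suc k)) (capped R₂ k k<l)
    where
    lem : ∀ d k₂ l₁ k₁ l₂ k₁′ s k₀ k₀′ → l₂ ℤ.≤ k₁′ →
      d + (s + (k₁ - k₀)) + (l₁ - k₀′) ℤ.≤
      d + (k₂ + l₁ - k₁ - l₂) + (s + (k₁ - k₀ - (k₂ - k₁)) + (k₁′ - k₀′))
    lem d k₂ l₁ k₁ l₂ k₁′ s k₀ k₀′ p =
      ≤-by (Δ p) (solve (d ∷ k₂ ∷ l₁ ∷ k₁ ∷ l₂ ∷ k₁′ ∷ s ∷ k₀ ∷ k₀′ ∷ []))

  -- Taken at `k₀` itself, the bound leaves no room for a positive d.
  below-k₀ : ∀ k → k ≤ k₀ → d k + G k ℤ.≤ G k₀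
  below-k₀ zero    k≤k₀ = subst (ℤ._≤ G k₀) (sym (ℤ.+-identityˡ (G 0))) (G≤ 0 k≤k₀)
  below-k₀ (suc k) k<k₀ with tight R₂ k k<l
    where k<l = ℕ.≤-<-trans k<k₀ k₀<l
  ... | inj₁ p = lem (d (suc k) + G (suc k)) (d k + G k) (λ₁ k) (κ₀ (suc k)) (G k₀)
                   (ℤ.≤-reflexive (advance k p)) (below-k₀ k (ℕ.<⇒≤ k<k₀))
                   (capped R₁ k (ℕ.≤-<-trans k<k₀ k₀<l))
    where
    lem : ∀ x y a b g → x ℤ.≤ y + (a - b) → y ℤ.≤ g → a ℤ.≤ b → x ℤ.≤ g
    lem x y a b g p q r = ≤-by (Δ p ⊕ Δ q ⊕ Δ r) (solve (x ∷ y ∷ a ∷ b ∷ g ∷ []))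
  ... | inj₂ p = subst (λ z → z + G (suc k) ℤ.≤ G k₀) (sym p)
                   (subst (ℤ._≤ G k₀) (sym (ℤ.+-identityˡ (G (suc k)))) (G≤ (suc k) k<k₀))

  d-k₀ : d k₀ ≡ 0ℤ
  d-k₀ = ℤ.≤-antisym (lem (d k₀) (G k₀) (below-k₀ k₀ ℕ.≤-refl)) (nonneg R₂ k₀ (ℕ.<⇒≤ k₀<l))
    where
    lem : ∀ d g → d + g ℤ.≤ g → d ℤ.≤ 0ℤ
    lem d g p = ≤-by (Δ p) (solve (d ∷ g ∷ []))

  -- Across a saturated row d + G does not decrease, while G stays strictly below `G k₀`, its last
  -- maximum; d has to make up for the difference. So there is a unit that the raise can take away
  -- from d.
  positive-suc : ∀ k → k₀ ≤ k → k < k₁ → d k + G k ≡ G k₀ → 1ℤ ℤ.≤ d (suc k)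
  positive-suc k k₀≤k k<k₁ eq = lem (d k + G k) (G k₀) (λ₁ k) (κ₀ (suc k)) (d (suc k)) (G (suc k))
    (ℤ.≤-reflexive (sym eq)) (ℤ.≤-reflexive (sym (saturated k k₀≤k k<k₁)))
    (advance-≥ k k<l) (upper (suc k) (s≤s k₀≤k) k<l)
    where
    k<l = ℕ.≤-<-trans k<k₁ k₁<l
    lem : ∀ x g a b d g′ → g ℤ.≤ x → b ℤ.≤ a → x + (a - b) ℤ.≤ d + g′ → g′ + 1ℤ ℤ.≤ g → 1ℤ ℤ.≤ d
    lem x g a b d g′ p q r s = ≤-by (Δ p ⊕ Δ q ⊕ Δ r ⊕ Δ s) (solve (x ∷ g ∷ a ∷ b ∷ d ∷ g′ ∷ []))

  between : ∀ k → k₀ ≤ k → k ≤ k₁ → d k + G k ≡ G k₀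
  between k k₀≤k k≤k₁ with ℕ.m≤n⇒m<n∨m≡n k₀≤k
  ... | inj₂ refl = trans (cong (λ z → z + G k₀) d-k₀) (ℤ.+-identityˡ (G k₀))
  between (suc k) _ k<k₁ | inj₁ (s≤s k₀≤k) with tight R₂ k (ℕ.≤-<-trans k<k₁ k₁<l)
  ... | inj₂ p = contradiction (subst (1ℤ ℤ.≤_) p
                   (positive-suc k k₀≤k k<k₁ (between k k₀≤k (ℕ.<⇒≤ k<k₁)))) 1≰0
  ... | inj₁ p = trans (advance k p) (trans
      (cong₂ _+_ (between k k₀≤k (ℕ.<⇒≤ k<k₁)) (ℤ.i≡j⇒i-j≡0 (saturated k k₀≤k k<k₁)))
      (ℤ.+-identityʳ (G k₀)))

  positive : ∀ k → k₀ < k → k ≤ k₁ → 1ℤ ℤ.≤ d k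
  positive (suc k) (s≤s k₀≤k) k<k₁ = positive-suc k k₀≤k k<k₁ (between k k₀≤k (ℕ.<⇒≤ k<k₁))

  -- The drop of d + G at the unsaturated row `k₁` gives the strict inequality; if d restarts from 0
  -- later, strictness comes from `upper`.
  beyond : ∀ k → k₁ < k → k < l → d k + G k + 1ℤ ℤ.≤ G k₀
  beyond (suc k) (s≤s k₁≤k) k<l with tight R₂ k k<l
  ... | inj₂ p = subst (λ z → z + G (suc k) + 1ℤ ℤ.≤ G k₀) (sym p)
      (subst (λ z → z + 1ℤ ℤ.≤ G k₀) (sym (ℤ.+-identityˡ (G (suc k))))
             (upper (suc k) (s≤s (ℕ.≤-trans k₀≤k₁ k₁≤k)) k<l))
  ... | inj₁ p with ℕ.m≤n⇒m<n∨m≡n k₁≤k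
  ...   | inj₂ refl = lem (d (suc k) + G (suc k)) (d k + G k) (λ₁ k) (κ₀ (suc k)) (G k₀)
      (ℤ.≤-reflexive (advance k p)) (ℤ.≤-reflexive (between k k₀≤k₁ ℕ.≤-refl)) (unsaturated k<l)
    where
    lem : ∀ x y a b g → x ℤ.≤ y + (a - b) → y ℤ.≤ g → a + 1ℤ ℤ.≤ b → x + 1ℤ ℤ.≤ g
    lem x y a b g p q r = ≤-by (Δ p ⊕ Δ q ⊕ Δ r) (solve (x ∷ y ∷ a ∷ b ∷ g ∷ []))
  ...   | inj₁ k₁<k = lem (d (suc k) + G (suc k)) (d k + G k) (λ₁ k) (κ₀ (suc k)) (G k₀)
      (ℤ.≤-reflexive (advance k p)) (beyond k k₁<k (ℕ.<⇒≤ k<l)) (capped R₁ k k<l)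
    where
    lem : ∀ x y a b g → x ℤ.≤ y + (a - b) → y + 1ℤ ℤ.≤ g → a ℤ.≤ b → x + 1ℤ ℤ.≤ g
    lem x y a b g p q r = ≤-by (Δ p ⊕ Δ q ⊕ Δ r) (solve (x ∷ y ∷ a ∷ b ∷ g ∷ []))

  -- Both carries telescope. Together with the bounds on d + G and with c ≥ 0, where c vanishes
  -- after row `k₁`, this makes `k₁` the last maximum of the new score.
  score-λ : ∀ k → score λ₀ λ₁ λ₂ k ≡ d k + G k - c (suc k)
  score-λ k = lem (sumTo (λ m → λ₁ m - λ₀ m - (λ₂ m - λ₁ m)) k)
    (sumTo (λ m → κ₁ m - κ₀ m - (κ₂ m - κ₁ m)) k) (d k) (c k)
    (λ₁ k) (λ₀ k) (κ₁ k) (κ₀ k) (sums k)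
    where
    lem : ∀ s t d c l₁ l₀ k₁ k₀ → s ≡ t + d - c →
          s + (l₁ - l₀) ≡ d + (t + (k₁ - k₀)) - (c + (k₁ + l₀ - k₀ - l₁))
    lem _ t d c l₁ l₀ k₁ k₀ refl = solve (t ∷ d ∷ c ∷ l₁ ∷ l₀ ∷ k₁ ∷ k₀ ∷ [])
    sums : ∀ k → sumTo (λ m → λ₁ m - λ₀ m - (λ₂ m - λ₁ m)) k ≡
                 sumTo (λ m → κ₁ m - κ₀ m - (κ₂ m - κ₁ m)) k + d k - c k
    sums zero    = refl
    sums (suc k) = lem′ (sumTo (λ m → λ₁ m - λ₀ m - (λ₂ m - λ₁ m)) k)
      (sumTo (λ m → κ₁ m - κ₀ m - (κ₂ m - κ₁ m)) k) (d k) (c k)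
      (λ₁ k) (λ₀ k) (κ₁ k) (κ₀ k) (λ₂ k) (κ₂ k) (sums k)
      where
      lem′ : ∀ s t d c l₁ l₀ k₁ k₀ l₂ k₂ → s ≡ t + d - c →
        s + (l₁ - l₀ - (l₂ - l₁)) ≡
        t + (k₁ - k₀ - (k₂ - k₁)) + (d + (k₂ + l₁ - k₁ - l₂)) - (c + (k₁ + l₀ - k₀ - l₁))
      lem′ _ t d c l₁ l₀ k₁ k₀ l₂ k₂ refl =
        solve (t ∷ d ∷ c ∷ l₁ ∷ l₀ ∷ k₁ ∷ k₀ ∷ l₂ ∷ k₂ ∷ [])

  c-k₁ : c (suc k₁) ≡ 0ℤ
  c-k₁ with ℕ.m≤n⇒m<n∨m≡n k₁<l
  ... | inj₂ eq = trans (cong c eq) (total R₁)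
  ... | inj₁ k₁<l′ with tight R₁ k₁ k₁<l′
  ...   | inj₂ p = p
  ...   | inj₁ p = contradiction (unsaturated k₁<l′) (≤-not-> (ℤ.≤-reflexive (sym p)))

  score-k₁ : score λ₀ λ₁ λ₂ k₁ ≡ G k₀
  score-k₁ = trans (score-λ k₁) (trans (cong₂ _-_ (between k₁ k₀≤k₁ ℕ.≤-refl) c-k₁)
    (ℤ.+-identityʳ (G k₀)))

  raise : Raise l λ₀ λ₁ λ₂ λ₁⁺
  raise = record
    { k₀ = k₁ ; k₀<l = k₁<l ; raised = λ _ _ → refl
    ; lower = λ k k<k₁ → subst₂ ℤ._≤_ (sym (score-λ k)) (sym score-k₁)
        (lem (d k + G k) (c (suc k)) (G k₀) (dG≤ k k<k₁) (nonneg R₁ (suc k) (ℕ.≤-trans k<k₁ (ℕ.<⇒≤ k₁<l))))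
    ; upper = λ k k₁<k k<l → subst₂ (λ y z → y + 1ℤ ℤ.≤ z) (sym (score-λ k)) (sym score-k₁)
        (lem′ (d k + G k) (c (suc k)) (G k₀) (beyond k k₁<k k<l) (nonneg R₁ (suc k) k<l))
    }
    where
    lem : ∀ x c g → x ℤ.≤ g → 0ℤ ℤ.≤ c → x - c ℤ.≤ g
    lem x c g p q = ≤-by (Δ p ⊕ q) (solve (x ∷ c ∷ g ∷ []))
    lem′ : ∀ x c g → x + 1ℤ ℤ.≤ g → 0ℤ ℤ.≤ c → x - c + 1ℤ ℤ.≤ g
    lem′ x c g p q = ≤-by (Δ p ⊕ q) (solve (x ∷ c ∷ g ∷ []))
    dG≤ : ∀ k → k < k₁ → d k + G k ℤ.≤ G k₀
    dG≤ k k<k₁ with ℕ.≤-total k k₀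
    ... | inj₁ p = below-k₀ k p
    ... | inj₂ p = ℤ.≤-reflexive (between k p (ℕ.<⇒≤ k<k₁))

  -- The difference of jumps is the indicator of k₀ < k ≤ k₁, the stretch over which the extra unit
  -- is carried. It is added to c there and, in `d⁺`, taken from d.
  c⁺ : ∀ k → k ≤ l → carry κ₀ κ₁⁺ λ₀ λ₁⁺ k ≡ c k + (jump k₀ k - jump k₁ k)
  c⁺ zero    _   = refl
  c⁺ (suc k) k<l = lem (c k) (jump k₀ k) (jump k₁ k) (κ₁ k) (λ₀ k) (κ₀ k) (λ₁ k) (δ k₀ k) (δ k₁ k) _ _
    (c⁺ k (ℕ.<⇒≤ k<l)) (raised k k<l)
    where
    lem : ∀ c j₀ j₁ k₁ l₀ k₀ l₁ d₀ d₁ c⁺ k⁺ → c⁺ ≡ c + (j₀ - j₁) → k⁺ ≡ k₁ + d₀ →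
          c⁺ + (k⁺ + l₀ - k₀ - (l₁ + d₁)) ≡ c + (k₁ + l₀ - k₀ - l₁) + (j₀ + d₀ - (j₁ + d₁))
    lem c j₀ j₁ k₁ l₀ k₀ l₁ d₀ d₁ _ _ refl refl =
      solve (c ∷ j₀ ∷ j₁ ∷ k₁ ∷ l₀ ∷ k₀ ∷ l₁ ∷ d₀ ∷ d₁ ∷ [])

  d⁺ : ∀ k → k ≤ l → carry κ₁⁺ κ₂ λ₁⁺ λ₂ k ≡ d k - (jump k₀ k - jump k₁ k)
  d⁺ zero    _   = refl
  d⁺ (suc k) k<l = lem (d k) (jump k₀ k) (jump k₁ k) (κ₂ k) (λ₁ k) (κ₁ k) (λ₂ k) (δ k₀ k) (δ k₁ k) _ _
    (d⁺ k (ℕ.<⇒≤ k<l)) (raised k k<l)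
    where
    lem : ∀ d j₀ j₁ k₂ l₁ k₁ l₂ d₀ d₁ d⁺ k⁺ → d⁺ ≡ d - (j₀ - j₁) → k⁺ ≡ k₁ + d₀ →
          d⁺ + (k₂ + (l₁ + d₁) - k⁺ - l₂) ≡ d + (k₂ + l₁ - k₁ - l₂) - (j₀ + d₀ - (j₁ + d₁))
    lem d j₀ j₁ k₂ l₁ k₁ l₂ d₀ d₁ _ _ refl refl =
      solve (d ∷ j₀ ∷ j₁ ∷ k₂ ∷ l₁ ∷ k₁ ∷ l₂ ∷ d₀ ∷ d₁ ∷ [])

  data Place (k : ℕ) : Set where
    outside : jump k₀ k - jump k₁ k ≡ 0ℤ → ¬ (k₀ < k × k ≤ k₁) → Place k
    inside  : jump k₀ k - jump k₁ k ≡ 1ℤ → k₀ < k → k ≤ k₁ → Place k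

  place : ∀ k → Place k
  place k with ℕ.≤-<-connex k k₀ | ℕ.≤-<-connex k k₁
  ... | inj₁ p | _      = outside (cong₂ _-_ (jump-≤ k p) (jump-≤ k (ℕ.≤-trans p k₀≤k₁)))
                            λ (q , _) → ℕ.<⇒≱ q p
  ... | inj₂ p | inj₁ q = inside (cong₂ _-_ (jump-> k p) (jump-≤ k q)) p q
  ... | inj₂ p | inj₂ q = outside (cong₂ _-_ (jump-> k p) (jump-> k q)) λ (_ , r) → ℕ.<⇒≱ q r

  c⁺-outside : ∀ {k} → k ≤ l → jump k₀ k - jump k₁ k ≡ 0ℤ → carry κ₀ κ₁⁺ λ₀ λ₁⁺ k ≡ c k
  c⁺-outside {k} k≤l z = trans (c⁺ k k≤l) (trans (cong (λ z → c k + z) z) (ℤ.+-identityʳ (c k)))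

  d⁺-outside : ∀ {k} → k ≤ l → jump k₀ k - jump k₁ k ≡ 0ℤ → carry κ₁⁺ κ₂ λ₁⁺ λ₂ k ≡ d k
  d⁺-outside {k} k≤l z = trans (d⁺ k k≤l) (trans (cong (λ z → d k - z) z) (ℤ.+-identityʳ (d k)))

  jump-l : jump k₀ l - jump k₁ l ≡ 0ℤ
  jump-l = cong₂ _-_ (jump-> l k₀<l) (jump-> l k₁<l)

  rule₁ : RowRule l κ₀ κ₁⁺ λ₀ λ₁⁺
  rule₁ = record
    { nonneg = nonneg′
    ; total  = trans (c⁺-outside ℕ.≤-refl jump-l) (total R₁)
    ; capped = capped′
    ; tight  = tight′
    }
    where
    nonneg′ : ∀ k → k ≤ l → 0ℤ ℤ.≤ carry κ₀ κ₁⁺ λ₀ λ₁⁺ k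
    nonneg′ k k≤l with place k
    ... | outside z _  = subst (0ℤ ℤ.≤_) (sym (c⁺-outside k≤l z)) (nonneg R₁ k k≤l)
    ... | inside z _ _ = subst (0ℤ ℤ.≤_) (sym (trans (c⁺ k k≤l) (cong (λ z → c k + z) z)))
                           (nonneg R₁ k k≤l ⊕ 0≤1)
    same : ∀ {k} → k ≢ k₁ → λ₁⁺ k ≡ λ₁ k
    same {k} k≢k₁ = trans (cong (λ z → λ₁ k + z) (δ-≢ (k≢k₁ ∘ sym))) (ℤ.+-identityʳ (λ₁ k))
    capped′ : ∀ k → suc k < l → λ₁⁺ k ℤ.≤ κ₀ (suc k)
    capped′ k k<l with k ℕ.≟ k₁
    ... | yes refl = subst (ℤ._≤ κ₀ (suc k)) (cong (λ z → λ₁ k + z) (sym (δ-≡ k))) (unsaturated k<l)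
    ... | no k≢k₁  = subst (ℤ._≤ κ₀ (suc k)) (sym (same k≢k₁)) (capped R₁ k k<l)
    tight′ : ∀ k → suc k < l → λ₁⁺ k ≡ κ₀ (suc k) ⊎ carry κ₀ κ₁⁺ λ₀ λ₁⁺ (suc k) ≡ 0ℤ
    tight′ k k<l with place (suc k)
    ... | inside _ (s≤s k₀≤k) k<k₁ = inj₁ (trans (same (ℕ.<⇒≢ k<k₁)) (saturated k k₀≤k k<k₁))
    ... | outside z _ with k ℕ.≟ k₁
    ...   | yes refl = inj₂ (trans (c⁺-outside (ℕ.<⇒≤ k<l) z) c-k₁)
    ...   | no k≢k₁ with tight R₁ k k<l
    ...     | inj₁ p = inj₁ (trans (same k≢k₁) p)
    ...     | inj₂ p = inj₂ (trans (c⁺-outside (ℕ.<⇒≤ k<l) z) p)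

  rule₂ : RowRule l κ₁⁺ κ₂ λ₁⁺ λ₂
  rule₂ = record
    { nonneg = nonneg′
    ; total  = trans (d⁺-outside ℕ.≤-refl jump-l) (total R₂)
    ; capped = capped′
    ; tight  = tight′
    }
    where
    nonneg′ : ∀ k → k ≤ l → 0ℤ ℤ.≤ carry κ₁⁺ κ₂ λ₁⁺ λ₂ k
    nonneg′ k k≤l with place k
    ... | outside z _  = subst (0ℤ ℤ.≤_) (sym (d⁺-outside k≤l z)) (nonneg R₂ k k≤l)
    ... | inside z p q = subst (0ℤ ℤ.≤_) (sym (trans (d⁺ k k≤l) (cong (λ z → d k - z) z)))
                           (Δ (positive k p q))
    capped′ : ∀ k → suc k < l → λ₂ k ℤ.≤ κ₁⁺ (suc k)
    capped′ k k<l = ℤ.≤-trans (capped R₂ k k<l) (subst (κ₁ (suc k) ℤ.≤_) (sym (raised (suc k) k<l))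
      (lem (κ₁ (suc k)) (δ k₀ (suc k)) (δ≥0 k₀ (suc k))))
      where
      lem : ∀ x y → 0ℤ ℤ.≤ y → x ℤ.≤ x + y
      lem x y p = ≤-by p (solve (x ∷ y ∷ []))
    tight′ : ∀ k → suc k < l → λ₂ k ≡ κ₁⁺ (suc k) ⊎ carry κ₁⁺ κ₂ λ₁⁺ λ₂ (suc k) ≡ 0ℤ
    tight′ k k<l with suc k ℕ.≟ k₀
    -- At `k₀` the cap has grown by one and is no longer attained for sure, but no carry arrives
    -- there.
    ... | yes refl = inj₂ (trans (d⁺-outside (ℕ.<⇒≤ k<l)
            (cong₂ _-_ (jump-≤ (suc k) ℕ.≤-refl) (jump-≤ (suc k) k₀≤k₁))) d-k₀)
    ... | no k≢k₀ with tight R₂ k k<l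
    ...   | inj₁ p = inj₁ (trans p (sym (trans (raised (suc k) k<l)
                       (trans (cong (λ z → κ₁ (suc k) + z) (δ-≢ (k≢k₀ ∘ sym))) (ℤ.+-identityʳ _)))))
    ...   | inj₂ p with place (suc k)
    ...     | outside z _  = inj₂ (trans (d⁺-outside (ℕ.<⇒≤ k<l) z) p)
    ...     | inside _ q r = contradiction (subst (1ℤ ℤ.≤_) p (positive (suc k) q r)) 1≰0

-- Signatures

-- Total in the row index, with junk value 0 from `l` on, so that row functions carry no bound
-- proofs.
fromBottom : ∀ {l} → Vec ℤ l → ℕ → ℤ
fromBottom Vec.[]              k = 0ℤ
fromBottom (Vec._∷_ {n = l} x v) k = if does (k ℕ.≟ l) then x else fromBottom v k

fromBottom-top : ∀ {l} x (v : Vec ℤ l) → fromBottom (x Vec.∷ v) l ≡ x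
fromBottom-top {l} x v rewrite dec-true (l ℕ.≟ l) refl = refl

fromBottom-< : ∀ {l} x (v : Vec ℤ l) {k} → k < l → fromBottom (x Vec.∷ v) k ≡ fromBottom v k
fromBottom-< {l} x v {k} k<l rewrite dec-false (k ℕ.≟ l) (ℕ.<⇒≢ k<l) = refl

fromBottom-lookup : ∀ {l} (v : Vec ℤ l) j → fromBottom v (l ∸ suc (toℕ j)) ≡ Vec.lookup v j
fromBottom-lookup (x Vec.∷ v) Fin.zero    = fromBottom-top x v
fromBottom-lookup {suc l} (x Vec.∷ v) (Fin.suc j) =
  trans (fromBottom-< x v (ℕ.∸-monoʳ-< (s≤s z≤n) (Fin.toℕ<n j))) (fromBottom-lookup v j)

fromBottom-ext : ∀ {l} (v w : Vec ℤ l) → (∀ k → k < l → fromBottom v k ≡ fromBottom w k) → v ≡ w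
fromBottom-ext Vec.[]      Vec.[]      _  = refl
fromBottom-ext {suc l} (x Vec.∷ v) (y Vec.∷ w) eq = cong₂ Vec._∷_
  (trans (sym (fromBottom-top x v)) (trans (eq l ℕ.≤-refl) (fromBottom-top y w)))
  (fromBottom-ext v w λ k k<l → trans (sym (fromBottom-< x v k<l))
    (trans (eq k (ℕ.m<n⇒m<1+n k<l)) (fromBottom-< y w k<l)))

tabulateBottom : ∀ l → (ℕ → ℤ) → Vec ℤ l
tabulateBottom zero    f = Vec.[]
tabulateBottom (suc l) f = f l Vec.∷ tabulateBottom l f

fromBottom-tabulate : ∀ {l} f k → k < l → fromBottom (tabulateBottom l f) k ≡ f k
fromBottom-tabulate {suc l} f k (s≤s k≤l) with ℕ.m≤n⇒m<n∨m≡n k≤l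
... | inj₁ k<l  = trans (fromBottom-< (f l) (tabulateBottom l f) k<l) (fromBottom-tabulate f k k<l)
... | inj₂ refl = fromBottom-top (f l) (tabulateBottom l f)

row : ∀ {l} → Sig l → ℕ → ℤ
row α = fromBottom (entries α)

∸-suc : ∀ {k l} → k < l → l ∸ k ≡ suc (l ∸ suc k)
∸-suc k<l = ℕ.+-∸-assoc 1 k<l

row-ext : ∀ {l} {α β : Sig l} → (∀ k → k < l → row α k ≡ row β k) → α ≡ β
row-ext {l} {sig v p} {sig w q} eq with refl ← fromBottom-ext v w eq = refl

row-lookup : ∀ {l} (α : Sig l) j → row α (l ∸ suc (toℕ j)) ≡ α ‼ j
row-lookup α = fromBottom-lookup (entries α)

index : ∀ {l k} → k < l → Fin l
index k<l = Fin.opposite (Fin.fromℕ< k<l)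

toℕ-index : ∀ {l k} (k<l : k < l) → toℕ (index k<l) ≡ l ∸ suc k
toℕ-index {l} k<l =
  trans (Fin.opposite-prop (Fin.fromℕ< k<l)) (cong (λ z → l ∸ suc z) (Fin.toℕ-fromℕ< k<l))

row-index : ∀ {l k} (α : Sig l) (k<l : k < l) → row α k ≡ α ‼ index k<l
row-index {l} {k} α k<l = trans (cong (row α) (sym eq)) (row-lookup α (index k<l))
  where
  eq : l ∸ suc (toℕ (index k<l)) ≡ k
  eq = trans (cong (λ z → l ∸ suc z) (toℕ-index k<l))
       (trans (cong (l ∸_) (sym (∸-suc k<l))) (ℕ.m∸[m∸n]≡n (ℕ.<⇒≤ k<l)))

index-suc : ∀ {l k} (k<l : suc k < l) → toℕ (index (ℕ.<⇒≤ k<l)) ≡ suc (toℕ (index k<l))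
index-suc k<l = trans (toℕ-index (ℕ.<⇒≤ k<l)) (trans (∸-suc k<l) (cong suc (sym (toℕ-index k<l))))

≼⇒interlaced : ∀ {l} {κ μ : Sig l} → κ ≼ μ → Interlaced l (row κ) (row μ)
≼⇒interlaced {κ = κ} {μ} h = record
  { below = λ k k<l → subst₂ ℤ._≤_ (sym (row-index κ k<l)) (sym (row-index μ k<l)) (_≼_.lower h _)
  ; above = λ k k<l → subst₂ ℤ._≤_ (sym (row-index μ (ℕ.<⇒≤ k<l))) (sym (row-index κ k<l))
                        (_≼_.upper h _ _ (index-suc k<l)) }

module _ {l : ℕ} (i j : Fin l) (eq : toℕ j ≡ suc (toℕ i)) where

  bottom : ℕ
  bottom = l ∸ suc (toℕ j)

  bottom-suc : suc bottom ≡ l ∸ suc (toℕ i)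
  bottom-suc = trans (sym (∸-suc (Fin.toℕ<n j))) (cong (l ∸_) eq)

  bottom-< : suc bottom < l
  bottom-< = subst (_< l) (sym bottom-suc) (ℕ.∸-monoʳ-< (s≤s z≤n) (Fin.toℕ<n i))

interlaced⇒≼ : ∀ {l} {κ μ : Sig l} → Interlaced l (row κ) (row μ) → κ ≼ μ
interlaced⇒≼ {l} {κ} {μ} h = record
  { lower = λ j → subst₂ ℤ._≤_ (row-lookup κ j) (row-lookup μ j)
      (Interlaced.below h _ (ℕ.∸-monoʳ-< (s≤s z≤n) (Fin.toℕ<n j)))
  ; upper = λ i j eq → subst₂ ℤ._≤_ (row-lookup μ j)
      (trans (cong (row κ) (bottom-suc i j eq)) (row-lookup κ i))
      (Interlaced.above h _ (bottom-< i j eq)) }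

row-↑ : ∀ {l} (α : Sig l) → Increasing l (row α)
row-↑ α@(sig v v↓) k k<l = subst₂ ℤ._≤_ (sym (row-index α (ℕ.<⇒≤ k<l))) (sym (row-index α k<l))
  (recompute (_ ℤ.≤? _) (v↓ (index k<l) (index (ℕ.<⇒≤ k<l)) (index-suc k<l)))

fromRows : ∀ l (f : ℕ → ℤ) → Increasing l f → Sig l
fromRows l f f↑ = sig (tabulateBottom l f) λ i j eq → subst₂ ℤ._≤_
  (trans (sym (fromBottom-tabulate f (bottom i j eq) (ℕ.<⇒≤ (bottom-< i j eq)))) (fromBottom-lookup (tabulateBottom l f) j))
  (trans (sym (fromBottom-tabulate f (suc (bottom i j eq)) (bottom-< i j eq)))
    (trans (cong (fromBottom (tabulateBottom l f)) (bottom-suc i j eq)) (fromBottom-lookup (tabulateBottom l f) i)))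
  (f↑ (bottom i j eq) (bottom-< i j eq))

row-fromRows : ∀ {l f} (f↑ : Increasing l f) k → k < l → row (fromRows l f f↑) k ≡ f k
row-fromRows {f = f} f↑ = fromBottom-tabulate f

count-fromBottom : ∀ {l} x (v : Vec ℤ l) → + Vec.count (x ℤ.≤?_) v ≡ countTo (fromBottom v) l x
count-fromBottom x Vec.[] = refl
count-fromBottom {suc l} x (y Vec.∷ v) = trans (head (Vec.count (x ℤ.≤?_) v) (does (x ℤ.≤? y)))
  (cong₂ _+_ (trans (count-fromBottom x v)
      (sumTo-cong l λ k k<l → cong (ind x) (sym (fromBottom-< y v k<l))))
    (cong (ind x) (sym (fromBottom-top y v))))
  where
  head : ∀ n b → + (if b then suc else (λ m → m)) n ≡ + n + (if b then 1ℤ else 0ℤ)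
  head n true  = cong +_ (ℕ.+-comm 1 n)
  head n false = cong +_ (sym (ℕ.+-identityʳ n))

conj-countTo : ∀ {l} (α : Sig l) x → + conj α x ≡ countTo (row α) l x
conj-countTo α x = count-fromBottom x (entries α)

fominRule⇒rule : ∀ {l} {κ μ α ν : Sig l} (F : FominRule κ μ α ν) →
                 Rule l (row κ) (row μ) (row α) (row ν) (FominRule.c F)
fominRule⇒rule {l} {κ = κ} {μ} {α} {ν} F = record
  { vanishing = vanishing
  ; recursion = λ x → trans (recursion x) (cong (0ℤ ⊔_)
      (cong (λ z → z + c (x - 1ℤ) - 1ℤ) (cong₂ _+_ (gap≡ μ x) (gap≡ α x))))
  ; conjugate = λ x → trans (sym (conj-countTo ν x)) (trans (conjugate x)
      (cong (λ z → z + c (x - 1ℤ) - c x)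
        (cong₂ _-_ (cong₂ _+_ (conj-countTo μ x) (conj-countTo α x)) (conj-countTo κ x)))) }
  where
  open FominRule F
  gap≡ : ∀ β x → gap κ β x ≡ countTo (row β) l x - countTo (row κ) l x
  gap≡ β x = cong₂ _-_ (conj-countTo β x) (conj-countTo κ x)

-- The local rule without its sequence c and with inequalities at κ only; those at ν follow, as in
-- `μ≼ν`. Cells exist, are unique and are symmetric, and this is what growth diagrams are built on.
record Cell {l} (κ μ α ν : Sig l) : Set where
  field
    κ≼μ  : κ ≼ μ
    κ≼α  : κ ≼ α
    rule : RowRule l (row κ) (row μ) (row α) (row ν)

  μ≼ν : μ ≼ ν
  μ≼ν = interlaced⇒≼ (rowRule-interlaced rule (≼⇒interlaced κ≼μ) (≼⇒interlaced κ≼α))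

fomin-cell : ∀ {l} {κ μ α ν : Sig l} → κ ≼ μ → κ ≼ α → μ ≼ ν → α ≼ ν → FominRule κ μ α ν → Cell κ μ α ν
fomin-cell {l} {κ} {μ} {α} {ν} κμ κα μν αν F = record
  { κ≼μ = κμ ; κ≼α = κα ; rule = FR.rowRule }
  where
  module L = Local l (row κ) (row μ) (row α) (row ν) (≼⇒interlaced κμ) (≼⇒interlaced κα)
                   (≼⇒interlaced μν) (≼⇒interlaced αν)
  module FR = L.FromRule (FominRule.c F) (fominRule⇒rule F)

cell-unique : ∀ {l} {κ μ α ν ν′ : Sig l} → Cell κ μ α ν → Cell κ μ α ν′ → ν ≡ ν′
cell-unique C C′ = row-ext (rowRule-unique (Cell.rule C) (Cell.rule C′))

cell-sym : ∀ {l} {κ μ α ν : Sig l} → Cell κ μ α ν → Cell κ α μ ν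
cell-sym C = record { κ≼μ = κ≼α ; κ≼α = κ≼μ ; rule = rowRule-sym rule }
  where open Cell C

rowRule-cong : ∀ {l κ μ α α′ ν ν′} → (∀ k → k < l → α k ≡ α′ k) → (∀ k → k < l → ν k ≡ ν′ k) →
               RowRule l κ μ α ν → RowRule l κ μ α′ ν′
rowRule-cong {l} {κ} {μ} {α} {α′} {ν} {ν′} α≡ ν≡ R = record
  { nonneg = λ k k≤l → subst (0ℤ ℤ.≤_) (carry≡ k k≤l) (nonneg k k≤l)
  ; total  = trans (sym (carry≡ l ℕ.≤-refl)) total
  ; capped = λ k k<l → subst (ℤ._≤ κ (suc k)) (ν≡ k (ℕ.<⇒≤ k<l)) (capped k k<l)
  ; tight  = λ k k<l → case tight k k<l of λ where
      (inj₁ p) → inj₁ (trans (sym (ν≡ k (ℕ.<⇒≤ k<l))) p)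
      (inj₂ p) → inj₂ (trans (sym (carry≡ (suc k) (ℕ.<⇒≤ k<l))) p) }
  where
  open RowRule R
  carry≡ : ∀ k → k ≤ l → carry κ μ α ν k ≡ carry κ μ α′ ν′ k
  carry≡ k k≤l = sumTo-cong k λ m m<k → let m<l = ℕ.≤-trans m<k k≤l in
    cong₂ (λ a n → μ m + a - κ m - n) (α≡ m m<l) (ν≡ m m<l)

cell-exists : ∀ {l} {κ μ α : Sig l} → κ ≼ μ → κ ≼ α → ∃[ ν ] Cell κ μ α ν
cell-exists {l} {κ} {μ} {α} κμ κα = fromRows l _ ν↑ , record
  { κ≼μ = κμ ; κ≼α = κα
  ; rule = rowRule-cong (λ _ _ → refl) (λ k k<l → sym (row-fromRows ν↑ k k<l)) R }
  where
  R : RowRule l (row κ) (row μ) (row α) _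
  R = rowRule-exists
  ν↑ = interlaced-↑ʳ (rowRule-interlaced R (≼⇒interlaced κμ) (≼⇒interlaced κα))

≼-refl : ∀ {l} {κ : Sig l} → κ ≼ κ
≼-refl {κ = κ} = interlaced⇒≼ record
  { below = λ _ _ → ℤ.≤-refl ; above = row-↑ κ }

-- An edge without cells passes unchanged through the diagram. This is what allows chains to be
-- continued by constants.
cell-flat : ∀ {l} {κ α : Sig l} → κ ≼ α → Cell κ κ α α
cell-flat {l} {κ} {α} κα = record
  { κ≼μ = ≼-refl ; κ≼α = κα
  ; rule = record
      { nonneg = λ k _ → ℤ.≤-reflexive (sym (zero-carry k))
      ; total  = zero-carry l
      ; capped = Interlaced.above (≼⇒interlaced κα)
      ; tight  = λ k _ → inj₂ (zero-carry (suc k)) } }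
  where
  lem : ∀ κ α → κ + α - κ - α ≡ 0ℤ
  lem κ α = solve (κ ∷ α ∷ [])
  zero-carry : ∀ k → carry (row κ) (row κ) (row α) (row α) k ≡ 0ℤ
  zero-carry zero    = refl
  zero-carry (suc k) = cong₂ _+_ (zero-carry k) (lem (row κ k) (row α k))

Raises : ∀ {l} (κ₀ κ₁ κ₂ κ₁⁺ : Sig l) → Set
Raises {l} κ₀ κ₁ κ₂ κ₁⁺ = Raise l (row κ₀) (row κ₁) (row κ₂) (row κ₁⁺)

cell-raise : ∀ {l} {κ₀ κ₁ κ₂ κ₁⁺ λ₀ λ₁ λ₂ : Sig l} → Raises κ₀ κ₁ κ₂ κ₁⁺ →
             κ₀ ≼ κ₁⁺ → κ₁⁺ ≼ κ₂ → Cell κ₀ κ₁ λ₀ λ₁ → Cell κ₁ κ₂ λ₁ λ₂ →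
             ∃[ λ₁⁺ ] Raises λ₀ λ₁ λ₂ λ₁⁺ × Cell κ₀ κ₁⁺ λ₀ λ₁⁺ × Cell κ₁⁺ κ₂ λ₁⁺ λ₂
cell-raise {l} {κ₀} {κ₁⁺ = κ₁⁺} {λ₀} {λ₁} {λ₂} E κ₀κ₁⁺ κ₁⁺κ₂ C₁ C₂ =
  λ₁⁺ , raise′ , record { κ≼μ = κ₀κ₁⁺ ; κ≼α = κ₀≼λ₀ ; rule = rule₁′ } ,
  record { κ≼μ = κ₁⁺κ₂ ; κ≼α = interlaced⇒≼ (rowRule-interlaced rule₁′ (≼⇒interlaced κ₀κ₁⁺) (≼⇒interlaced κ₀≼λ₀))
         ; rule = rowRule-cong same (λ _ _ → refl) rule₂ }
  where
  open Commute E (Cell.rule C₁) (Cell.rule C₂) using (raise; rule₁; rule₂) renaming (λ₁⁺ to f)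
  κ₀≼λ₀ = Cell.κ≼α C₁
  f↑ = interlaced-↑ʳ (rowRule-interlaced rule₁ (≼⇒interlaced κ₀κ₁⁺) (≼⇒interlaced κ₀≼λ₀))
  λ₁⁺ = fromRows l f f↑
  same : ∀ k → k < l → f k ≡ row λ₁⁺ k
  same k k<l = sym (row-fromRows f↑ k k<l)
  rule₁′ = rowRule-cong (λ _ _ → refl) same rule₁
  raise′ : Raises λ₀ λ₁ λ₂ λ₁⁺
  raise′ = record
    { k₀ = Raise.k₀ raise ; k₀<l = Raise.k₀<l raise
    ; raised = λ k k<l → trans (sym (same k k<l)) (Raise.raised raise k k<l)
    ; lower = Raise.lower raise ; upper = Raise.upper raise }

-- Bracket words

source target : Kind → ℕ → ℕ
source Kind.e i = suc (suc i)
source Kind.f i = suc i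
target Kind.e i = suc i
target Kind.f i = suc (suc i)

module Brackets (i : ℕ) where

  cl op : ℕ
  cl = suc i
  op = suc (suc i)

  data Letter (x : ℕ) : Bool → Bool → Set where
    closes : x ≡ cl → Letter x true false
    opens  : x ≡ op → Letter x false true
    other  : x ≢ cl → x ≢ op → Letter x false false

  letter : ∀ x → Letter x (does (x ℕ.≟ cl)) (does (x ℕ.≟ op))
  letter x = classify (x ℕ.≟ cl) (x ℕ.≟ op)
    where
    classify : (p : Dec (x ≡ cl)) (q : Dec (x ≡ op)) → Letter x (does p) (does q)
    classify (yes refl) (yes ())
    classify (yes p)    (no _)  = closes p
    classify (no _)     (yes q) = opens q
    classify (no p)     (no q)  = other p q

  -- The numbers of unpaired closing and of unpaired opening brackets.
  r o : Row → ℕ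
  r []      = 0
  r (x ∷ w) = if does (x ℕ.≟ cl) then suc (r w)
              else if does (x ℕ.≟ op) then pred (r w) else r w
  o []      = 0
  o (x ∷ w) = if does (x ℕ.≟ cl) then o w
              else if does (x ℕ.≟ op) then (case r w of λ where
                zero    → suc (o w)
                (suc _) → o w)
              else o w

  r-++ : ∀ v {w} → o v ≡ 0 → r (v ++ w) ≡ r v ℕ.+ r w
  r-++ []      _ = refl
  r-++ (x ∷ v) {w} o≡0 with does (x ℕ.≟ cl) | does (x ℕ.≟ op)
  ... | true  | _     = cong suc (r-++ v o≡0)
  ... | false | false = r-++ v o≡0
  ... | false | true with r v in eq
  ...   | suc k = cong pred (trans (r-++ v o≡0) (cong (ℕ._+ r w) eq))

  -- Positions, counted from `s`, of the unpaired closing and opening brackets. Reading from the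
  -- right, an opening bracket meets the nearest unpaired closing one, the head of the first list.
  stack : ℕ → Row → List ℕ × List ℕ
  stack s []      = [] , []
  stack s (x ∷ w) = if does (x ℕ.≟ cl) then (s ∷ proj₁ (stack (suc s) w) , proj₂ (stack (suc s) w))
                    else if does (x ℕ.≟ op) then (case stack (suc s) w of λ where
                      ([]     , os) → [] , s ∷ os
                      (_ ∷ cs , os) → cs , os)
                    else stack (suc s) w

  length-stack : ∀ s w → length (proj₁ (stack s w)) ≡ r w
  length-stack s []      = refl
  length-stack s (x ∷ w) with does (x ℕ.≟ cl) | does (x ℕ.≟ op)
  ... | true  | _     = cong suc (length-stack (suc s) w)
  ... | false | false = length-stack (suc s) w
  ... | false | true with stack (suc s) w in eq
  ...   | []     , os = cong pred (trans (cong (length ∘ proj₁) (sym eq)) (length-stack (suc s) w))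
  ...   | _ ∷ cs , os = cong pred (trans (cong (length ∘ proj₁) (sym eq)) (length-stack (suc s) w))

  render : List ℕ × List ℕ → List (ℕ × Bracket)
  render (cs , os) = List.map (_, ⟩) cs ++ List.map (_, ⟨) os

  push : ℕ → ℕ → List (ℕ × Bracket) → List (ℕ × Bracket)
  push p x bs = if does (x ℕ.≟ cl) then (p , ⟩) ∷ bs
                else if does (x ℕ.≟ op) then (case bs of λ where
                  ((_ , ⟩) ∷ bs) → bs
                  bs             → (p , ⟨) ∷ bs)
                else bs

  render-stack : ∀ s w (g : ℕ → ℕ) → (∀ k → g k ≡ s ℕ.+ k) →
    foldr (λ (p , x) → push p x) [] (zip (applyUpTo g (length w)) w) ≡ render (stack s w)
  render-stack s []      g eq = refl
  render-stack s (x ∷ w) g eq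
    rewrite render-stack (suc s) w (g ∘ suc) (λ k → trans (eq (suc k)) (ℕ.+-suc s k))
          | trans (eq 0) (ℕ.+-identityʳ s)
    with does (x ℕ.≟ cl) | does (x ℕ.≟ op)
  ... | true  | _     = refl
  ... | false | false = refl
  ... | false | true with stack (suc s) w
  ...   | [] , []    = refl
  ...   | [] , _ ∷ _ = refl
  ...   | _ ∷ _ , _  = refl

  unpaired-stack : ∀ n w → unpaired n (suc i) w ≡ render (stack 0 w)
  unpaired-stack n w = trans (List.foldr-cong (λ where
      (p , x) []              → refl
      (p , x) ((_ , ⟩) ∷ bs) → refl
      (p , x) ((_ , ⟨) ∷ bs) → refl) refl (zip (upTo (length w)) w))
    (render-stack 0 w (λ k → k) (λ _ → refl))

  openings-render : ∀ cs os → openings (render (cs , os)) ≡ os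
  openings-render []       []       = refl
  openings-render []       (q ∷ os) = cong (q ∷_) (openings-render [] os)
  openings-render (_ ∷ cs) os       = openings-render cs os

  closings-render : ∀ cs os → closings (render (cs , os)) ≡ cs
  closings-render []       []       = refl
  closings-render []       (_ ∷ os) = closings-render [] os
  closings-render (c ∷ cs) os       = cong (c ∷_) (closings-render cs os)

  -- The acting bracket is the one with no unpaired opening bracket to its left
  -- and no unpaired closing bracket to its right, for both e and f.
  record Split (x : ℕ) (s p : ℕ) (w : Row) : Set where
    constructor split
    field
      {before after} : Row
      word  : w ≡ before ++ x ∷ after
      place : p ≡ s ℕ.+ length before
      o≡0   : o before ≡ 0
      r≡0   : r after ≡ 0

  position : Kind → List ℕ × List ℕ → Maybe ℕ
  position Kind.e (_ , os) = List.head os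
  position Kind.f (cs , _) = List.last cs

  r-cl : ∀ w → r (cl ∷ w) ≡ suc (r w)
  r-cl w rewrite dec-true (cl ℕ.≟ cl) refl = refl

  r-op : ∀ w → r (op ∷ w) ≡ pred (r w)
  r-op w rewrite dec-false (op ℕ.≟ cl) (λ ()) | dec-true (op ℕ.≟ op) refl = refl

  o-cl : ∀ w → o (cl ∷ w) ≡ o w
  o-cl w rewrite dec-true (cl ℕ.≟ cl) refl = refl

  o-op : ∀ w {k} → r w ≡ suc k → o (op ∷ w) ≡ o w
  o-op w eq rewrite dec-false (op ℕ.≟ cl) (λ ()) | dec-true (op ℕ.≟ op) refl | eq = refl

  o-op₀ : ∀ w → r w ≡ 0 → o (op ∷ w) ≡ suc (o w)
  o-op₀ w eq rewrite dec-false (op ℕ.≟ cl) (λ ()) | dec-true (op ℕ.≟ op) refl | eq = refl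

  o-op⁻ : ∀ w → o (op ∷ w) ≡ 0 → o w ≡ 0 × ∃[ k ] r w ≡ suc k
  o-op⁻ w eq = go (r w) refl
    where
    go : ∀ m → r w ≡ m → o w ≡ 0 × ∃[ k ] r w ≡ suc k
    go zero    rw = contradiction (trans (sym (o-op₀ w rw)) eq) λ ()
    go (suc k) rw = trans (sym (o-op w rw)) eq , k , rw

  r-other : ∀ {x} w → x ≢ cl → x ≢ op → r (x ∷ w) ≡ r w
  r-other {x} w p q rewrite dec-false (x ℕ.≟ cl) p | dec-false (x ℕ.≟ op) q = refl

  o-other : ∀ {x} w → x ≢ cl → x ≢ op → o (x ∷ w) ≡ o w
  o-other {x} w p q rewrite dec-false (x ℕ.≟ cl) p | dec-false (x ℕ.≟ op) q = refl

  prepend : ∀ {x s p w} y (S : Split x (suc s) p w) → o (y ∷ Split.before S) ≡ 0 → Split x s p (y ∷ w)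
  prepend {s = s} y (split {before} word place o≡0 r≡0) o≡0′ =
    split {before = y ∷ before} (cong (y ∷_) word) (trans place (sym (ℕ.+-suc s (length before)))) o≡0′ r≡0

  split-here : ∀ x s w → r w ≡ 0 → Split x s s (x ∷ w)
  split-here x s w r≡0 = split {before = []} refl (sym (ℕ.+-identityʳ s)) refl r≡0

  -- Here k stands for the closing brackets that survive from the acting letter on. As `w` has more
  -- of them, one lies in `before`; it pairs with the new opening bracket, so that `before` still
  -- leaves none unpaired.
  prepend-op : ∀ {x s p w k} (S : Split x (suc s) p w) → r w ≡ r (Split.before S) ℕ.+ k → k < r w →
               Split x s p (op ∷ w)
  prepend-op {w = w} {k} S@(split {before} word _ o≡0 _) eq k<r with r before in req
  ... | zero  = contradiction eq (ℕ.<⇒≢ k<r ∘ sym)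
  ... | suc m = prepend op S (trans (o-op before req) o≡0)

  r-split : ∀ {x s p w} (S : Split x s p w) → r w ≡ r (Split.before S) ℕ.+ r (x ∷ Split.after S)
  r-split (split {before} refl _ o≡0 _) = r-++ before o≡0

  last-just : ∀ (cs : List ℕ) {p} c → List.last cs ≡ just p → List.last (c ∷ cs) ≡ just p
  last-just (_ ∷ _) c eq = eq

  act-split : ∀ k s w {p} → position k (stack s w) ≡ just p → Split (source k i) s p w
  act-split Kind.e s [] ()
  act-split Kind.f s [] ()
  act-split k s (x ∷ w) eq with does (x ℕ.≟ cl) | does (x ℕ.≟ op) | letter x
  act-split k s (x ∷ w) eq | _ | _ | other p q =
    let S = act-split k (suc s) w eq
    in prepend x S (trans (o-other (Split.before S) p q) (Split.o≡0 S))
  act-split Kind.e s (x ∷ w) eq | _ | _ | closes refl =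
    let S = act-split Kind.e (suc s) w eq
    in prepend cl S (trans (o-cl (Split.before S)) (Split.o≡0 S))
  act-split Kind.f s (x ∷ w) eq | _ | _ | closes refl with proj₁ (stack (suc s) w) in st
  ... | [] with refl ← just-injective eq =
    split-here cl s w (trans (sym (length-stack (suc s) w)) (cong length st))
  ... | c ∷ cs =
    let S = act-split Kind.f (suc s) w (trans (cong List.last st) eq)
    in prepend cl S (trans (o-cl (Split.before S)) (Split.o≡0 S))
  act-split Kind.e s (x ∷ w) eq | _ | _ | opens refl with stack (suc s) w in st
  ... | [] , os with refl ← just-injective eq =
    split-here op s w (trans (sym (length-stack (suc s) w)) (cong (length ∘ proj₁) st))
  ... | c ∷ cs , os =
    let S = act-split Kind.e (suc s) w (trans (cong (List.head ∘ proj₂) st) eq)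
        rw = trans (sym (length-stack (suc s) w)) (cong (length ∘ proj₁) st)
    in prepend-op {k = 0} S
         (trans (r-split S) (cong (r (Split.before S) ℕ.+_) (trans (r-op (Split.after S)) (cong pred (Split.r≡0 S)))))
         (subst (0 <_) (sym rw) (s≤s z≤n))
  act-split Kind.f s (x ∷ w) eq | _ | _ | opens refl with stack (suc s) w in st
  ... | c ∷ cs@(_ ∷ _) , os =
    let S = act-split Kind.f (suc s) w (trans (cong (List.last ∘ proj₁) st) (last-just cs c eq))
        rw = trans (sym (length-stack (suc s) w)) (cong (length ∘ proj₁) st)
    in prepend-op {k = 1} S
         (trans (r-split S) (cong (r (Split.before S) ℕ.+_) (trans (r-cl (Split.after S)) (cong suc (Split.r≡0 S)))))
         (subst (1 <_) (sym rw) (s≤s (s≤s z≤n)))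

  stack-cl : ∀ s w → stack s (cl ∷ w) ≡ (s ∷ proj₁ (stack (suc s) w) , proj₂ (stack (suc s) w))
  stack-cl s w rewrite dec-true (cl ℕ.≟ cl) refl = refl

  stack-op₀ : ∀ s w {os} → stack (suc s) w ≡ ([] , os) → stack s (op ∷ w) ≡ ([] , s ∷ os)
  stack-op₀ s w eq rewrite dec-false (op ℕ.≟ cl) (λ ()) | dec-true (op ℕ.≟ op) refl | eq = refl

  stack-op₁ : ∀ s w {c cs os} → stack (suc s) w ≡ (c ∷ cs , os) → stack s (op ∷ w) ≡ (cs , os)
  stack-op₁ s w eq rewrite dec-false (op ℕ.≟ cl) (λ ()) | dec-true (op ℕ.≟ op) refl | eq = refl

  stack-other : ∀ {x} s w → x ≢ cl → x ≢ op → stack s (x ∷ w) ≡ stack (suc s) w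
  stack-other {x} s w p q rewrite dec-false (x ℕ.≟ cl) p | dec-false (x ℕ.≟ op) q = refl

  split-act : ∀ k s v w → o v ≡ 0 → r w ≡ 0 →
              position k (stack s (v ++ source k i ∷ w)) ≡ just (s ℕ.+ length v)
  split-act Kind.e s [] w _ r≡0 = go (stack (suc s) w) refl
    where
    go : ∀ st → stack (suc s) w ≡ st → List.head (proj₂ (stack s (op ∷ w))) ≡ just (s ℕ.+ 0)
    go ([] , os)    st = trans (cong (position Kind.e) (stack-op₀ s w st)) (cong just (sym (ℕ.+-identityʳ s)))
    go (_ ∷ _ , os) st = contradiction (trans (trans (sym (cong (length ∘ proj₁) st)) (length-stack (suc s) w)) r≡0) λ ()
  split-act Kind.f s [] w _ r≡0 = go (stack (suc s) w) refl
    where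
    go : ∀ st → stack (suc s) w ≡ st → List.last (proj₁ (stack s (cl ∷ w))) ≡ just (s ℕ.+ 0)
    go ([] , os)    st = trans (cong (position Kind.f) (stack-cl s w))
                       (trans (cong (λ z → List.last (s ∷ proj₁ z)) st) (cong just (sym (ℕ.+-identityʳ s))))
    go (_ ∷ _ , os) st = contradiction (trans (trans (sym (cong (length ∘ proj₁) st)) (length-stack (suc s) w)) r≡0) λ ()
  split-act k s (x ∷ v) w o≡0 r≡0 rewrite ℕ.+-suc s (length v) = go k (letter x)
    where
    go : ∀ k {b b′} → Letter x b b′ → position k (stack s (x ∷ v ++ source k i ∷ w)) ≡ just (suc (s ℕ.+ length v))
    go k (other p q) = trans (cong (position k) (stack-other s (v ++ source k i ∷ w) p q))
      (split-act k (suc s) v w (trans (sym (o-other v p q)) o≡0) r≡0)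
    go Kind.e (closes refl) = trans (cong (position Kind.e) (stack-cl s (v ++ op ∷ w)))
      (split-act Kind.e (suc s) v w (trans (sym (o-cl v)) o≡0) r≡0)
    go Kind.f (closes refl) = trans (cong (position Kind.f) (stack-cl s (v ++ cl ∷ w)))
      (last-just (proj₁ (stack (suc s) (v ++ cl ∷ w))) s
        (split-act Kind.f (suc s) v w (trans (sym (o-cl v)) o≡0) r≡0))
    go Kind.e (opens refl) with o-op⁻ v o≡0
    ... | ov , m , rv = go′ (stack (suc s) (v ++ op ∷ w)) refl
      where
      go′ : ∀ st → stack (suc s) (v ++ op ∷ w) ≡ st →
            position Kind.e (stack s (op ∷ v ++ op ∷ w)) ≡ just (suc (s ℕ.+ length v))
      go′ ([] , os) st = contradiction
        (trans (sym (cong (length ∘ proj₁) st)) (trans (length-stack (suc s) (v ++ op ∷ w))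
          (trans (r-++ v ov) (cong (ℕ._+ r (op ∷ w)) rv)))) λ ()
      go′ (c ∷ cs , os) st = trans (cong (position Kind.e) (stack-op₁ s (v ++ op ∷ w) st))
        (trans (cong (List.head ∘ proj₂) (sym st)) (split-act Kind.e (suc s) v w ov r≡0))
    go Kind.f (opens refl) with o-op⁻ v o≡0
    ... | ov , m , rv = go′ (stack (suc s) (v ++ cl ∷ w)) refl
      where
      len : ∀ {cs os} → stack (suc s) (v ++ cl ∷ w) ≡ (cs , os) → length cs ≡ suc m ℕ.+ suc (r w)
      len st = trans (sym (cong (length ∘ proj₁) st)) (trans (length-stack (suc s) (v ++ cl ∷ w))
        (trans (r-++ v ov) (cong₂ ℕ._+_ rv (r-cl w))))
      go′ : ∀ st → stack (suc s) (v ++ cl ∷ w) ≡ st →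
            position Kind.f (stack s (op ∷ v ++ cl ∷ w)) ≡ just (suc (s ℕ.+ length v))
      go′ ([] , os) st = contradiction (len st) λ ()
      go′ (c ∷ [] , os) st = contradiction (ℕ.suc-injective (len st))
        (ℕ.<⇒≢ (ℕ.≤-trans (s≤s z≤n) (ℕ.m≤n+m (suc (r w)) m)))
      go′ (c ∷ cs@(_ ∷ _) , os) st = trans (cong (position Kind.f) (stack-op₁ s (v ++ cl ∷ w) st))
        (trans (cong (List.last ∘ proj₁) (sym st)) (split-act Kind.f (suc s) v w ov r≡0))

replaceAt-++ : ∀ v {x y w} → replaceAt (length v) y (v ++ x ∷ w) ≡ v ++ y ∷ w
replaceAt-++ []      = refl
replaceAt-++ (z ∷ v) = cong (z ∷_) (replaceAt-++ v)

actWord-position : ∀ k n i w → actWord k n (suc i) w ≡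
  Maybe.map (λ p → replaceAt p (target k i) w) (Brackets.position i k (Brackets.stack i 0 w))
actWord-position Kind.e n i w = cong (λ z → Maybe.map (λ p → replaceAt p (suc i) w) (List.head z))
  (trans (cong openings (unpaired-stack n w)) (openings-render (proj₁ (stack 0 w)) (proj₂ (stack 0 w))))
  where open Brackets i
actWord-position Kind.f n i w = cong (λ z → Maybe.map (λ p → replaceAt p (suc (suc i)) w) (List.last z))
  (trans (cong closings (unpaired-stack n w)) (closings-render (proj₁ (stack 0 w)) (proj₂ (stack 0 w))))
  where open Brackets i

-- The conditions on `before` and `after` do not depend on the kind; this is why a single `Exchange`
-- can later describe e and f.
record Acts (k : Kind) (i : ℕ) (w w′ : Row) : Set where
  constructor acts
  field
    {before after} : Row
    word   : w ≡ before ++ source k i ∷ after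
    result : w′ ≡ before ++ target k i ∷ after
    o≡0    : Brackets.o i before ≡ 0
    r≡0    : Brackets.r i after ≡ 0

actWord⇒acts : ∀ k n i w {w′} → actWord k n (suc i) w ≡ just w′ → Acts k i w w′
actWord⇒acts k n i w eq with Brackets.position i k (Brackets.stack i 0 w) in pos
                             | trans (sym (actWord-position k n i w)) eq
... | just p | eq′ with Brackets.act-split i k 0 w pos
...   | Brackets.split {before} {after} refl refl o≡0 r≡0 =
  acts {before = before} refl (trans (sym (just-injective eq′)) (replaceAt-++ before)) o≡0 r≡0

acts⇒actWord : ∀ k n i {w w′} → Acts k i w w′ → actWord k n (suc i) w ≡ just w′
acts⇒actWord k n i (acts {before} {after} refl refl o≡0 r≡0) =
  trans (actWord-position k n i (before ++ source k i ∷ after))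
    (trans (cong (Maybe.map _) (Brackets.split-act i k 0 before after o≡0 r≡0))
           (cong just (replaceAt-++ before)))

-- Kashiwara operators on fillings

take-++ : ∀ {A : Set} (xs ys : List A) → List.take (length xs) (xs ++ ys) ≡ xs
take-++ []       ys = refl
take-++ (x ∷ xs) ys = cong (x ∷_) (take-++ xs ys)

drop-++ : ∀ {A : Set} (xs ys : List A) → List.drop (length xs) (xs ++ ys) ≡ ys
drop-++ []       ys = refl
drop-++ (x ∷ xs) ys = drop-++ xs ys

cut-concat : ∀ H → cut (List.map length H) (concat H) ≡ H
cut-concat []      = refl
cut-concat (h ∷ H) = cong₂ _∷_ (take-++ h (concat H))
  (trans (cong (cut (List.map length H)) (drop-++ h (concat H))) (cut-concat H))

concat-split : ∀ (H : Filling) {v x w} → concat H ≡ v ++ x ∷ w →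
  ∃[ Ha ] ∃[ u ] ∃[ t ] ∃[ Hc ] H ≡ Ha ++ (u ++ x ∷ t) ∷ Hc × v ≡ concat Ha ++ u × w ≡ t ++ concat Hc
concat-split [] {[]} ()
concat-split [] {_ ∷ _} ()
concat-split ([] ∷ H) eq with Ha , u , t , Hc , refl , refl , refl ← concat-split H eq =
  [] ∷ Ha , u , t , Hc , refl , refl , refl
concat-split ((y ∷ h) ∷ H) {[]} refl = [] , [] , h , H , refl , refl , refl
concat-split ((y ∷ h) ∷ H) {z ∷ v} eq with refl ← List.∷-injectiveˡ eq | concat-split (h ∷ H) {v} (List.∷-injectiveʳ eq)
... | [] , u , t , Hc , refl , refl , refl = [] , y ∷ u , t , Hc , refl , refl , refl
... | a ∷ Ha , u , t , Hc , refl , refl , refl = (y ∷ a) ∷ Ha , u , t , Hc , refl , refl , refl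

concat-middle : ∀ (Ha : Filling) u x t Hc →
  concat (Ha ++ (u ++ x ∷ t) ∷ Hc) ≡ (concat Ha ++ u) ++ x ∷ (t ++ concat Hc)
concat-middle Ha u x t Hc = begin
  concat (Ha ++ (u ++ x ∷ t) ∷ Hc)          ≡⟨ List.concat-++ Ha ((u ++ x ∷ t) ∷ Hc) ⟨
  concat Ha ++ ((u ++ x ∷ t) ++ concat Hc)  ≡⟨ cong (concat Ha ++_) (List.++-assoc u (x ∷ t) (concat Hc)) ⟩
  concat Ha ++ (u ++ x ∷ (t ++ concat Hc))  ≡⟨ List.++-assoc (concat Ha) u _ ⟨
  (concat Ha ++ u) ++ x ∷ (t ++ concat Hc)  ∎
  where open ≡-Reasoning

lengths-middle : ∀ (Ha : Filling) u x y t Hc →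
  List.map length (Ha ++ (u ++ x ∷ t) ∷ Hc) ≡ List.map length (Ha ++ (u ++ y ∷ t) ∷ Hc)
lengths-middle []       u x y t Hc = cong (_∷ List.map length Hc)
  (trans (List.length-++ u) (sym (List.length-++ u)))
lengths-middle (h ∷ Ha) u x y t Hc = cong (length h ∷_) (lengths-middle Ha u x y t Hc)

module _ {A : Set} where

  from : (ℕ → A) → ℕ → ℕ → A
  from g k m = g (k ℕ.+ m)

  applyUpTo-split⁻ : ∀ (g : ℕ → A) l {Ha h Hc} → applyUpTo g l ≡ Ha ++ h ∷ Hc →
    length Ha < l × Ha ≡ applyUpTo g (length Ha) × h ≡ g (length Ha) ×
    Hc ≡ applyUpTo (from g (suc (length Ha))) (l ∸ suc (length Ha))
  applyUpTo-split⁻ g zero {[]} ()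
  applyUpTo-split⁻ g zero {_ ∷ _} ()
  applyUpTo-split⁻ g (suc l) {[]} refl = s≤s z≤n , refl , refl , refl
  applyUpTo-split⁻ g (suc l) {a ∷ Ha} eq
    with refl ← List.∷-injectiveˡ eq | applyUpTo-split⁻ (g ∘ suc) l {Ha} (List.∷-injectiveʳ eq)
  ... | k<l , eqa , eqh , eqc = s≤s k<l , cong (a ∷_) eqa , eqh , eqc

  applyUpTo-split : ∀ (g : ℕ → A) l k → k < l →
    applyUpTo g l ≡ applyUpTo g k ++ g k ∷ applyUpTo (from g (suc k)) (l ∸ suc k)
  applyUpTo-split g (suc l) zero    _         = refl
  applyUpTo-split g (suc l) (suc k) (s≤s k<l) = cong (g 0 ∷_) (applyUpTo-split (g ∘ suc) l k k<l)

  applyUpTo-cong : ∀ {g g′ : ℕ → A} l → (∀ k → k < l → g k ≡ g′ k) → applyUpTo g l ≡ applyUpTo g′ l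
  applyUpTo-cong zero    eq = refl
  applyUpTo-cong (suc l) eq = cong₂ _∷_ (eq 0 (s≤s z≤n)) (applyUpTo-cong l λ k k<l → eq (suc k) (s≤s k<l))

  applyUpTo-injective : ∀ {g g′ : ℕ → A} l → applyUpTo g l ≡ applyUpTo g′ l → ∀ k → k < l → g k ≡ g′ k
  applyUpTo-injective (suc l) eq zero    _         = List.∷-injectiveˡ eq
  applyUpTo-injective (suc l) eq (suc k) (s≤s k<l) = applyUpTo-injective l (List.∷-injectiveʳ eq) k k<l

++-split-injective : ∀ {A : Set} (as bs : List A) {x y cs ds} → length as ≡ length bs →
  as ++ x ∷ cs ≡ bs ++ y ∷ ds → as ≡ bs × x ≡ y × cs ≡ ds
++-split-injective []       []       _   eq = refl , List.∷-injectiveˡ eq , List.∷-injectiveʳ eq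
++-split-injective (a ∷ as) (b ∷ bs) len eq
  with p , q , r ← ++-split-injective as bs (ℕ.suc-injective len) (List.∷-injectiveʳ eq) =
  cong₂ _∷_ (List.∷-injectiveˡ eq) p , q , r

-- Rows are counted from the bottom, in the order in which the word lists them.
record RowMove (k : Kind) (i l : ℕ) (g g′ : ℕ → Row) : Set where
  field
    k₀    : ℕ
    k₀<l  : k₀ < l
    {u t} : Row
    old   : g k₀ ≡ u ++ source k i ∷ t
    new   : g′ k₀ ≡ sort (u ++ target k i ∷ t)
    same  : ∀ m → m < l → m ≢ k₀ → g′ m ≡ g m
    o≡0   : Brackets.o i (concat (applyUpTo g k₀) ++ u) ≡ 0
    r≡0   : Brackets.r i (t ++ concat (applyUpTo (from g (suc k₀)) (l ∸ suc k₀))) ≡ 0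

module _ (n i l : ℕ) {g g′ : ℕ → Row} (g-sorted : ∀ m → m < l → sort (g m) ≡ g m) where

  Hb Hb′ : Filling
  Hb  = applyUpTo g l
  Hb′ = applyUpTo g′ l

  result : Row → Filling
  result w = List.map sort (cut (List.map length Hb) w)

  result-middle : ∀ {Ha u x t Hc} y → Hb ≡ Ha ++ (u ++ x ∷ t) ∷ Hc →
    result ((concat Ha ++ u) ++ y ∷ (t ++ concat Hc)) ≡
    List.map sort Ha ++ sort (u ++ y ∷ t) ∷ List.map sort Hc
  result-middle {Ha} {u} {x} {t} {Hc} y eq = begin
    List.map sort (cut (List.map length Hb) ((concat Ha ++ u) ++ y ∷ (t ++ concat Hc)))
      ≡⟨ cong (List.map sort) (cong₂ cut (trans (cong (List.map length) eq) (lengths-middle Ha u x y t Hc))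
                                        (sym (concat-middle Ha u y t Hc))) ⟩
    List.map sort (cut (List.map length H′) (concat H′)) ≡⟨ cong (List.map sort) (cut-concat H′) ⟩
    List.map sort H′ ≡⟨ List.map-++ sort Ha _ ⟩
    List.map sort Ha ++ sort (u ++ y ∷ t) ∷ List.map sort Hc ∎
    where
    open ≡-Reasoning
    H′ : Filling
    H′ = Ha ++ (u ++ y ∷ t) ∷ Hc

  acts⇒rowMove : ∀ k {w} → Acts k i (concat Hb) w → result w ≡ Hb′ → RowMove k i l g g′
  acts⇒rowMove k (acts word refl o≡0 r≡0) res
    with Ha , u , t , Hc , eqH , refl , refl ← concat-split Hb word
    with k<l , eqa , eqh , eqc ← applyUpTo-split⁻ g l eqH
    with pa , ph , pc ← ++-split-injective (List.map sort Ha) (applyUpTo g′ (length Ha))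
           (trans (List.length-map sort Ha) (sym (List.length-applyUpTo g′ (length Ha))))
           (trans (sym (result-middle (target k i) eqH)) (trans res (applyUpTo-split g′ l (length Ha) k<l)))
    = record
    { k₀ = length Ha ; k₀<l = k<l ; old = sym eqh ; new = sym ph ; same = same
    ; o≡0 = trans (cong (λ z → Brackets.o i (concat z ++ u)) (sym eqa)) o≡0
    ; r≡0 = trans (cong (λ z → Brackets.r i (t ++ concat z)) (sym eqc)) r≡0 }
    where
    -- Rows that were sorted before are not affected by the sorting in `kashiwara`, so only the
    -- acting row changes.
    same : ∀ m → m < l → m ≢ length Ha → g′ m ≡ g m
    same m m<l m≢k with ℕ.<-cmp m (length Ha)
    ... | tri≈ _ m≡k _ = contradiction m≡k m≢k
    ... | tri< m<k _ _ = sym (trans (sym (g-sorted m m<l)) (applyUpTo-injective (length Ha)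
            (trans (sym (List.map-applyUpTo g sort (length Ha))) (trans (cong (List.map sort) (sym eqa)) pa)) m m<k))
    ... | tri> _ _ k<m = subst (λ z → g′ z ≡ g z) (ℕ.m+[n∸m]≡n k<m)
      (sym (trans (sym (g-sorted _ (subst (_< l) (sym (ℕ.m+[n∸m]≡n k<m)) m<l)))
        (applyUpTo-injective (l ∸ suc (length Ha))
          (trans (sym (List.map-applyUpTo (from g (suc (length Ha))) sort (l ∸ suc (length Ha))))
            (trans (cong (List.map sort) (sym eqc)) pc))
          (m ∸ suc (length Ha)) (ℕ.∸-monoˡ-< m<l k<m))))

  rowMove⇒acts : ∀ k → RowMove k i l g g′ → ∃[ w ] Acts k i (concat Hb) w × result w ≡ Hb′
  rowMove⇒acts k M = (concat Ha ++ u) ++ target k i ∷ (t ++ concat Hc) ,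
    acts (trans (cong concat eqH) (concat-middle Ha u (source k i) t Hc)) refl o≡0 r≡0 ,
    trans (result-middle (target k i) eqH) (trans
      (cong₂ _++_ sa (cong₂ _∷_ (sym new) sc))
      (sym (applyUpTo-split g′ l k₀ k₀<l)))
    where
    open RowMove M
    Ha Hc : Filling
    Ha = applyUpTo g k₀
    Hc = applyUpTo (from g (suc k₀)) (l ∸ suc k₀)
    eqH : Hb ≡ Ha ++ (u ++ source k i ∷ t) ∷ Hc
    eqH = trans (applyUpTo-split g l k₀ k₀<l) (cong (λ z → Ha ++ z ∷ Hc) old)
    sa : List.map sort Ha ≡ applyUpTo g′ k₀
    sa = trans (List.map-applyUpTo g sort k₀) (applyUpTo-cong k₀ λ m m<k →
      let m<l = ℕ.<-trans m<k k₀<l in trans (g-sorted m m<l) (sym (same m m<l (ℕ.<⇒≢ m<k))))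
    sc : List.map sort Hc ≡ applyUpTo (from g′ (suc k₀)) (l ∸ suc k₀)
    sc = trans (List.map-applyUpTo (from g (suc k₀)) sort (l ∸ suc k₀)) (applyUpTo-cong (l ∸ suc k₀) λ m m<d →
      let m<l = subst (suc k₀ ℕ.+ m <_) (ℕ.m+[n∸m]≡n k₀<l) (ℕ.+-monoʳ-< (suc k₀) m<d)
      in trans (g-sorted _ m<l) (sym (same _ m<l (ℕ.<⇒≢ (s≤s (ℕ.m≤m+n k₀ m)) ∘ sym))))

  kashiwara-unfold : ∀ k H → reverse H ≡ Hb →
    kashiwara k n (suc i) H ≡ Maybe.map (reverse ∘ result) (actWord k n (suc i) (concat Hb))
  kashiwara-unfold k H refl-H = cong₂ (λ R w → Maybe.map (λ w → reverse (List.map sort (cut (List.map length R) w)))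
      (actWord k n (suc i) w)) refl-H
    (trans (cong concat (List.map-id (reverse H))) (cong concat refl-H))

  kashiwara⇒rowMove : ∀ k {H H′} → reverse H ≡ Hb → reverse H′ ≡ Hb′ →
    kashiwara k n (suc i) H ≡ just H′ → RowMove k i l g g′
  kashiwara⇒rowMove k {H} {H′} eqH eqH′ eq with actWord k n (suc i) (concat Hb) in act
                                                | trans (sym (kashiwara-unfold k H eqH)) eq
  ... | just w | eq′ = acts⇒rowMove k (actWord⇒acts k n i (concat Hb) act)
    (trans (sym (List.reverse-involutive (result w)))
      (trans (cong reverse (just-injective eq′)) eqH′))

  rowMove⇒kashiwara : ∀ k {H H′} → reverse H ≡ Hb → reverse H′ ≡ Hb′ →
    RowMove k i l g g′ → kashiwara k n (suc i) H ≡ just H′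
  rowMove⇒kashiwara k {H} {H′} eqH eqH′ M with w , act , res ← rowMove⇒acts k M =
    trans (kashiwara-unfold k H eqH) (trans (cong (Maybe.map _) (acts⇒actWord k n i act))
      (cong just (trans (cong reverse (trans res (sym eqH′))) (List.reverse-involutive H′))))

-- Rows of a skew tableau

insert-least : ∀ x w → All (x ≤_) w → insert x w ≡ x ∷ w
insert-least x []      _         = refl
insert-least x (y ∷ w) (x≤y All.∷ _) rewrite dec-true (x ℕ.≤? y) x≤y = refl

sort-sorted : ∀ w → AllPairs _≤_ w → sort w ≡ w
sort-sorted []      _          = refl
sort-sorted (x ∷ w) (x≤ AllPairs.∷ ord) = trans (cong (insert x) (sort-sorted w ord)) (insert-least x w x≤)

occurrences-++ : ∀ m v w → occurrences m (v ++ w) ≡ occurrences m v ℕ.+ occurrences m w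
occurrences-++ m v w = trans (cong length (List.filter-++ (m ℕ.≟_) v w)) (List.length-++ (List.filter (m ℕ.≟_) v))

occurrences-sort : ∀ m w → occurrences m (sort w) ≡ occurrences m w
occurrences-sort m w = ↭ₚ.↭-length (↭ₚ.filter-↭ (m ℕ.≟_) (sort-↭ w))

occurrences-∷ : ∀ m x w → + occurrences m (x ∷ w) ≡ δ m x + + occurrences m w
occurrences-∷ m x w with does (m ℕ.≟ x)
... | true  = refl
... | false = refl

occurrences-middle : ∀ m u x t →
  + occurrences m (u ++ x ∷ t) ≡ δ m x + (+ occurrences m u + + occurrences m t)
occurrences-middle m u x t = begin
  + occurrences m (u ++ x ∷ t)                       ≡⟨ cong +_ (occurrences-++ m u (x ∷ t)) ⟩
  + occurrences m u + + occurrences m (x ∷ t)        ≡⟨ cong (λ z → + occurrences m u + z) (occurrences-∷ m x t) ⟩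
  + occurrences m u + (δ m x + + occurrences m t)    ≡⟨ lem (+ occurrences m u) (δ m x) (+ occurrences m t) ⟩
  δ m x + (+ occurrences m u + + occurrences m t)    ∎
  where
  open ≡-Reasoning
  lem : ∀ a b c → a + (b + c) ≡ b + (a + c)
  lem a b c = solve (a ∷ b ∷ c ∷ [])

occurrences-replicate-≡ : ∀ m k → occurrences m (replicate k m) ≡ k
occurrences-replicate-≡ m zero    = refl
occurrences-replicate-≡ m (suc k) rewrite dec-true (m ℕ.≟ m) refl = cong suc (occurrences-replicate-≡ m k)

occurrences-replicate-≢ : ∀ {m x} k → m ≢ x → occurrences m (replicate k x) ≡ 0
occurrences-replicate-≢ zero    _ = refl
occurrences-replicate-≢ {m} {x} (suc k) m≢x rewrite dec-false (m ℕ.≟ x) m≢x = occurrences-replicate-≢ k m≢x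

-- Row words are sorted, hence determined by their letter counts `c`; the alphabet is that of the m
-- letters from `s` on.
seg : (ℕ → ℕ) → ℕ → ℕ → Row
seg c s zero    = []
seg c s (suc m) = replicate (c s) s ++ seg c (suc s) m

seg-bounds : ∀ c s m → All (λ x → s ≤ x × x < s ℕ.+ m) (seg c s m)
seg-bounds c s zero    = All.[]
seg-bounds c s (suc m) = All.++⁺ (All.replicate⁺ (c s) (ℕ.≤-refl , ℕ.m<m+n s (s≤s z≤n)))
  (All.map (λ {x} (p , q) → ℕ.<⇒≤ p , subst (x <_) (sym (ℕ.+-suc s m)) q) (seg-bounds c (suc s) m))

replicate-sorted : ∀ k x → AllPairs _≤_ (replicate k x)
replicate-sorted zero    x = AllPairs.[]
replicate-sorted (suc k) x = All.replicate⁺ k ℕ.≤-refl AllPairs.∷ replicate-sorted k x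

seg-sorted : ∀ c s m → AllPairs _≤_ (seg c s m)
seg-sorted c s zero    = AllPairs.[]
seg-sorted c s (suc m) = AllPairs.++⁺ (replicate-sorted (c s) s) (seg-sorted c (suc s) m)
  (All.replicate⁺ (c s) (All.map (ℕ.<⇒≤ ∘ proj₁) (seg-bounds c (suc s) m)))

seg-cong : ∀ {c c′} s m → (∀ x → s ≤ x → x < s ℕ.+ m → c x ≡ c′ x) → seg c s m ≡ seg c′ s m
seg-cong s zero    eq = refl
seg-cong s (suc m) eq = cong₂ _++_ (cong (λ z → replicate z s) (eq s ℕ.≤-refl (ℕ.m<m+n s (s≤s z≤n))))
  (seg-cong (suc s) m λ x s<x x< → eq x (ℕ.<⇒≤ s<x) (subst (x <_) (sym (ℕ.+-suc s m)) x<))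

seg-+ : ∀ c s a b → seg c s (a ℕ.+ b) ≡ seg c s a ++ seg c (a ℕ.+ s) b
seg-+ c s zero    b = refl
seg-+ c s (suc a) b = trans (cong (replicate (c s) s ++_)
    (trans (seg-+ c (suc s) a b) (cong (λ z → seg c (suc s) a ++ seg c z b) (ℕ.+-suc a s))))
  (sym (List.++-assoc (replicate (c s) s) (seg c (suc s) a) _))

occurrences-none : ∀ m w → All (λ x → m ≢ x) w → occurrences m w ≡ 0
occurrences-none m w m∉w = cong length (List.filter-none (m ℕ.≟_) m∉w)

occurrences-seg : ∀ c s k m → s ≤ m → m < s ℕ.+ k → occurrences m (seg c s k) ≡ c m
occurrences-seg c s zero    m s≤m m< = contradiction s≤m (ℕ.<⇒≱ (subst (m <_) (ℕ.+-identityʳ s) m<))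
occurrences-seg c s (suc k) m s≤m m< with ℕ.m≤n⇒m<n∨m≡n s≤m
... | inj₁ s<m = trans (occurrences-++ m (replicate (c s) s) _) (cong₂ ℕ._+_
        (occurrences-replicate-≢ (c s) (ℕ.<⇒≢ s<m ∘ sym))
        (occurrences-seg c (suc s) k m s<m (subst (m <_) (ℕ.+-suc s k) m<)))
... | inj₂ refl = trans (occurrences-++ m (replicate (c m) m) _) (trans (cong₂ ℕ._+_
        (occurrences-replicate-≡ m (c m))
        (occurrences-none m (seg c (suc m) k) (All.map (λ (p , _) → ℕ.<⇒≢ p) (seg-bounds c (suc m) k))))
        (ℕ.+-identityʳ (c m)))

occurrences-seg-bounds : ∀ c s k m → 0 < occurrences m (seg c s k) → m < s ℕ.+ k
occurrences-seg-bounds c s k m pos with m ℕ.<? s ℕ.+ k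
... | yes p = p
... | no ¬p = contradiction (occurrences-none m (seg c s k)
  (All.map (λ (_ , x<) m≡x → ¬p (subst (_< s ℕ.+ k) (sym m≡x) x<)) (seg-bounds c s k))) (ℕ.<⇒≢ pos ∘ sym)

-- Bracket numbers of concatenated and of sorted words

module _ (i : ℕ) where

  open Brackets i

  Neutral : Row → Set
  Neutral = All (λ x → x ≢ cl × x ≢ op)

  r-neutral : ∀ {v} w → Neutral v → r (v ++ w) ≡ r w
  r-neutral w All.[]            = refl
  r-neutral {_ ∷ v} w ((p , q) All.∷ ν) = trans (r-other (v ++ w) p q) (r-neutral w ν)

  o-neutral : ∀ {v} w → Neutral v → o (v ++ w) ≡ o w
  o-neutral w All.[]            = refl
  o-neutral {_ ∷ v} w ((p , q) All.∷ ν) = trans (o-other (v ++ w) p q) (o-neutral w ν)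

  r-replicate-cl : ∀ k w → r (replicate k cl ++ w) ≡ k ℕ.+ r w
  r-replicate-cl zero    w = refl
  r-replicate-cl (suc k) w = trans (r-cl (replicate k cl ++ w)) (cong suc (r-replicate-cl k w))

  o-replicate-cl : ∀ k w → o (replicate k cl ++ w) ≡ o w
  o-replicate-cl zero    w = refl
  o-replicate-cl (suc k) w = trans (o-cl (replicate k cl ++ w)) (o-replicate-cl k w)

  r-replicate-op : ∀ k w → r w ≡ 0 → r (replicate k op ++ w) ≡ 0
  r-replicate-op zero    w eq = eq
  r-replicate-op (suc k) w eq = trans (r-op (replicate k op ++ w)) (cong pred (r-replicate-op k w eq))

  o-replicate-op : ∀ k w → r w ≡ 0 → o (replicate k op ++ w) ≡ k ℕ.+ o w
  o-replicate-op zero    w eq = refl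
  o-replicate-op (suc k) w eq = trans (o-op₀ (replicate k op ++ w) (r-replicate-op k w eq))
    (cong suc (o-replicate-op k w eq))

  kind : ∀ x → ∃[ b ] ∃[ b′ ] Letter x b b′
  kind x = _ , _ , letter x

  -- Unpaired opening brackets of `v` absorb unpaired closing brackets of `w`.
  r-++-∸ : ∀ v w → r (v ++ w) ≡ r v ℕ.+ (r w ∸ o v)
  r-++-∸ []      w = refl
  r-++-∸ (x ∷ v) w with kind x
  ... | _ , _ , other p q = trans (r-other (v ++ w) p q) (trans (r-++-∸ v w)
          (sym (cong₂ (λ y z → y ℕ.+ (r w ∸ z)) (r-other v p q) (o-other v p q))))
  ... | _ , _ , closes refl = trans (r-cl (v ++ w)) (trans (cong suc (r-++-∸ v w))
          (sym (cong₂ (λ y z → y ℕ.+ (r w ∸ z)) (r-cl v) (o-cl v))))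
  ... | _ , _ , opens refl = trans (r-op (v ++ w)) (trans (cong pred (r-++-∸ v w)) (go (r v) refl))
    where
    go : ∀ k → r v ≡ k → pred (r v ℕ.+ (r w ∸ o v)) ≡ r (op ∷ v) ℕ.+ (r w ∸ o (op ∷ v))
    go zero    eq = trans (cong (λ z → pred (z ℕ.+ (r w ∸ o v))) eq)
      (trans (ℕ.pred[m∸n]≡m∸[1+n] (r w) (o v))
        (sym (cong₂ (λ y z → y ℕ.+ (r w ∸ z)) (trans (r-op v) (cong pred eq)) (o-op₀ v eq))))
    go (suc k) eq = trans (cong (λ z → pred (z ℕ.+ (r w ∸ o v))) eq)
      (sym (cong₂ (λ y z → y ℕ.+ (r w ∸ z)) (trans (r-op v) (cong pred eq)) (o-op v eq)))

  o-++-∸ : ∀ v w → o (v ++ w) ≡ o w ℕ.+ (o v ∸ r w)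
  o-++-∸ []      w = sym (trans (cong (o w ℕ.+_) (ℕ.0∸n≡0 (r w))) (ℕ.+-identityʳ (o w)))
  o-++-∸ (x ∷ v) w with kind x
  ... | _ , _ , other p q = trans (o-other (v ++ w) p q) (trans (o-++-∸ v w)
          (sym (cong (λ z → o w ℕ.+ (z ∸ r w)) (o-other v p q))))
  ... | _ , _ , closes refl = trans (o-cl (v ++ w)) (trans (o-++-∸ v w)
          (sym (cong (λ z → o w ℕ.+ (z ∸ r w)) (o-cl v))))
  ... | _ , _ , opens refl = go (r v) refl
    where
    zero-case : r v ≡ 0 → ∀ k → r w ∸ o v ≡ k → o (op ∷ v ++ w) ≡ o w ℕ.+ (suc (o v) ∸ r w)
    zero-case eq zero d = trans (o-op₀ (v ++ w) (trans (r-++-∸ v w) (cong₂ ℕ._+_ eq d)))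
      (trans (cong suc (o-++-∸ v w)) (trans (sym (ℕ.+-suc (o w) _))
        (cong (o w ℕ.+_) (sym (ℕ.+-∸-assoc 1 {o v} {r w} (ℕ.m∸n≡0⇒m≤n d))))))
    zero-case eq (suc k) d = trans (o-op (v ++ w) (trans (r-++-∸ v w) (cong₂ ℕ._+_ eq d)))
      (trans (o-++-∸ v w) (cong (o w ℕ.+_) (trans (ℕ.m≤n⇒m∸n≡0 (ℕ.<⇒≤ ov<rw)) (sym (ℕ.m≤n⇒m∸n≡0 ov<rw)))))
      where
      ov<rw : o v < r w
      ov<rw = ℕ.m∸n≢0⇒n<m λ z → contradiction (trans (sym d) z) λ ()
    go : ∀ k → r v ≡ k → o (op ∷ v ++ w) ≡ o w ℕ.+ (o (op ∷ v) ∸ r w)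
    go zero    eq = trans (zero-case eq (r w ∸ o v) refl) (cong (λ z → o w ℕ.+ (z ∸ r w)) (sym (o-op₀ v eq)))
    go (suc k) eq = trans (o-op (v ++ w) (trans (r-++-∸ v w) (cong (ℕ._+ (r w ∸ o v)) eq)))
      (trans (o-++-∸ v w) (cong (λ z → o w ℕ.+ (z ∸ r w)) (sym (o-op v eq))))

  module _ (c : ℕ → ℕ) (m : ℕ) where

    before-cl after-op : Row
    before-cl = seg c 1 i
    after-op  = seg c (suc op) m

    seg-shape : seg c 1 (i ℕ.+ suc (suc m)) ≡
                before-cl ++ replicate (c cl) cl ++ replicate (c op) op ++ after-op
    seg-shape = trans (seg-+ c 1 i (suc (suc m)))
      (cong (λ z → before-cl ++ seg c z (suc (suc m))) (ℕ.+-comm i 1))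

    before-neutral : Neutral before-cl
    before-neutral = All.map (λ (_ , p) → ℕ.<⇒≢ p , ℕ.<⇒≢ (ℕ.m<n⇒m<1+n p)) (seg-bounds c 1 i)

    after-neutral : Neutral after-op
    after-neutral = All.map (λ (p , _) → ℕ.<⇒≢ (ℕ.<⇒≤ p) ∘ sym , ℕ.<⇒≢ p ∘ sym) (seg-bounds c (suc op) m)

    r-after : r after-op ≡ 0
    r-after = trans (cong r (sym (List.++-identityʳ after-op))) (r-neutral [] after-neutral)

    o-after : o after-op ≡ 0
    o-after = trans (cong o (sym (List.++-identityʳ after-op))) (o-neutral [] after-neutral)

    r-seg : r (seg c 1 (i ℕ.+ suc (suc m))) ≡ c cl
    r-seg = trans (cong r seg-shape) (trans (r-neutral _ before-neutral) (trans (r-replicate-cl (c cl) _)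
      (trans (cong (c cl ℕ.+_) (r-replicate-op (c op) after-op r-after)) (ℕ.+-identityʳ (c cl)))))

    o-seg : o (seg c 1 (i ℕ.+ suc (suc m))) ≡ c op
    o-seg = trans (cong o seg-shape) (trans (o-neutral _ before-neutral) (trans (o-replicate-cl (c cl) _)
      (trans (o-replicate-op (c op) after-op r-after)
        (trans (cong (c op ℕ.+_) o-after) (ℕ.+-identityʳ (c op))))))

-- A tableau without its shapes in the type, so that tableaux of different shapes can be related.
record Chain (n l : ℕ) : Set where
  field
    at    : ℕ → Sig l
    grows : ∀ m → at m ≼ at (suc m)
    halts : ∀ m → n ≤ m → at m ≡ at n

open Chain public using () renaming (at to _⟦_⟧)

chainOf : ∀ {n l} {α β : Sig l} → SST α β n → Chain n l
chainOf {n} S = record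
  { at = chain S ; grows = SST.step S
  ; halts = λ m n≤m → trans (SST.stop S m n≤m) (sym (SST.stop S n ℕ.≤-refl)) }

multiplicities : ∀ {n l} → Chain n l → ℕ → ℕ → ℕ
multiplicities C k m = ℤ.∣ row (C ⟦ m ⟧) k - row (C ⟦ m ∸ 1 ⟧) k ∣

letters : ∀ {n l} → Chain n l → ℕ → Row
letters {n} C k = seg (multiplicities C k) 1 n

concatMap-seg : ∀ c s m (g : ℕ → ℕ) → (∀ k → g k ≡ s ℕ.+ k) →
                concatMap (λ x → replicate (c x) x) (applyUpTo g m) ≡ seg c s m
concatMap-seg c s zero    g eq = refl
concatMap-seg c s (suc m) g eq = cong₂ _++_
  (cong (λ x → replicate (c x) x) (trans (eq 0) (ℕ.+-identityʳ s)))
  (concatMap-seg c (suc s) m (g ∘ suc) λ k → trans (eq (suc k)) (ℕ.+-suc s k))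

tabulate-downFrom : ∀ {A : Set} l (g : ℕ → A) →
  List.tabulate {n = l} (λ j → g (l ∸ suc (toℕ j))) ≡ applyDownFrom g l
tabulate-downFrom zero    g = refl
tabulate-downFrom (suc l) g = cong (g l ∷_) (tabulate-downFrom l g)

reverse-rows : ∀ {n l} {α β : Sig l} (S : SST α β n) →
               reverse (rows S) ≡ applyUpTo (letters (chainOf S)) l
reverse-rows {n} {l} S = trans (cong reverse (trans
    (List.tabulate-cong λ j → trans
      (concatMap-seg (λ i → ℤ.∣ chain S i ‼ j - chain S (i ∸ 1) ‼ j ∣) 1 n suc (λ _ → refl))
      (seg-cong 1 n λ x _ _ → cong ℤ.∣_∣ (cong₂ _-_ (sym (row-lookup (chain S x) j))
                                                    (sym (row-lookup (chain S (x ∸ 1)) j)))))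
    (tabulate-downFrom l (letters (chainOf S)))))
  (List.reverse-applyDownFrom (letters (chainOf S)) l)

letters-sorted : ∀ {n l} (C : Chain n l) k → sort (letters C k) ≡ letters C k
letters-sorted {n} C k = sort-sorted _ (seg-sorted (multiplicities C k) 1 n)

row-step : ∀ {n l} (C : Chain n l) m k → k < l →
           + multiplicities C k (suc m) ≡ row (C ⟦ suc m ⟧) k - row (C ⟦ m ⟧) k
row-step C m k k<l = ℤ.0≤i⇒+∣i∣≡i (Δ (Interlaced.below (≼⇒interlaced (Chain.grows C m)) k k<l))

occurrences-letters : ∀ {n l} (C : Chain n l) k m → 1 ≤ m → m ≤ n →
                      occurrences m (letters C k) ≡ multiplicities C k m
occurrences-letters {n} C k m 1≤m m≤n = occurrences-seg (multiplicities C k) 1 n m 1≤m (s≤s m≤n)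

-- The signature rule as the last maximum of the score

module _ {n l : ℕ} (i : ℕ) (Low Up : Chain n l) where

  open Brackets i

  record Raised : Set where
    field
      range  : op ≤ n
      others : ∀ m → m ≢ cl → Up ⟦ m ⟧ ≡ Low ⟦ m ⟧
      raise  : Raises (Low ⟦ i ⟧) (Low ⟦ cl ⟧) (Low ⟦ op ⟧) (Up ⟦ cl ⟧)

  p q : ℕ → ℕ
  p k = multiplicities Low k cl
  q k = multiplicities Low k op

  -- The move as seen in the row words: one `op` of row k₀ becomes `cl`, the closing brackets of
  -- that row absorb all opening ones from below, and its opening ones outnumber the closing ones
  -- from above. The change of letter counts is written without subtraction.
  record WordRaised : Set where
    field
      k₀      : ℕ
      k₀<l    : k₀ < l
      range   : op ≤ n
      changes : ∀ m k → m < n → k < l → + multiplicities Up k (suc m) + δ (suc m) op * δ k₀ k ≡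
                                       + multiplicities Low k (suc m) + δ (suc m) cl * δ k₀ k
      o-below : o (concat (applyUpTo (letters Low) k₀)) ≤ p k₀
      r-above : r (concat (applyUpTo (from (letters Low) (suc k₀)) (l ∸ suc k₀))) < q k₀

  S : ℕ → ℤ
  S = sumTo λ k → + p k - + q k

  G : ℕ → ℤ
  G k = S k + + p k

  score-G : ∀ k → k < l → score (row (Low ⟦ i ⟧)) (row (Low ⟦ cl ⟧)) (row (Low ⟦ op ⟧)) k ≡ G k
  score-G k k<l = cong₂ _+_ (sumTo-cong k λ m m<k → let m<l = ℕ.<-trans m<k k<l in
      cong₂ _-_ (sym (row-step Low i m m<l)) (sym (row-step Low cl m m<l)))
    (sym (row-step Low i k k<l))

  module _ (range : op ≤ n) where

    alphabet : i ℕ.+ suc (suc (n ∸ op)) ≡ n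
    alphabet = trans (ℕ.+-suc i _) (trans (cong suc (ℕ.+-suc i _)) (ℕ.m+[n∸m]≡n range))

    r-letters : ∀ (C : Chain n l) k → r (letters C k) ≡ multiplicities C k cl
    r-letters C k = subst (λ z → r (seg (multiplicities C k) 1 z) ≡ multiplicities C k cl) alphabet
      (r-seg i (multiplicities C k) (n ∸ op))

    o-letters : ∀ (C : Chain n l) k → o (letters C k) ≡ multiplicities C k op
    o-letters C k = subst (λ z → o (seg (multiplicities C k) 1 z) ≡ multiplicities C k op) alphabet
      (o-seg i (multiplicities C k) (n ∸ op))

    O : ℕ → ℕ
    O k = o (concat (applyUpTo (letters Low) k))

    O-suc : ∀ k → O (suc k) ≡ q k ℕ.+ (O k ∸ p k)
    O-suc k = trans (cong (o ∘ concat) (sym (List.applyUpTo-∷ʳ (letters Low) k)))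
      (trans (cong o (trans (sym (List.concat-++ (applyUpTo (letters Low) k) (letters Low k ∷ [])))
                            (cong (concat (applyUpTo (letters Low) k) ++_) (List.++-identityʳ (letters Low k)))))
        (trans (o-++-∸ i (concat (applyUpTo (letters Low) k)) (letters Low k))
          (cong₂ (λ y z → y ℕ.+ (O k ∸ z)) (o-letters Low k) (r-letters Low k))))

    R : ℕ → ℕ → ℕ
    R a d = r (concat (applyUpTo (from (letters Low) a) d))

    R-suc : ∀ a d → R a (suc d) ≡ p a ℕ.+ (R (suc a) d ∸ q a)
    R-suc a d = trans (cong r (cong₂ _++_ (cong (letters Low) (ℕ.+-identityʳ a))
        (cong concat (applyUpTo-cong d λ k _ → cong (letters Low) (ℕ.+-suc a k)))))
      (trans (r-++-∸ i (letters Low a) _) (cong₂ (λ y z → y ℕ.+ (R (suc a) d ∸ z)) (r-letters Low a) (o-letters Low a)))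

    ∸-split : ∀ a b c d → a ℕ.+ (b ∸ c) ≤ d → a ≤ d × b ≤ c ℕ.+ (d ∸ a)
    ∸-split a b c d h = a≤d , ℕ.≤-trans (ℕ.m≤n+m∸n b c)
        (ℕ.+-monoʳ-≤ c (ℕ.m+n≤o⇒m≤o∸n _ (subst (_≤ d) (ℕ.+-comm a (b ∸ c)) h)))
      where
      a≤d : a ≤ d
      a≤d = ℕ.m+n≤o⇒m≤o a h

    ∸-join : ∀ a b c d → a ≤ d → b ≤ c ℕ.+ (d ∸ a) → a ℕ.+ (b ∸ c) ≤ d
    ∸-join a b c d a≤d h = ℕ.≤-trans (ℕ.+-monoʳ-≤ a (ℕ.m≤n+o⇒m∸n≤o b c h))
      (ℕ.≤-reflexive (ℕ.m+[n∸m]≡n a≤d))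

    cast-∸ : ∀ a d c → a ≤ d → + (c ℕ.+ (d ∸ a)) ≡ + c + (+ d - + a)
    cast-∸ a d c a≤d = cong (λ z → + c + z) (trans (sym (ℤ.⊖-≥ a≤d)) (sym (ℤ.m-n≡m⊖n d a)))

    -- With the converse `G⇒O≤`: at most N opening brackets survive from the rows below k exactly if
    -- no score there exceeds S k + N. For k = k₀ and N = p k₀ this bound is the score of k₀.
    O≤⇒G : ∀ k N → O k ≤ N → ∀ m → m < k → G m ℤ.≤ S k + + N
    O≤⇒G (suc k) N O≤N m (s≤s m≤k) with ∸-split (q k) (O k) (p k) N (subst (_≤ N) (O-suc k) O≤N) | ℕ.m≤n⇒m<n∨m≡n m≤k
    ... | q≤N , _ | inj₂ refl = lem (S k) (+ p k) (+ q k) (+ N) (ℤ.+≤+ q≤N)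
      where
      lem : ∀ s p q n → q ℤ.≤ n → s + p ℤ.≤ s + (p - q) + n
      lem s p q n h = ≤-by (Δ h) (solve (s ∷ p ∷ q ∷ n ∷ []))
    ... | q≤N , h | inj₁ m<k = subst (G m ℤ.≤_) (trans (cong (λ z → S k + z) (cast-∸ (q k) N (p k) q≤N))
          (lem (S k) (+ p k) (+ q k) (+ N))) (O≤⇒G k (p k ℕ.+ (N ∸ q k)) h m m<k)
      where
      lem : ∀ s p q n → s + (p + (n - q)) ≡ s + (p - q) + n
      lem s p q n = solve (s ∷ p ∷ q ∷ n ∷ [])

    G⇒O≤ : ∀ k N → (∀ m → m < k → G m ℤ.≤ S k + + N) → O k ≤ N
    G⇒O≤ zero    N h = z≤n
    G⇒O≤ (suc k) N h = subst (_≤ N) (sym (O-suc k)) (∸-join (q k) (O k) (p k) N q≤N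
      (G⇒O≤ k (p k ℕ.+ (N ∸ q k)) λ m m<k → subst (G m ℤ.≤_)
        (trans (lem′ (S k) (+ p k) (+ q k) (+ N)) (cong (λ z → S k + z) (sym (cast-∸ (q k) N (p k) q≤N)))) (h m (ℕ.m<n⇒m<1+n m<k))))
      where
      lem : ∀ s p q n → s + p ℤ.≤ s + (p - q) + n → q ℤ.≤ n
      lem s p q n h = ≤-by (Δ h) (solve (s ∷ p ∷ q ∷ n ∷ []))
      lem′ : ∀ s p q n → s + (p - q) + n ≡ s + (p + (n - q))
      lem′ s p q n = solve (s ∷ p ∷ q ∷ n ∷ [])
      q≤N : q k ≤ N
      q≤N = ℤ.drop‿+≤+ (lem (S k) (+ p k) (+ q k) (+ N) (h k ℕ.≤-refl))

    -- The mirror image for closing brackets from above. With a = k₀ + 1 and N = q k₀ - 1 the bound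
    -- is G k₀ - 1, which is why the maximum is the last one.
    R≤⇒G : ∀ a d N → R a d ≤ N → ∀ m → a ≤ m → m < a ℕ.+ d → G m ℤ.≤ S a + + N
    R≤⇒G a zero    N _ m a≤m m< = contradiction a≤m (ℕ.<⇒≱ (subst (m <_) (ℕ.+-identityʳ a) m<))
    R≤⇒G a (suc d) N R≤N m a≤m m< with ∸-split (p a) (R (suc a) d) (q a) N (subst (_≤ N) (R-suc a d) R≤N) | ℕ.m≤n⇒m<n∨m≡n a≤m
    ... | p≤N , _ | inj₂ refl = ℤ.+-monoʳ-≤ (S a) (ℤ.+≤+ p≤N)
    ... | p≤N , h | inj₁ a<m  = subst (G m ℤ.≤_) (trans (cong (λ z → S (suc a) + z) (cast-∸ (p a) N (q a) p≤N))
          (lem (S a) (+ p a) (+ q a) (+ N)))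
          (R≤⇒G (suc a) d (q a ℕ.+ (N ∸ p a)) h m a<m (subst (m <_) (ℕ.+-suc a d) m<))
      where
      lem : ∀ s p q n → s + (p - q) + (q + (n - p)) ≡ s + n
      lem s p q n = solve (s ∷ p ∷ q ∷ n ∷ [])

    G⇒R≤ : ∀ a d N → (∀ m → a ≤ m → m < a ℕ.+ d → G m ℤ.≤ S a + + N) → R a d ≤ N
    G⇒R≤ a zero    N h = z≤n
    G⇒R≤ a (suc d) N h = subst (_≤ N) (sym (R-suc a d)) (∸-join (p a) (R (suc a) d) (q a) N p≤N
      (G⇒R≤ (suc a) d (q a ℕ.+ (N ∸ p a)) λ m a<m m< → subst (G m ℤ.≤_)
        (trans (lem′ (S a) (+ p a) (+ q a) (+ N)) (cong (λ z → S (suc a) + z) (sym (cast-∸ (p a) N (q a) p≤N))))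
        (h m (ℕ.<⇒≤ a<m) (subst (m <_) (sym (ℕ.+-suc a d)) m<))))
      where
      lem : ∀ s p n → s + p ℤ.≤ s + n → p ℤ.≤ n
      lem s p n h = ≤-by (Δ h) (solve (s ∷ p ∷ n ∷ []))
      lem′ : ∀ s p q n → s + n ≡ s + (p - q) + (q + (n - p))
      lem′ s p q n = solve (s ∷ p ∷ q ∷ n ∷ [])
      p≤N : p a ≤ N
      p≤N = ℤ.drop‿+≤+ (lem (S a) (+ p a) (+ N) (h a ℕ.≤-refl (ℕ.m<m+n a (s≤s z≤n))))

  cl≢op : cl ≢ op
  cl≢op ()

  module _ (W : WordRaised) (inner≡ : Up ⟦ 0 ⟧ ≡ Low ⟦ 0 ⟧) where

    open WordRaised W

    -- Letter counts determine a chain only relative to its first term; equality of the inner shapes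
    -- starts the induction.
    rows≡ : ∀ m k → m ≤ n → k < l → row (Up ⟦ m ⟧) k ≡ row (Low ⟦ m ⟧) k + δ m cl * δ k₀ k
    rows≡ zero    k _   k<l = trans (cong (λ α → row α k) inner≡) (sym (ℤ.+-identityʳ _))
    rows≡ (suc m) k m<n k<l = lem (row (Up ⟦ suc m ⟧) k) (row (Up ⟦ m ⟧) k) (row (Low ⟦ suc m ⟧) k) (row (Low ⟦ m ⟧) k)
      (+ multiplicities Up k (suc m)) (+ multiplicities Low k (suc m)) (δ (suc m) op * δ k₀ k) (δ (suc m) cl * δ k₀ k)
      (row-step Up m k k<l) (row-step Low m k k<l) (changes m k m<n k<l) (rows≡ m k (ℕ.<⇒≤ m<n) k<l)
      where
      lem : ∀ u u′ v v′ a b x y → a ≡ u - u′ → b ≡ v - v′ → a + x ≡ b + y → u′ ≡ v′ + x → u ≡ v + y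
      lem u _ v v′ _ _ x y refl refl eq refl = begin
        u                           ≡⟨ solve (u ∷ v′ ∷ x ∷ []) ⟩
        u - (v′ + x) + x + v′       ≡⟨ cong (λ z → z + v′) eq ⟩
        v - v′ + y + v′             ≡⟨ solve (v ∷ v′ ∷ y ∷ []) ⟩
        v + y                       ∎
        where open ≡-Reasoning

    wordRaised⇒raised : Raised
    wordRaised⇒raised = record
      { range  = range
      ; others = others
      ; raise  = record
          { k₀ = k₀ ; k₀<l = k₀<l
          ; raised = λ k k<l → trans (rows≡ cl k (ℕ.<⇒≤ range) k<l)
              (cong (λ z → row (Low ⟦ cl ⟧) k + z) (trans (cong (λ z → z * δ k₀ k) (δ-≡ cl)) (ℤ.*-identityˡ _)))
          ; lower = λ k k<k₀ → subst₂ ℤ._≤_ (sym (score-G k (ℕ.<-trans k<k₀ k₀<l))) (sym (score-G k₀ k₀<l))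
              (O≤⇒G range k₀ (p k₀) o-below k k<k₀)
          ; upper = λ k k₀<k k<l → subst₂ (λ y z → y + 1ℤ ℤ.≤ z) (sym (score-G k k<l)) (sym (score-G k₀ k₀<l))
              (lem (G k) (S k₀) (+ p k₀) (+ q k₀) (+ pred (q k₀)) (q-pred (q k₀) (ℕ.≤-<-trans z≤n r-above))
                (R≤⇒G range (suc k₀) (l ∸ suc k₀) (pred (q k₀)) (ℕ.s≤s⁻¹ (subst (suc (R range (suc k₀) (l ∸ suc k₀)) ≤_) (sym (ℕ.suc-pred (q k₀) ⦃ ℕ.>-nonZero (ℕ.≤-<-trans z≤n r-above) ⦄)) r-above)) k k₀<k
                  (subst (k <_) (sym (ℕ.m+[n∸m]≡n k₀<l)) k<l)))
          }
      }
      where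
      q-pred : ∀ x → 0 < x → + x ≡ 1ℤ + + pred x
      q-pred (suc x) _ = refl
      lem : ∀ g s p q q′ → q ≡ 1ℤ + q′ → g ℤ.≤ s + (p - q) + q′ → g + 1ℤ ℤ.≤ s + p
      lem g s p q q′ eq h = ≤-by (Δ h ⊕ Δ (ℤ.≤-reflexive (sym eq))) (solve (g ∷ s ∷ p ∷ q ∷ q′ ∷ []))
      others-≤ : ∀ m → m ≤ n → m ≢ cl → Up ⟦ m ⟧ ≡ Low ⟦ m ⟧
      others-≤ m m≤n m≢cl = row-ext λ k k<l → trans (rows≡ m k m≤n k<l)
        (trans (cong (λ z → row (Low ⟦ m ⟧) k + z * δ k₀ k) (δ-≢ m≢cl)) (ℤ.+-identityʳ _))
      others : ∀ m → m ≢ cl → Up ⟦ m ⟧ ≡ Low ⟦ m ⟧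
      others m m≢cl with ℕ.≤-total m n
      ... | inj₁ m≤n = others-≤ m m≤n m≢cl
      ... | inj₂ n≤m = trans (Chain.halts Up m n≤m) (trans
        (others-≤ n ℕ.≤-refl (ℕ.<⇒≢ range ∘ sym)) (sym (Chain.halts Low m n≤m)))

  module _ (E : Raised) where

    open Raised E
    open Raise raise

    rows-raised : ∀ m k → k < l → row (Up ⟦ m ⟧) k ≡ row (Low ⟦ m ⟧) k + δ m cl * δ k₀ k
    rows-raised m k k<l with m ℕ.≟ cl
    ... | yes refl = trans (raised k k<l) (cong (λ z → row (Low ⟦ cl ⟧) k + z)
            (sym (trans (cong (λ z → z * δ k₀ k) (δ-≡ cl)) (ℤ.*-identityˡ _))))
    ... | no m≢cl = trans (cong (λ α → row α k) (others m m≢cl))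
            (sym (trans (cong (λ z → row (Low ⟦ m ⟧) k + z * δ k₀ k) (δ-≢ m≢cl)) (ℤ.+-identityʳ _)))

    changes′ : ∀ m k → k < l → + multiplicities Up k (suc m) + δ (suc m) op * δ k₀ k ≡
                               + multiplicities Low k (suc m) + δ (suc m) cl * δ k₀ k
    changes′ m k k<l = lem (row (Up ⟦ suc m ⟧) k) (row (Up ⟦ m ⟧) k) (row (Low ⟦ suc m ⟧) k) (row (Low ⟦ m ⟧) k)
      (+ multiplicities Up k (suc m)) (+ multiplicities Low k (suc m)) (δ (suc m) op * δ k₀ k) (δ (suc m) cl * δ k₀ k)
      (row-step Up m k k<l) (row-step Low m k k<l) (rows-raised (suc m) k k<l) (rows-raised m k k<l)
      where
      lem : ∀ u u′ v v′ a b x y → a ≡ u - u′ → b ≡ v - v′ → u ≡ v + y → u′ ≡ v′ + x → a + x ≡ b + y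
      lem _ _ v v′ _ _ x y refl refl refl refl = solve (v ∷ v′ ∷ x ∷ y ∷ [])

    -- The raised term still lies below the next one in row k₀, so an `op` must have been there to
    -- be changed.
    q≥1 : 1 ≤ q k₀
    q≥1 = ℤ.drop‿+≤+ (lem (+ multiplicities Up k₀ op) (+ q k₀) (δ op op) (δ op cl) (δ k₀ k₀)
      (changes′ cl k₀ k₀<l) (δ-≡ op) (δ-≢ (cl≢op ∘ sym)) (δ-≡ k₀) (ℤ.+≤+ z≤n))
      where
      lem : ∀ u v a b d → u + a * d ≡ v + b * d → a ≡ 1ℤ → b ≡ 0ℤ → d ≡ 1ℤ → 0ℤ ℤ.≤ u → 1ℤ ℤ.≤ v
      lem u v _ _ _ eq refl refl refl h = subst (1ℤ ℤ.≤_) (trans eq (ℤ.+-identityʳ v)) (ℤ.+-monoˡ-≤ 1ℤ h)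

    raised⇒wordRaised : WordRaised
    raised⇒wordRaised = record
      { k₀ = k₀ ; k₀<l = k₀<l ; range = range
      ; changes = λ m k _ k<l → changes′ m k k<l
      ; o-below = G⇒O≤ range k₀ (p k₀) λ m m<k₀ →
          subst₂ ℤ._≤_ (score-G m (ℕ.<-trans m<k₀ k₀<l)) (score-G k₀ k₀<l) (lower m m<k₀)
      ; r-above = subst (suc (R range (suc k₀) (l ∸ suc k₀)) ≤_) (ℕ.suc-pred (q k₀) ⦃ ℕ.>-nonZero q≥1 ⦄)
          (s≤s (G⇒R≤ range (suc k₀) (l ∸ suc k₀) (pred (q k₀)) λ m k₀<m m< →
            let m<l = subst (m <_) (ℕ.m+[n∸m]≡n k₀<l) m< in
            lem (G m) (S k₀) (+ p k₀) (+ q k₀) (+ pred (q k₀)) (q-pred (q k₀) q≥1)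
              (subst₂ (λ y z → y + 1ℤ ℤ.≤ z) (score-G m m<l) (score-G k₀ k₀<l) (upper m k₀<m m<l))))
      }
      where
      q-pred : ∀ x → 0 < x → + x ≡ 1ℤ + + pred x
      q-pred (suc x) _ = refl
      lem : ∀ g s p q q′ → q ≡ 1ℤ + q′ → g + 1ℤ ℤ.≤ s + p → g ℤ.≤ s + (p - q) + q′
      lem g s p q q′ eq h = ≤-by (Δ h ⊕ Δ (ℤ.≤-reflexive eq)) (solve (g ∷ s ∷ p ∷ q ∷ q′ ∷ []))

module _ {n l : ℕ} (i : ℕ) (Low Up : Chain n l) where

  open Brackets i

  -- Both operators exchange words u ++ op ∷ t and u ++ cl ∷ t in row k₀ of the
  -- lower and of the raised tableau.
  record Exchange : Set where
    field
      k₀    : ℕ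
      k₀<l  : k₀ < l
      {u t} : Row
      low   : ∀ m → occurrences m (letters Low k₀) ≡ occurrences m (u ++ op ∷ t)
      up    : ∀ m → occurrences m (letters Up k₀) ≡ occurrences m (u ++ cl ∷ t)
      p≡    : op ≤ n → multiplicities Low k₀ cl ≡ r u
      q≡    : op ≤ n → multiplicities Low k₀ op ≡ suc (o t)
      same  : ∀ m → m < l → m ≢ k₀ → letters Up m ≡ letters Low m
      o≡0   : o (concat (applyUpTo (letters Low) k₀) ++ u) ≡ 0
      r≡0   : r (t ++ concat (applyUpTo (from (letters Low) (suc k₀)) (l ∸ suc k₀))) ≡ 0

  exchange⇒wordRaised : Exchange → WordRaised i Low Up
  exchange⇒wordRaised X = record
    { k₀ = k₀ ; k₀<l = k₀<l ; range = range ; changes = changes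
    ; o-below = subst (o Ha ≤_) (sym (p≡ range)) (ℕ.m∸n≡0⇒m≤n (ℕ.m+n≡0⇒n≡0 (o u) (trans (sym (o-++-∸ i Ha u)) o≡0)))
    ; r-above = subst (r Hc <_) (sym (q≡ range))
        (s≤s (ℕ.m∸n≡0⇒m≤n (ℕ.m+n≡0⇒n≡0 (r t) (trans (sym (r-++-∸ i t Hc)) r≡0)))) }
    where
    open Exchange X
    Ha Hc : Row
    Ha = concat (applyUpTo (letters Low) k₀)
    Hc = concat (applyUpTo (from (letters Low) (suc k₀)) (l ∸ suc k₀))
    -- The letter `op` occurs in a row word, and these have letters up to n only.
    range : op ≤ n
    range = ℕ.s≤s⁻¹ (occurrences-seg-bounds (multiplicities Low k₀) 1 n op
      (subst (0 <_) (sym (low op)) (ℤ.drop‿+<+ (subst (+ 0 ℤ.<_) (sym eq) (ℤ.+<+ (s≤s z≤n))))))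
      where
      eq : + occurrences op (u ++ op ∷ t) ≡ + (1 ℕ.+ (occurrences op u ℕ.+ occurrences op t))
      eq = trans (occurrences-middle op u op t) (cong (λ z → z + (+ occurrences op u + + occurrences op t)) (δ-≡ op))
    changes : ∀ m k → m < n → k < l → + multiplicities Up k (suc m) + δ (suc m) op * δ k₀ k ≡
                                      + multiplicities Low k (suc m) + δ (suc m) cl * δ k₀ k
    changes m k m<n k<l with k ℕ.≟ k₀
    ... | no k≢k₀ = lem (+ multiplicities Up k (suc m)) (+ multiplicities Low k (suc m)) (δ (suc m) op) (δ (suc m) cl) (δ k₀ k)
        (cong +_ (trans (sym (occurrences-letters Up k (suc m) (s≤s z≤n) m<n))
          (trans (cong (occurrences (suc m)) (same k k<l k≢k₀)) (occurrences-letters Low k (suc m) (s≤s z≤n) m<n))))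
        (δ-≢ (k≢k₀ ∘ sym))
      where
      lem : ∀ a b x y d → a ≡ b → d ≡ 0ℤ → a + x * d ≡ b + y * d
      lem a _ x y _ refl refl = cong (λ z → a + z) (trans (ℤ.*-zeroʳ x) (sym (ℤ.*-zeroʳ y)))
    ... | yes refl = lem (+ multiplicities Up k (suc m)) (+ multiplicities Low k (suc m)) (δ (suc m) op) (δ (suc m) cl) (δ k k)
        (+ occurrences (suc m) u + + occurrences (suc m) t)
        (trans (cong +_ (trans (sym (occurrences-letters Up k (suc m) (s≤s z≤n) m<n)) (up (suc m)))) (occurrences-middle (suc m) u cl t))
        (trans (cong +_ (trans (sym (occurrences-letters Low k (suc m) (s≤s z≤n) m<n)) (low (suc m)))) (occurrences-middle (suc m) u op t))
        (δ-≡ k)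
      where
      lem : ∀ a b x y d z → a ≡ y + z → b ≡ x + z → d ≡ 1ℤ → a + x * d ≡ b + y * d
      lem _ _ x y _ z refl refl refl = solve (x ∷ y ∷ z ∷ [])

  o-prefix : ∀ v w → o (v ++ w) ≡ 0 → o w ≡ 0
  o-prefix v w eq = ℕ.m+n≡0⇒m≡0 (o w) (trans (sym (o-++-∸ i v w)) eq)

  r-suffix : ∀ v w → r (v ++ w) ≡ 0 → r v ≡ 0
  r-suffix v w eq = ℕ.m+n≡0⇒m≡0 (r v) (trans (sym (r-++-∸ i v w)) eq)

  rowMove-e⇒exchange : RowMove Kind.e i l (letters Low) (letters Up) → Exchange
  rowMove-e⇒exchange M = record
    { k₀ = k₀ ; k₀<l = k₀<l ; u = u ; t = t
    ; low = λ m → cong (occurrences m) old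
    ; up  = λ m → trans (cong (occurrences m) new) (occurrences-sort m (u ++ cl ∷ t))
    ; p≡ = λ range → trans (sym (r-letters i Low Up range Low k₀)) (trans (cong r old)
        (trans (r-++ u ou) (trans (cong (r u ℕ.+_) (trans (r-op t) (cong pred rt))) (ℕ.+-identityʳ (r u)))))
    ; q≡ = λ range → trans (sym (o-letters i Low Up range Low k₀)) (trans (cong o old)
        (trans (o-++-∸ i u (op ∷ t)) (trans (cong (λ z → o (op ∷ t) ℕ.+ (z ∸ r (op ∷ t))) ou)
          (trans (cong (o (op ∷ t) ℕ.+_) (ℕ.0∸n≡0 (r (op ∷ t)))) (trans (ℕ.+-identityʳ _) (o-op₀ t rt))))))
    ; same = same ; o≡0 = o≡0 ; r≡0 = r≡0 }
    where
    open RowMove M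
    ou : o u ≡ 0
    ou = o-prefix (concat (applyUpTo (letters Low) k₀)) u o≡0
    rt : r t ≡ 0
    rt = r-suffix t _ r≡0

  -- Now the lower row is known only after sorting, so its bracket numbers cannot be read off from u
  -- and t; they are found by comparing letter counts with the upper row.
  rowMove-f⇒exchange : RowMove Kind.f i l (letters Up) (letters Low) → Exchange
  rowMove-f⇒exchange M = record
    { k₀ = k₀ ; k₀<l = k₀<l ; u = u ; t = t
    ; low = low
    ; up  = λ m → cong (occurrences m) old
    ; p≡ = λ range → lem-p (multiplicities Low k₀ cl) (r u) (+ occurrences cl u + + occurrences cl t)
        (trans (cong +_ (trans (sym (occurrences-letters Low k₀ cl (s≤s z≤n) (ℕ.<⇒≤ range))) (low cl)))
          (trans (occurrences-middle cl u op t) (cong (λ z → z + (+ occurrences cl u + + occurrences cl t)) (δ-≢ cl≢op′))))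
        (trans (cong +_ (trans (sym (up-p range)) (trans (sym (occurrences-letters Up k₀ cl (s≤s z≤n) (ℕ.<⇒≤ range)))
            (cong (occurrences cl) old))))
          (trans (occurrences-middle cl u cl t) (cong (λ z → z + (+ occurrences cl u + + occurrences cl t)) (δ-≡ cl))))
    ; q≡ = λ range → lem-q (multiplicities Low k₀ op) (o t) (+ occurrences op u + + occurrences op t)
        (trans (cong +_ (trans (sym (occurrences-letters Low k₀ op (s≤s z≤n) range)) (low op)))
          (trans (occurrences-middle op u op t) (cong (λ z → z + (+ occurrences op u + + occurrences op t)) (δ-≡ op))))
        (trans (cong +_ (trans (sym (up-q range)) (trans (sym (occurrences-letters Up k₀ op (s≤s z≤n) range))
            (cong (occurrences op) old))))
          (trans (occurrences-middle op u cl t) (cong (λ z → z + (+ occurrences op u + + occurrences op t)) (δ-≢ (cl≢op′ ∘ sym)))))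
    ; same = λ m m<l m≢k → sym (same m m<l m≢k)
    ; o≡0 = trans (cong (λ z → o (concat z ++ u)) (applyUpTo-cong k₀ λ m m<k → same m (ℕ.<-trans m<k k₀<l) (ℕ.<⇒≢ m<k))) o≡0
    ; r≡0 = trans (cong (λ z → r (t ++ concat z)) (applyUpTo-cong (l ∸ suc k₀) λ m m<d →
          same _ (subst (suc k₀ ℕ.+ m <_) (ℕ.m+[n∸m]≡n k₀<l) (ℕ.+-monoʳ-< (suc k₀) m<d)) (ℕ.<⇒≢ (s≤s (ℕ.m≤m+n k₀ m)) ∘ sym))) r≡0 }
    where
    open RowMove M
    cl≢op′ : cl ≢ op
    cl≢op′ ()
    low : ∀ m → occurrences m (letters Low k₀) ≡ occurrences m (u ++ op ∷ t)
    low m = trans (cong (occurrences m) new) (occurrences-sort m (u ++ op ∷ t))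
    ou : o u ≡ 0
    ou = o-prefix (concat (applyUpTo (letters Up) k₀)) u o≡0
    rt : r t ≡ 0
    rt = r-suffix t _ r≡0
    up-p : op ≤ n → multiplicities Up k₀ cl ≡ suc (r u)
    up-p range = trans (sym (r-letters i Low Up range Up k₀)) (trans (cong r old)
        (trans (r-++ u ou) (trans (cong (r u ℕ.+_) (trans (r-cl t) (cong suc rt))) (ℕ.+-comm (r u) 1))))
    up-q : op ≤ n → multiplicities Up k₀ op ≡ o t
    up-q range = trans (sym (o-letters i Low Up range Up k₀)) (trans (cong o old)
        (trans (o-++-∸ i u (cl ∷ t)) (trans (cong (λ z → o (cl ∷ t) ℕ.+ (z ∸ r (cl ∷ t))) ou)
          (trans (cong (o (cl ∷ t) ℕ.+_) (ℕ.0∸n≡0 (r (cl ∷ t)))) (trans (ℕ.+-identityʳ _) (o-cl t))))))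
    lem-p : ∀ x y z → + x ≡ 0ℤ + z → + suc y ≡ 1ℤ + z → x ≡ y
    lem-p x y z eq eq′ = ℕ.suc-injective (sym (ℤ.+-injective
      (trans eq′ (cong (λ z → 1ℤ + z) (sym (trans eq (ℤ.+-identityˡ z)))))))
    lem-q : ∀ x y z → + x ≡ 1ℤ + z → + y ≡ 0ℤ + z → x ≡ suc y
    lem-q x y z eq eq′ = ℤ.+-injective
      (trans eq (cong (λ z → 1ℤ + z) (sym (trans eq′ (ℤ.+-identityˡ z)))))

  module _ (W : WordRaised i Low Up) where

    open WordRaised W

    private
      m = n ∸ op
      p₀ = multiplicities Low k₀ cl
      q₀ = pred (multiplicities Low k₀ op)
      before after U V Hc : Row
      Hc = concat (applyUpTo (from (letters Low) (suc k₀)) (l ∸ suc k₀))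
      before = seg (multiplicities Low k₀) 1 i
      after  = seg (multiplicities Low k₀) (suc op) m
      -- In a sorted row the acting letter stands between the letters `cl` and `op`: it is the first
      -- `op` of the lower row and the last `cl` of the upper one. One factorisation therefore
      -- serves e and f.
      U = before ++ replicate p₀ cl
      V = replicate q₀ op ++ after

    q₀≡ : multiplicities Low k₀ op ≡ suc q₀
    q₀≡ = sym (ℕ.suc-pred (multiplicities Low k₀ op) ⦃ ℕ.>-nonZero (ℕ.≤-<-trans z≤n r-above) ⦄)

    regroup : ∀ (a b c : Row) x → a ++ b ++ x ∷ c ≡ (a ++ b) ++ x ∷ c
    regroup a b c x = sym (List.++-assoc a b (x ∷ c))

    low-word : letters Low k₀ ≡ U ++ op ∷ V
    low-word = trans (cong (seg (multiplicities Low k₀) 1) (sym (alphabet i Low Up range))) (trans (seg-shape i (multiplicities Low k₀) m)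
      (trans (cong (λ z → before ++ replicate p₀ cl ++ replicate z op ++ after) q₀≡)
             (regroup before (replicate p₀ cl) V op)))

    changed : ∀ x → x < n → + multiplicities Up k₀ (suc x) + δ (suc x) op ≡ + multiplicities Low k₀ (suc x) + δ (suc x) cl
    changed x x<n = lem (+ multiplicities Up k₀ (suc x)) (+ multiplicities Low k₀ (suc x)) (δ (suc x) op) (δ (suc x) cl) (δ k₀ k₀)
        (δ-≡ k₀) (changes x k₀ x<n k₀<l)
      where
      lem : ∀ a b x y d → d ≡ 1ℤ → a + x * d ≡ b + y * d → a + x ≡ b + y
      lem a b x y _ refl eq = trans (cong (λ z → a + z) (sym (ℤ.*-identityʳ x)))
        (trans eq (cong (λ z → b + z) (ℤ.*-identityʳ y)))

    up-other : ∀ x → 1 ≤ x → x ≤ n → x ≢ cl → x ≢ op → multiplicities Up k₀ x ≡ multiplicities Low k₀ x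
    up-other (suc x) _ x≤n x≢cl x≢op = ℤ.+-injective (trans (sym (ℤ.+-identityʳ _))
      (trans (cong (λ z → + multiplicities Up k₀ (suc x) + z) (sym (δ-≢ x≢op)))
        (trans (changed x x≤n) (trans (cong (λ z → + multiplicities Low k₀ (suc x) + z) (δ-≢ x≢cl)) (ℤ.+-identityʳ _)))))

    up-cl : multiplicities Up k₀ cl ≡ suc p₀
    up-cl = ℤ.+-injective (trans (sym (ℤ.+-identityʳ _))
      (trans (cong (λ z → + multiplicities Up k₀ cl + z) (sym (δ-≢ {cl} {op} (λ ()))))
        (trans (changed i (ℕ.<⇒≤ range)) (trans (cong (λ z → + p₀ + z) (δ-≡ cl)) (ℤ.+-comm (+ p₀) 1ℤ)))))

    up-op : multiplicities Up k₀ op ≡ q₀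
    up-op = ℕ.suc-injective (trans (ℤ.+-injective (trans (ℤ.+-comm 1ℤ (+ multiplicities Up k₀ op))
      (trans (cong (λ z → + multiplicities Up k₀ op + z) (sym (δ-≡ op)))
        (trans (changed cl range) (trans (cong (λ z → + multiplicities Low k₀ op + z) (δ-≢ {op} {cl} (λ ()))) (ℤ.+-identityʳ _)))))) q₀≡)

    replicate-snoc : ∀ k (x : ℕ) w → replicate (suc k) x ++ w ≡ replicate k x ++ x ∷ w
    replicate-snoc zero    x w = refl
    replicate-snoc (suc k) x w = cong (x ∷_) (replicate-snoc k x w)

    up-word : letters Up k₀ ≡ U ++ cl ∷ V
    up-word = trans (cong (seg (multiplicities Up k₀) 1) (sym (alphabet i Low Up range))) (trans (seg-shape i (multiplicities Up k₀) m)
      (trans (cong₂ _++_ before≡ (cong₂ _++_ (cong (λ z → replicate z cl) up-cl)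
                (cong₂ _++_ (cong (λ z → replicate z op) up-op) after≡)))
        (trans (cong (before ++_) (replicate-snoc p₀ cl V)) (regroup before (replicate p₀ cl) V cl))))
      where
      before≡ : seg (multiplicities Up k₀) 1 i ≡ before
      before≡ = seg-cong 1 i λ x 1≤x x≤i → up-other x 1≤x
        (ℕ.≤-trans (ℕ.<⇒≤ (ℕ.<-trans x≤i ℕ.≤-refl)) range) (ℕ.<⇒≢ x≤i) (ℕ.<⇒≢ (ℕ.m<n⇒m<1+n x≤i))
      after≡ : seg (multiplicities Up k₀) (suc op) m ≡ after
      after≡ = seg-cong (suc op) m λ x op<x x< → up-other x (ℕ.≤-trans (s≤s z≤n) op<x)
        (subst (x ≤_) (ℕ.m+[n∸m]≡n range) (ℕ.s≤s⁻¹ x<)) (ℕ.<⇒≢ (ℕ.<⇒≤ op<x) ∘ sym) (ℕ.<⇒≢ op<x ∘ sym)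

    unchanged : ∀ k → k < l → k ≢ k₀ → letters Up k ≡ letters Low k
    unchanged k k<l k≢k₀ = seg-cong 1 n eq
      where
      lem : ∀ a b x y d → d ≡ 0ℤ → a + x * d ≡ b + y * d → a ≡ b
      lem a b x y _ refl eq = trans (sym (trans (cong (λ z → a + z) (ℤ.*-zeroʳ x)) (ℤ.+-identityʳ a)))
        (trans eq (trans (cong (λ z → b + z) (ℤ.*-zeroʳ y)) (ℤ.+-identityʳ b)))
      eq : ∀ x → 1 ≤ x → x < suc n → multiplicities Up k x ≡ multiplicities Low k x
      eq (suc x) _ (s≤s x<n) = ℤ.+-injective (lem (+ multiplicities Up k (suc x)) (+ multiplicities Low k (suc x))
        (δ (suc x) op) (δ (suc x) cl) (δ k₀ k) (δ-≢ (k≢k₀ ∘ sym)) (changes x k x<n k<l))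

    r-U : r U ≡ p₀
    r-U = trans (r-neutral i _ (before-neutral i (multiplicities Low k₀) m))
      (trans (cong r (sym (List.++-identityʳ (replicate p₀ cl))))
        (trans (r-replicate-cl i p₀ []) (ℕ.+-identityʳ p₀)))

    o-U : o U ≡ 0
    o-U = trans (o-neutral i _ (before-neutral i (multiplicities Low k₀) m))
      (trans (cong o (sym (List.++-identityʳ (replicate p₀ cl)))) (o-replicate-cl i p₀ []))

    r-V : r V ≡ 0
    r-V = r-replicate-op i q₀ after (r-after i (multiplicities Low k₀) m)

    o-V : o V ≡ q₀
    o-V = trans (o-replicate-op i q₀ after (r-after i (multiplicities Low k₀) m))
      (trans (cong (q₀ ℕ.+_) (o-after i (multiplicities Low k₀) m)) (ℕ.+-identityʳ q₀))

    o-zero : o (concat (applyUpTo (letters Low) k₀) ++ U) ≡ 0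
    o-zero = trans (o-++-∸ i (concat (applyUpTo (letters Low) k₀)) U)
      (cong₂ ℕ._+_ o-U (ℕ.m≤n⇒m∸n≡0 (subst (o (concat (applyUpTo (letters Low) k₀)) ≤_) (sym r-U) o-below)))

    r-zero : r (V ++ Hc) ≡ 0
    r-zero = trans (r-++-∸ i V Hc)
      (cong₂ ℕ._+_ r-V (ℕ.m≤n⇒m∸n≡0 (subst (r Hc ≤_) (sym o-V) (ℕ.s≤s⁻¹ (subst (r Hc <_) q₀≡ r-above)))))

    wordRaised⇒rowMove-e : RowMove Kind.e i l (letters Low) (letters Up)
    wordRaised⇒rowMove-e = record
      { k₀ = k₀ ; k₀<l = k₀<l ; u = U ; t = V ; old = low-word
      ; new = trans (sym (letters-sorted Up k₀)) (cong sort up-word)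
      ; same = unchanged ; o≡0 = o-zero ; r≡0 = r-zero }

    wordRaised⇒rowMove-f : RowMove Kind.f i l (letters Up) (letters Low)
    wordRaised⇒rowMove-f = record
      { k₀ = k₀ ; k₀<l = k₀<l ; u = U ; t = V ; old = up-word
      ; new = trans (sym (letters-sorted Low k₀)) (cong sort low-word)
      ; same = λ k k<l k≢k₀ → sym (unchanged k k<l k≢k₀)
      ; o≡0 = trans (cong (λ z → o (concat z ++ U)) (applyUpTo-cong k₀ λ k k<k₀ →
          unchanged k (ℕ.<-trans k<k₀ k₀<l) (ℕ.<⇒≢ k<k₀))) o-zero
      ; r≡0 = trans (cong (λ z → r (V ++ concat z)) (applyUpTo-cong (l ∸ suc k₀) λ k k<d →
          unchanged _ (subst (suc k₀ ℕ.+ k <_) (ℕ.m+[n∸m]≡n k₀<l) (ℕ.+-monoʳ-< (suc k₀) k<d))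
            (ℕ.<⇒≢ (s≤s (ℕ.m≤m+n k₀ k)) ∘ sym))) r-zero }

Moves : ∀ {n l} → Kind → ℕ → Chain n l → Chain n l → Set
Moves Kind.e i C D = Raised i C D
Moves Kind.f i C D = Raised i D C

module _ {n l : ℕ} {α β γ ε : Sig l} (i : ℕ) (S : SST α β n) (T : SST γ ε n) where

  kashiwara⇒moves : ∀ k → γ ≡ α → kashiwara k n (suc i) (rows S) ≡ just (rows T) →
                    Moves k i (chainOf S) (chainOf T)
  kashiwara⇒moves Kind.e γ≡α eq = wordRaised⇒raised i _ _ (exchange⇒wordRaised i _ _ (rowMove-e⇒exchange i _ _
      (kashiwara⇒rowMove n i l (λ m _ → letters-sorted (chainOf S) m) Kind.e {rows S} {rows T} (reverse-rows S) (reverse-rows T) eq)))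
    (trans (SST.start T) (trans γ≡α (sym (SST.start S))))
  kashiwara⇒moves Kind.f γ≡α eq = wordRaised⇒raised i _ _ (exchange⇒wordRaised i _ _ (rowMove-f⇒exchange i _ _
      (kashiwara⇒rowMove n i l (λ m _ → letters-sorted (chainOf S) m) Kind.f {rows S} {rows T} (reverse-rows S) (reverse-rows T) eq)))
    (trans (SST.start S) (trans (sym γ≡α) (sym (SST.start T))))

  moves⇒kashiwara : ∀ k → Moves k i (chainOf S) (chainOf T) → kashiwara k n (suc i) (rows S) ≡ just (rows T)
  moves⇒kashiwara Kind.e M = rowMove⇒kashiwara n i l (λ m _ → letters-sorted (chainOf S) m) Kind.e {rows S} {rows T}
    (reverse-rows S) (reverse-rows T) (wordRaised⇒rowMove-e i _ _ (raised⇒wordRaised i _ _ M))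
  moves⇒kashiwara Kind.f M = rowMove⇒kashiwara n i l (λ m _ → letters-sorted (chainOf S) m) Kind.f {rows S} {rows T}
    (reverse-rows S) (reverse-rows T) (wordRaised⇒rowMove-f i _ _ (raised⇒wordRaised i _ _ M))

-- Growth diagrams

-- X′ is obtained from X by the local rules on the quadrant, the chains of X
-- being continued by constants; so X′ = cRSK X without a field on the cylinder.
record Forward {n l} (X X′ : Pair n l) : Set where
  field
    grid   : ℕ → ℕ → Sig l
    cells  : ∀ i j → Cell (grid i j) (grid (suc i) j) (grid i (suc j)) (grid (suc i) (suc j))
    P-in   : ∀ i → grid i 0 ≡ chain (P X) i
    Q-in   : ∀ j → grid 0 j ≡ chain (Q X) j
    P-out  : ∀ i → chain (P X′) i ≡ grid i n
    Q-out  : ∀ j → chain (Q X′) j ≡ grid n j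

cell-cong : ∀ {l} {κ κ′ μ μ′ α α′ ν ν′ : Sig l} → κ ≡ κ′ → μ ≡ μ′ → α ≡ α′ → ν ≡ ν′ →
            Cell κ μ α ν → Cell κ′ μ′ α′ ν′
cell-cong refl refl refl refl C = C

module _ {n l} {X X′ X″ : Pair n l} (F : Forward X X′) (F′ : Forward X X″) where

  private
    module F  = Forward F
    module F′ = Forward F′

  grid-unique : ∀ i j → F.grid i j ≡ F′.grid i j
  grid-unique zero    j       = trans (F.Q-in j) (sym (F′.Q-in j))
  grid-unique (suc i) zero    = trans (F.P-in (suc i)) (sym (F′.P-in (suc i)))
  grid-unique (suc i) (suc j) = cell-unique (F.cells i j)
    (cell-cong (sym (grid-unique i j)) (sym (grid-unique (suc i) j)) (sym (grid-unique i (suc j))) refl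
      (F′.cells i j))

  forward-unique : P X′ ≈ P X″ × Q X′ ≈ Q X″
  forward-unique = (λ i → trans (F.P-out i) (trans (grid-unique i n) (sym (F′.P-out i)))) ,
                   (λ j → trans (F.Q-out j) (trans (grid-unique n j) (sym (F′.Q-out j))))

swap : ∀ {n l} → Pair n l → Pair n l
swap (pair P Q) = pair Q P

forward-swap : ∀ {n l} {X X′ : Pair n l} → Forward X X′ → Forward (swap X) (swap X′)
forward-swap F = record
  { grid = λ i j → grid j i ; cells = λ i j → cell-sym (cells j i)
  ; P-in = Q-in ; Q-in = P-in ; P-out = Q-out ; Q-out = P-out }
  where open Forward F

module _ {n l} {X X′ : Pair n l} (F : Forward X X′) where

  open Forward F

  grid-halts-suc : ∀ i j → n ≤ j → grid i (suc j) ≡ grid i j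
  grid-halts-suc zero    j n≤j = trans (Q-in (suc j)) (trans (SST.stop (Q X) (suc j) (ℕ.m≤n⇒m≤1+n n≤j))
    (trans (sym (SST.stop (Q X) j n≤j)) (sym (Q-in j))))
  grid-halts-suc (suc i) j n≤j = cell-unique
    (cell-cong refl refl (grid-halts-suc i j n≤j) refl (cells i j)) (cell-sym (cell-flat (Cell.κ≼μ (cells i j))))

  grid-halts : ∀ i j → n ≤ j → grid i j ≡ grid i n
  grid-halts i j n≤j with ℕ.m≤n⇒m<n∨m≡n n≤j
  ... | inj₂ refl = refl
  grid-halts i (suc j) _ | inj₁ (s≤s n≤j) = trans (grid-halts-suc i j n≤j) (grid-halts i j n≤j)

-- Past n all edges of the diagram are constant, so its edges at m agree with those at n, although
-- the cylinders of circumference n and m differ.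
forward-enlarge : ∀ {n m l} (n≤m : n ≤ m) {X X′ : Pair n l} → Forward X X′ →
                  Forward (enlarge n≤m X) (enlarge n≤m X′)
forward-enlarge {m = m} n≤m F = record
  { grid = grid ; cells = cells ; P-in = P-in ; Q-in = Q-in
  ; P-out = λ i → trans (P-out i) (sym (grid-halts F i m n≤m))
  ; Q-out = λ j → trans (Q-out j) (sym (grid-halts (forward-swap F) j m n≤m)) }
  where open Forward F

-- Reading pairs off a Fomin field

module _ {n l : ℕ} (Λ : FominField n l) where

  open FominField Λ hiding (at)

  Reads : ℤ → ℤ → Pair n l → Set
  Reads x y X = ∀ i → i ≤ n → chain (P X) i ≡ at Λ (x + + i) y × chain (Q X) i ≡ at Λ x (y + + i)

  -- Periodicity with k = -1. It identifies the upper edge of a square of side n with the chain that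
  -- starts at its lower right corner, which is how `cRSK` turns into `Forward`.
  turn : ∀ x y → at Λ (x + + n) y ≡ at Λ x (y + + n)
  turn x y = trans (sym (periodic (ℤ.- 1ℤ) (x + + n) y)) (cong₂ (at Λ) (lem₁ x (+ n)) (lem₂ y (+ n)))
    where
    lem₁ : ∀ x n → x + n + (ℤ.- 1ℤ) * n ≡ x
    lem₁ x n = solve (x ∷ n ∷ [])
    lem₂ : ∀ y n → y - (ℤ.- 1ℤ) * n ≡ y + n
    lem₂ y n = solve (y ∷ n ∷ [])

  clamp-suc : ∀ i → suc i ℕ.⊓ n ≡ suc (i ℕ.⊓ n) ⊎ suc i ℕ.⊓ n ≡ i ℕ.⊓ n
  clamp-suc i with ℕ.<-≤-connex i n
  ... | inj₁ i<n = inj₁ (trans (ℕ.m≤n⇒m⊓n≡m i<n) (cong suc (sym (ℕ.m≤n⇒m⊓n≡m (ℕ.<⇒≤ i<n)))))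
  ... | inj₂ n≤i = inj₂ (trans (ℕ.m≥n⇒m⊓n≡n (ℕ.m≤n⇒m≤1+n n≤i)) (sym (ℕ.m≥n⇒m⊓n≡n n≤i)))

  +-suc : ∀ x i → x + + i + 1ℤ ≡ x + + suc i
  +-suc x i = lem x (+ i)
    where
    lem : ∀ x i → x + i + 1ℤ ≡ x + (1ℤ + i)
    lem x i = solve (x ∷ i ∷ [])

  cell-at : ∀ x y i j → Cell (at Λ (x + + i) (y + + j)) (at Λ (x + + suc i) (y + + j))
                             (at Λ (x + + i) (y + + suc j)) (at Λ (x + + suc i) (y + + suc j))
  cell-at x y i j = cell-cong refl (cong (λ z → at Λ z (y + + j)) (+-suc x i)) (cong (at Λ (x + + i)) (+-suc y j))
    (cong₂ (at Λ) (+-suc x i) (+-suc y j))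
    (fomin-cell (growth₁ _ _) (growth₂ _ _) (growth₂ _ _) (growth₁ _ _) (local (x + + i) (y + + j)))

  module _ (x y : ℤ) where

    -- Clamping at n realises the constant continuation of both chains; the cells beyond the clamp
    -- are flat.
    quadrant : ℕ → ℕ → Sig l
    quadrant i j = at Λ (x + + (i ℕ.⊓ n)) (y + + (j ℕ.⊓ n))

    quadrant-cells : ∀ i j → Cell (quadrant i j) (quadrant (suc i) j) (quadrant i (suc j)) (quadrant (suc i) (suc j))
    quadrant-cells i j with clamp-suc i | clamp-suc j
    ... | inj₁ p | inj₁ q rewrite p | q = cell-at x y (i ℕ.⊓ n) (j ℕ.⊓ n)
    ... | inj₂ p | inj₁ q rewrite p | q = cell-flat (Cell.κ≼α (cell-at x y (i ℕ.⊓ n) (j ℕ.⊓ n)))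
    ... | inj₁ p | inj₂ q rewrite p | q = cell-sym (cell-flat (Cell.κ≼μ (cell-at x y (i ℕ.⊓ n) (j ℕ.⊓ n))))
    ... | inj₂ p | inj₂ q rewrite p | q = cell-flat ≼-refl

    bottom-row : ∀ i → quadrant i 0 ≡ at Λ (x + + (i ℕ.⊓ n)) y
    bottom-row i = cong (at Λ (x + + (i ℕ.⊓ n))) (ℤ.+-identityʳ y)

    left-column : ∀ j → quadrant 0 j ≡ at Λ x (y + + (j ℕ.⊓ n))
    left-column j = cong (λ z → at Λ z (y + + (j ℕ.⊓ n))) (ℤ.+-identityʳ x)

    pairAt : Pair n l
    pairAt = pair {inner = at Λ x y} {outer = at Λ (x + + n) y}
      (record { chain = λ i → at Λ (x + + (i ℕ.⊓ n)) y
              ; start = cong (λ z → at Λ z y) (ℤ.+-identityʳ x)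
              ; step  = λ i → subst₂ _≼_ (bottom-row i) (bottom-row (suc i)) (Cell.κ≼μ (quadrant-cells i 0))
              ; stop  = λ i n≤i → cong (λ z → at Λ (x + + z) y) (ℕ.m≥n⇒m⊓n≡n n≤i) })
      (record { chain = λ i → at Λ x (y + + (i ℕ.⊓ n))
              ; start = cong (at Λ x) (ℤ.+-identityʳ y)
              ; step  = λ j → subst₂ _≼_ (left-column j) (left-column (suc j)) (Cell.κ≼α (quadrant-cells 0 j))
              ; stop  = λ i n≤i → trans (cong (λ z → at Λ x (y + + z)) (ℕ.m≥n⇒m⊓n≡n n≤i)) (sym (turn x y)) })

    reads-pairAt : Reads x y pairAt
    reads-pairAt i i≤n = cong (λ z → at Λ (x + + z) y) (ℕ.m≤n⇒m⊓n≡m i≤n) ,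
                         cong (λ z → at Λ x (y + + z)) (ℕ.m≤n⇒m⊓n≡m i≤n)

    reads-clamped : ∀ {X} → Reads x y X → ∀ i →
      chain (P X) i ≡ at Λ (x + + (i ℕ.⊓ n)) y × chain (Q X) i ≡ at Λ x (y + + (i ℕ.⊓ n))
    reads-clamped {X} R i with ℕ.<-≤-connex i n
    ... | inj₁ i<n = trans (proj₁ (R i (ℕ.<⇒≤ i<n))) (sym (proj₁ (reads-pairAt i (ℕ.<⇒≤ i<n)))) ,
                     trans (proj₂ (R i (ℕ.<⇒≤ i<n))) (sym (proj₂ (reads-pairAt i (ℕ.<⇒≤ i<n))))
    ... | inj₂ n≤i rewrite ℕ.m≥n⇒m⊓n≡n n≤i =
      trans (trans (SST.stop (P X) i n≤i) (sym (SST.stop (P X) n ℕ.≤-refl))) (proj₁ (R n ℕ.≤-refl)) ,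
      trans (trans (SST.stop (Q X) i n≤i) (sym (SST.stop (Q X) n ℕ.≤-refl))) (proj₂ (R n ℕ.≤-refl))

  reads-≈ : ∀ {x y X Y} → Reads x y X → P Y ≈ P X → Q Y ≈ Q X → Reads x y Y
  reads-≈ R p q i i≤n = trans (p i) (proj₁ (R i i≤n)) , trans (q i) (proj₂ (R i i≤n))

  reads⇒forward : ∀ {x y X X′} → Reads x y X → Reads (x + + n) y X′ → Forward X X′
  reads⇒forward {x} {y} {X} {X′} R R′ = record
    { grid  = quadrant x y
    ; cells = quadrant-cells x y
    ; P-in  = λ i → trans (bottom-row x y i) (sym (proj₁ (reads-clamped x y {X} R i)))
    ; Q-in  = λ j → trans (left-column x y j) (sym (proj₂ (reads-clamped x y {X} R j)))
    ; P-out = λ i → trans (proj₁ (reads-clamped (x + + n) y {X′} R′ i))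
        (trans (cong (λ z → at Λ z y) (lem x (+ n) (+ (i ℕ.⊓ n))))
          (trans (turn (x + + (i ℕ.⊓ n)) y) (cong (λ z → at Λ (x + + (i ℕ.⊓ n)) (y + + z)) (sym (ℕ.⊓-idem n)))))
    ; Q-out = λ j → trans (proj₂ (reads-clamped (x + + n) y {X′} R′ j))
        (cong (λ z → at Λ (x + + z) (y + + (j ℕ.⊓ n))) (sym (ℕ.⊓-idem n)))
    }
    where
    lem : ∀ x n i → x + n + i ≡ x + i + n
    lem x n i = solve (x ∷ n ∷ i ∷ [])

  -- The pair read n steps further is one result of the growth, and the result is unique. So images
  -- under `cRSK` are already present in any field that contains the original pair.
  forward⇒reads : ∀ {x y X X′} → Reads x y X → Forward X X′ → Reads (x + + n) y X′
  forward⇒reads {x} {y} {X} {X′} R F with p , q ← forward-unique F (reads⇒forward {X = X} {X′ = pairAt (x + + n) y} R (reads-pairAt (x + + n) y)) =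
    reads-≈ {X = pairAt (x + + n) y} {Y = X′} (reads-pairAt (x + + n) y) p q

  shift : FominField n l
  shift = record
    { at       = λ x y → at Λ (+ n + x) y
    ; periodic = λ k x y → trans (cong (λ z → at Λ z (y - k * + n)) (sym (ℤ.+-assoc (+ n) x (k * + n))))
                                 (periodic k (+ n + x) y)
    ; growth₁  = λ x y → subst (at Λ (+ n + x) y ≼_) (cong (λ z → at Λ z y) (ℤ.+-assoc (+ n) x 1ℤ)) (growth₁ (+ n + x) y)
    ; growth₂  = λ x y → growth₂ (+ n + x) y
    ; local    = λ x y → subst (λ z → FominRule (at Λ (+ n + x) y) (at Λ z y) (at Λ (+ n + x) (y + 1ℤ)) (at Λ z (y + 1ℤ)))
                               (ℤ.+-assoc (+ n) x 1ℤ) (local (+ n + x) y)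
    }

cRSK⇒forward : ∀ {n l} {X X′ : Pair n l} → cRSK X X′ → Forward X X′
cRSK⇒forward {X = X} {X′} (Λ , ext , out) = reads⇒forward Λ {0ℤ} {0ℤ} {X} {X′}
  (λ i i≤n → sym (proj₁ (ext i i≤n)) , sym (proj₂ (ext i i≤n))) out

dx dy : Side → ℤ
dx ① = 1ℤ
dx ② = 0ℤ
dy ① = 0ℤ
dy ② = 1ℤ

module _ {n l : ℕ} where

  ι⇒reads : ∀ s {X Y : Pair n l} → ι s X Y → Σ (FominField n l) λ Λ → Reads Λ 0ℤ 0ℤ X × Reads Λ (dx s) (dy s) Y
  ι⇒reads ① (Λ , ext , out) = Λ , (λ i i≤n → sym (proj₁ (ext i i≤n)) , sym (proj₂ (ext i i≤n))) , out
  ι⇒reads ② (Λ , ext , out) = Λ , (λ i i≤n → sym (proj₁ (ext i i≤n)) , sym (proj₂ (ext i i≤n))) , out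

  -- The graph of `ι` asks for a field that extends the pair from the origin, hence the shift by n.
  reads⇒ι : ∀ s Λ {X Y : Pair n l} → Reads Λ (+ n) 0ℤ X → Reads Λ (dx s + + n) (dy s) Y → ι s X Y
  reads⇒ι s Λ {X} R R′ = go s R′
    where
    ext : Extends (shift Λ) X
    ext i i≤n = sym (proj₁ (R i i≤n)) ,
      trans (cong (λ z → at Λ z (+ i)) (ℤ.+-identityʳ (+ n))) (sym (proj₂ (R i i≤n)))
    lem : ∀ n i → 1ℤ + n + i ≡ n + (1ℤ + i)
    lem n i = solve (n ∷ i ∷ [])
    go : ∀ s {Y : Pair n l} → Reads Λ (dx s + + n) (dy s) Y → ι s X Y
    go ① R′ = shift Λ , ext , λ i i≤n →
      trans (proj₁ (R′ i i≤n)) (cong (λ z → at Λ z 0ℤ) (lem (+ n) (+ i))) ,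
      trans (proj₂ (R′ i i≤n)) (cong (λ z → at Λ z (+ i)) (ℤ.+-comm 1ℤ (+ n)))
    go ② R′ = shift Λ , ext , λ i i≤n →
      proj₁ (R′ i i≤n) ,
      trans (proj₂ (R′ i i≤n)) (cong (λ z → at Λ z (+ suc i)) (sym (ℤ.+-identityʳ (+ n))))

-- Transport of operators through growth diagrams

Mid : ∀ {l} → Kind → (κ₀ κ₁ κ₂ α : Sig l) → Set
Mid Kind.e κ₀ κ₁ κ₂ α = Raises κ₀ κ₁ κ₂ α × κ₀ ≼ α × α ≼ κ₂
Mid Kind.f κ₀ κ₁ κ₂ α = Raises κ₀ α κ₂ κ₁ × κ₀ ≼ α × α ≼ κ₂

-- For f, grow new cells from the lowered middle term. Raising it back reproduces the given cells by
-- uniqueness, so the term grown is the lowering of the given one.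
mid-cell : ∀ k {l} {κ₀ κ₁ κ₂ λ₀ λ₁ λ₂ α : Sig l} → Mid k κ₀ κ₁ κ₂ α → Cell κ₀ κ₁ λ₀ λ₁ → Cell κ₁ κ₂ λ₁ λ₂ →
           ∃[ β ] Mid k λ₀ λ₁ λ₂ β × Cell κ₀ α λ₀ β × Cell α κ₂ β λ₂
mid-cell Kind.e (E , p , q) C₁ C₂ with β , E′ , C₁′ , C₂′ ← cell-raise E p q C₁ C₂ =
  β , (E′ , Cell.μ≼ν (cell-sym C₁′) , Cell.μ≼ν (cell-sym C₂′)) , C₁′ , C₂′
mid-cell Kind.f (E , p , q) C₁ C₂
  with β , C₁′ ← cell-exists p (Cell.κ≼α C₁)
  with γ , C₂′ ← cell-exists q (Cell.μ≼ν C₁′)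
  with β⁺ , E′ , C₁″ , C₂″ ← cell-raise E (Cell.κ≼μ C₁) (Cell.κ≼μ C₂) C₁′ C₂′
  with refl ← cell-unique C₁ C₁″
  with refl ← cell-unique C₂ C₂″ =
  β , (E′ , Cell.μ≼ν (cell-sym C₁′) , Cell.μ≼ν (cell-sym C₂′)) , C₁′ , C₂′

module Transport {n l} {X X′ Y : Pair n l} (F : Forward X X′) (k : Kind) (i : ℕ)
                 (M : Moves k i (chainOf (P X)) (chainOf (P Y))) (Q≈ : Q Y ≈ Q X) where

  open Forward F

  cl op : ℕ
  cl = suc i
  op = suc (suc i)

  range : op ≤ n
  range = go k M
    where
    go : ∀ k → Moves k i (chainOf (P X)) (chainOf (P Y)) → op ≤ n
    go Kind.e M = Raised.range M
    go Kind.f M = Raised.range M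

  others : ∀ m → m ≢ cl → chain (P Y) m ≡ chain (P X) m
  others m m≢cl = go k M
    where
    go : ∀ k → Moves k i (chainOf (P X)) (chainOf (P Y)) → chain (P Y) m ≡ chain (P X) m
    go Kind.e M = Raised.others M m m≢cl
    go Kind.f M = sym (Raised.others M m m≢cl)

  i≢cl : i ≢ cl
  i≢cl = ℕ.<⇒≢ ℕ.≤-refl

  op≢cl : op ≢ cl
  op≢cl = ℕ.<⇒≢ ℕ.≤-refl ∘ sym

  mid-cong : ∀ k {κ₀ κ₀′ κ₁ κ₁′ κ₂ κ₂′ α α′ : Sig l} → κ₀ ≡ κ₀′ → κ₁ ≡ κ₁′ → κ₂ ≡ κ₂′ → α ≡ α′ →
             Mid k κ₀ κ₁ κ₂ α → Mid k κ₀′ κ₁′ κ₂′ α′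
  mid-cong k refl refl refl refl h = h

  first : Mid k (grid i 0) (grid cl 0) (grid op 0) (chain (P Y) cl)
  first = mid-cong k (sym (P-in i)) (sym (P-in cl)) (sym (P-in op)) refl (go k M)
    where
    below : chain (P X) i ≼ chain (P Y) cl
    below = subst (_≼ chain (P Y) cl) (others i i≢cl) (SST.step (P Y) i)
    above : chain (P Y) cl ≼ chain (P X) op
    above = subst (chain (P Y) cl ≼_) (others op op≢cl) (SST.step (P Y) cl)
    go : ∀ k → Moves k i (chainOf (P X)) (chainOf (P Y)) →
         Mid k (chain (P X) i) (chain (P X) cl) (chain (P X) op) (chain (P Y) cl)
    go Kind.e M = Raised.raise M , below , above
    go Kind.f M = subst₂ (λ κ₀ κ₂ → Raises κ₀ (chain (P Y) cl) κ₂ (chain (P X) cl))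
      (others i i≢cl) (others op op≢cl) (Raised.raise M) , below , above

  column : ∀ j → Σ (Sig l) (Mid k (grid i j) (grid cl j) (grid op j))
  column zero    = chain (P Y) cl , first
  column (suc j) with β , mid , _ ← mid-cell k (proj₂ (column j)) (cells i j) (cells cl j) = β , mid

  col : ℕ → Sig l
  col j = proj₁ (column j)

  col-cells : ∀ j → Cell (grid i j) (col j) (grid i (suc j)) (col (suc j)) ×
                    Cell (col j) (grid op j) (col (suc j)) (grid op (suc j))
  col-cells j = proj₂ (proj₂ (mid-cell k (proj₂ (column j)) (cells i j) (cells cl j)))

  grid′ : ℕ → ℕ → Sig l
  grid′ m j with m ℕ.≟ cl
  ... | yes _ = col j
  ... | no _  = grid m j

  grid′-cl : ∀ j → grid′ cl j ≡ col j
  grid′-cl j with cl ℕ.≟ cl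
  ... | yes _ = refl
  ... | no ≢  = contradiction refl ≢

  grid′-≢ : ∀ {m} j → m ≢ cl → grid′ m j ≡ grid m j
  grid′-≢ {m} j m≢cl with m ℕ.≟ cl
  ... | yes m≡cl = contradiction m≡cl m≢cl
  ... | no _     = refl

  cells′ : ∀ m j → Cell (grid′ m j) (grid′ (suc m) j) (grid′ m (suc j)) (grid′ (suc m) (suc j))
  cells′ m j with m ℕ.≟ i
  ... | yes refl = cell-cong (sym (grid′-≢ j i≢cl)) (sym (grid′-cl j))
                     (sym (grid′-≢ (suc j) i≢cl)) (sym (grid′-cl (suc j))) (proj₁ (col-cells j))
  ... | no m≢i with m ℕ.≟ cl
  ...   | yes refl = cell-cong refl (sym (grid′-≢ j op≢cl)) refl (sym (grid′-≢ (suc j) op≢cl)) (proj₂ (col-cells j))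
  ...   | no m≢cl  = cell-cong refl (sym (grid′-≢ j sm≢cl)) refl (sym (grid′-≢ (suc j) sm≢cl)) (cells m j)
    where
    sm≢cl : suc m ≢ cl
    sm≢cl = m≢i ∘ ℕ.suc-injective

  n≢cl : ∀ {m} → n ≤ m → m ≢ cl
  n≢cl n≤m = ℕ.<⇒≢ (ℕ.≤-trans range n≤m) ∘ sym

  Y′ : Pair n l
  Y′ = pair {inner = inner X′} {outer = outer X′}
    (record { chain = λ m → grid′ m n
            ; start = trans (grid′-≢ n (λ ())) (trans (sym (P-out 0)) (SST.start (P X′)))
            ; step  = λ m → Cell.κ≼μ (cells′ m n)
            ; stop  = λ m n≤m → trans (grid′-≢ n (n≢cl n≤m)) (trans (sym (P-out m)) (SST.stop (P X′) m n≤m)) })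
    (Q X′)

  forward : Forward Y Y′
  forward = record
    { grid  = grid′ ; cells = cells′
    ; P-in  = P-in′
    ; Q-in  = λ j → trans (grid′-≢ j (λ ())) (trans (Q-in j) (sym (Q≈ j)))
    ; P-out = λ m → refl
    ; Q-out = λ j → trans (Q-out j) (sym (grid′-≢ j (n≢cl ℕ.≤-refl))) }
    where
    P-in′ : ∀ m → grid′ m 0 ≡ chain (P Y) m
    P-in′ m with m ℕ.≟ cl
    ... | yes refl  = refl
    ... | no m≢cl = trans (P-in m) (sym (others m m≢cl))

  moves : Moves k i (chainOf (P X′)) (chainOf (P Y′))
  moves = go k (proj₂ (column n))
    where
    others′ : ∀ m → m ≢ cl → chain (P Y′) m ≡ chain (P X′) m
    others′ m m≢cl = trans (grid′-≢ n m≢cl) (sym (P-out m))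
    raises-cong : ∀ {κ₀ κ₀′ κ₁ κ₁′ κ₂ κ₂′ α α′ : Sig l} → κ₀ ≡ κ₀′ → κ₁ ≡ κ₁′ → κ₂ ≡ κ₂′ → α ≡ α′ →
                  Raises κ₀ κ₁ κ₂ α → Raises κ₀′ κ₁′ κ₂′ α′
    raises-cong refl refl refl refl h = h
    go : ∀ k → Mid k (grid i n) (grid cl n) (grid op n) (col n) → Moves k i (chainOf (P X′)) (chainOf (P Y′))
    go Kind.e (E , _) = record
      { range = range ; others = others′
      ; raise = raises-cong (sym (P-out i)) (sym (P-out cl)) (sym (P-out op)) (sym (grid′-cl n)) E }
    go Kind.f (E , _) = record
      { range = range ; others = λ m m≢cl → sym (others′ m m≢cl)
      ; raise = raises-cong (sym (grid′-≢ n i≢cl)) (sym (grid′-cl n)) (sym (grid′-≢ n op≢cl)) (sym (P-out cl)) E }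

  on-component : OnComponent ① k (suc i) X′ Y′
  on-component = (refl , moves⇒kashiwara i (P X′) (P Y′) k moves) , λ _ → refl

transport-component : ∀ s k i {n l} {X X′ Y : Pair n l} → Forward X X′ → OnComponent s k (suc i) X Y →
                      ∃[ Y′ ] OnComponent s k (suc i) X′ Y′ × Forward Y Y′
transport-component ① k i {X = X} {Y = Y} F ((inner≡ , eq) , Q≈) = Y′ , on-component , forward
  where open Transport {Y = Y} F k i (kashiwara⇒moves i (P X) (P Y) k inner≡ eq) Q≈
transport-component ② k i {X = X} {Y = Y} F (P≈ , inner≡ , eq) =
  swap Y′ , (proj₂ on-component , proj₁ on-component) , forward-swap forward
  where open Transport {Y = swap Y} (forward-swap F) k i (kashiwara⇒moves i (Q X) (Q Y) k inner≡ eq) P≈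

-- For index 0, the two fields of the hypothesis serve again: each contains, n steps further, the
-- images of the two pairs that it relates, and these are related by the same `ι`.
transport-op : ∀ s k i {n l} {X X′ Y : Pair n l} → Forward X X′ → OnPair s k i X Y →
               ∃[ Y′ ] OnPair s k i X′ Y′ × Forward Y Y′
transport-op s k (suc i) F on = transport-component s k i F on
transport-op s k zero {n} {l} {X} {X′} {Y} F (X₁ , Y₁ , ιX , on , ιY)
  with Λ , R₁ , R ← ι⇒reads s ιX
  with M , S₁ , S ← ι⇒reads s ιY
  with Y₁′ , on′ , F₁ ← transport-component s k 0 (reads⇒forward Λ {X = X₁} {X′ = pairAt Λ (+ n) 0ℤ} R₁ (reads-pairAt Λ (+ n) 0ℤ)) on =
  pairAt M (dx s + + n) (dy s) ,
  (pairAt Λ (+ n) 0ℤ , Y₁′ ,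
    reads⇒ι s Λ {pairAt Λ (+ n) 0ℤ} {X′} (reads-pairAt Λ (+ n) 0ℤ) (forward⇒reads Λ {X = X} {X′ = X′} R F) , on′ ,
    reads⇒ι s M {Y₁′} {pairAt M (dx s + + n) (dy s)} (forward⇒reads M {X = Y₁} {X′ = Y₁′} S₁ F₁) (reads-pairAt M (dx s + + n) (dy s))) ,
  reads⇒forward M {X = Y} {X′ = pairAt M (dx s + + n) (dy s)} S (reads-pairAt M (dx s + + n) (dy s))

forward-≈ : ∀ {n l} {X Y X′ : Pair n l} → P X ≈ P Y → Q X ≈ Q Y → Forward X X′ → Forward Y X′
forward-≈ p q F = record
  { grid = grid ; cells = cells ; P-in = λ i → trans (P-in i) (p i) ; Q-in = λ j → trans (Q-in j) (q j)
  ; P-out = P-out ; Q-out = Q-out }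
  where open Forward F

transport-run : ∀ s {w n l} {X X′ Z : Pair n l} → Forward X X′ → RunOnPair s w X Z →
                ∃[ Z′ ] RunOnPair s w X′ Z′ × Forward Z Z′
transport-run s {X′ = X′} F (RunOnPair.[] p q) =
  X′ , RunOnPair.[] (λ _ → refl) (λ _ → refl) , forward-≈ p q F
transport-run s F (RunOnPair._∷_ {k} {i} on run)
  with Y′ , on′ , F₁ ← transport-op s k i F on
  with Z′ , run′ , F₂ ← transport-run s F₁ run = Z′ , on′ RunOnPair.∷ run′ , F₂

-- Rigged configurations

load : RC → ℕ → ℤ
load rc i = + (2 ℕ.* sum (List.map (ℕ._⊓ i) (List.map proj₁ rc)))

weight : ℕ → ℕ → ℤ
weight s i = + (2 ℕ.* (s ℕ.⊓ i))

load-∷ : ∀ s j rc i → load ((s , j) ∷ rc) i ≡ weight s i + load rc i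
load-∷ s j rc i = trans (cong +_ (ℕ.*-distribˡ-+ 2 (s ℕ.⊓ i) (sum (List.map (ℕ._⊓ i) (List.map proj₁ rc)))))
                        (ℤ.pos-+ (2 ℕ.* (s ℕ.⊓ i)) _)

load-↭ : ∀ {rc rc′} → rc ↭ rc′ → ∀ i → load rc i ≡ load rc′ i
load-↭ p i = cong (λ z → + (2 ℕ.* z)) (sum-↭ (↭ₚ.map⁺ (ℕ._⊓ i) (↭ₚ.map⁺ proj₁ p)))

weight-≤ : ∀ {s i} → i ≤ s → weight (suc s) i ≡ weight s i
weight-≤ i≤s = cong (λ z → + (2 ℕ.* z))
  (trans (ℕ.m≥n⇒m⊓n≡n (ℕ.m≤n⇒m≤1+n i≤s)) (sym (ℕ.m≥n⇒m⊓n≡n i≤s)))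

weight-> : ∀ {s i} → s < i → weight (suc s) i ≡ weight s i + + 2
weight-> {s} {i} s<i = trans (cong (λ z → + (2 ℕ.* z)) (ℕ.m≤n⇒m⊓n≡m s<i))
  (trans (cong +_ (trans (ℕ.*-suc 2 s) (ℕ.+-comm 2 (2 ℕ.* s))))
    (cong (λ z → + (2 ℕ.* z) + + 2) (sym (ℕ.m≤n⇒m⊓n≡m (ℕ.<⇒≤ s<i)))))

strict : ∀ {x y} → x ℤ.≤ y → x ≢ y → x + 1ℤ ℤ.≤ y
strict {x} {y} x≤y x≢y with ≤-or-> y x
... | inj₁ y≤x = contradiction (ℤ.≤-antisym x≤y y≤x) x≢y
... | inj₂ p   = p

-- Strings of length 0 are not listed.
string : ℕ → ℤ → RC
string zero      j = []
string s@(suc _) j = (s , j) ∷ []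

load-string : ∀ s j rc i → load (string s j ++ rc) i ≡ weight s i + load rc i
load-string zero    j rc i = sym (ℤ.+-identityˡ (load rc i))
load-string (suc s) j rc i = load-∷ (suc s) j rc i

-- a is the site before the one that is read.
record Adds (a : ℤ) (X X₁ : RC) : Set where
  field
    s        : ℕ
    {j v}    : ℤ
    {rest}   : RC
    old      : X ↭ string s j ++ rest
    new      : X₁ ↭ (suc s , v) ∷ rest
    singular : j ≡ a - load X s
    longest  : All (λ t → proj₂ t ≡ a - load X (proj₁ t) → proj₁ t ≤ s) X
    rigged   : v ≡ a + 1ℤ - load X₁ (suc s)

Positive : RC → Set
Positive = All (λ t → 1 ≤ proj₁ t)

suc-pred′ : ∀ k → k ≡ ℤ.pred k + 1ℤ
suc-pred′ k = trans (sym (ℤ.suc-pred k)) (ℤ.+-comm 1ℤ (ℤ.pred k))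

-- Creating a string means extending one of length 0, which is not listed; positivity guarantees
-- that `extend` never meets a listed one.
step⇒adds : ∀ {k X X₁} → Positive X → Step k true X X₁ → Adds (ℤ.pred k) X X₁
step⇒adds {k} {X} pos (Step.extend {s = zero} old _ _) with All.head (↭ₚ.All-resp-↭ old pos)
... | ()
step⇒adds {k} {X} pos (Step.extend {s = s@(suc _)} {j} {rest} old sing max) = record
  { s = s ; old = old ; new = ↭-refl ; singular = sing
  ; longest = ↭ₚ.All-resp-↭ (↭-sym old) ((λ _ → ℕ.≤-refl) All.∷ max)
  ; rigged = cong (_- load ((suc s , v) ∷ rest) (suc s)) (suc-pred′ k) }
  where v = vacancy k (suc s ∷ List.map proj₁ rest) (suc s)
step⇒adds {k} {X} pos (Step.create none) = record
  { s = 0 ; j = ℤ.pred k - load X 0 ; old = ↭-refl ; new = ↭-refl ; singular = refl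
  ; longest = All.map (λ ¬sing sing → contradiction sing ¬sing) none
  ; rigged = cong (_- load ((1 , v) ∷ X) 1) (suc-pred′ k) }
  where v = vacancy k (1 ∷ List.map proj₁ X) 1

-- Balls at c consecutive sites from x on: the word written by a carrier that unloads c balls.
data Ones : ℤ → ℕ → RC → RC → Set where
  done : ∀ {x X X′} → X ↭ X′ → Ones x 0 X X′
  more : ∀ {x c X X₁ X′} → Step x true X X₁ → Ones (ℤ.suc x) c X₁ X′ → Ones x (suc c) X X′

pick : ∀ {s j rest m J A} → m < s → string s j ++ rest ↭ string m J ++ A →
       ∃[ A″ ] A ↭ (s , j) ∷ A″ × rest ↭ string m J ++ A″
pick {suc s} {j} {rest} {m} {J} {A} m<s p = go m m<s p
  where
  remove : (suc s , j) ∈ A → ∃[ A″ ] A ↭ (suc s , j) ∷ A″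
  remove x∈A with ys , zs , refl ← ∈ₚ.∈-∃++ x∈A = ys ++ zs , ↭ₚ.shift (suc s , j) ys zs
  go : ∀ m → m < suc s → string (suc s) j ++ rest ↭ string m J ++ A →
       ∃[ A″ ] A ↭ (suc s , j) ∷ A″ × rest ↭ string m J ++ A″
  go zero    _   p = rest , ↭-sym p , ↭-refl
  go (suc m) m<s p with ↭ₚ.∈-resp-↭ p (here refl)
  ... | here refl = contradiction m<s (ℕ.<-irrefl refl)
  ... | there x∈A with A″ , q ← remove x∈A = A″ , q ,
    ↭ₚ.drop-∷ (↭-trans p (↭-trans (Perm.prep _ q) (Perm.swap _ _ ↭-refl)))

drop-string : ∀ s {j rest A} → string s j ++ rest ↭ string s j ++ A → rest ↭ A
drop-string zero    p = p
drop-string (suc s) p = ↭ₚ.drop-∷ p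

suc≡ : ∀ x → ℤ.suc x ≡ ℤ.pred x + + 2
suc≡ x = lem x
  where
  lem : ∀ x → 1ℤ + x ≡ ℤ.- 1ℤ + x + + 2
  lem x = solve (x ∷ [])

+-suc-assoc : ∀ b h → b + + h + 1ℤ ≡ b + + suc h
+-suc-assoc b h = lem b (+ h)
  where
  lem : ∀ b h → b + h + 1ℤ ≡ b + (1ℤ + h)
  lem b h = solve (b ∷ h ∷ [])

positive-string : ∀ m {J A X} → X ↭ string m J ++ A → Positive A → Positive X
positive-string zero    p pos = ↭ₚ.All-resp-↭ (↭-sym p) pos
positive-string (suc m) p pos = ↭ₚ.All-resp-↭ (↭-sym p) (s≤s z≤n All.∷ pos)

-- Compares the strings after h balls with those after one empty site and h + 1
-- balls, both starting from the same strings at site b.  The configurations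
-- string m J ++ A and (m + 1, J′) ∷ A differ in one string, which is the one
-- that grows as long as m = h and rests afterwards.
module Compare (b : ℤ) where

  -- A singular string longer than h draws the next ball to a string at least as long, which is
  -- again singular and long enough afterwards; so the special string never resumes. `bounded` is
  -- carried along for `finish`.
  record Rests (h m : ℕ) (A : RC) (LX : ℕ → ℤ) : Set where
    field
      m<h      : m < h
      {s j}    : _
      member   : (s , j) ∈ A
      long     : h < s
      singular : j ≡ b + + h - LX s
      bounded  : All (λ t → m < proj₁ t → proj₂ t + 1ℤ ℤ.≤ b - LX (proj₁ t) + + proj₁ t) A

  loadX : ℕ → RC → ℕ → ℤ
  loadX m A i = weight m i + load A i

  -- `J-eq` and `J′-eq` say that the special strings have the riggings they received when last
  -- extended, after m and m + 1 balls. The second run is two sites ahead, by the empty site and the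
  -- additional ball.
  record Sim (h m : ℕ) (J J′ : ℤ) (A : RC) : Set where
    field
      J-eq  : J ≡ b - loadX m A m + + m
      J′-eq : J′ ≡ b + + 2 - loadX (suc m) A (suc m) + + m
      pos   : Positive A
      fine  : All (λ t → proj₂ t ℤ.≤ b + + h - loadX m A (proj₁ t)) A
      phase : m ≡ h ⊎ Rests h m A (loadX m A)

  sim-adds : ∀ {h m J J′ A X X₁ Y y} → Sim h m J J′ A → X ↭ string m J ++ A → Y ↭ (suc m , J′) ∷ A →
    Adds (b + + h) X X₁ → ℤ.pred y ≡ b + + h + + 2 →
    ∃[ Y₁ ] Step y true Y Y₁ × ∃[ m₁ ] ∃[ J₁ ] ∃[ J₁′ ] ∃[ A₁ ]
      Sim (suc h) m₁ J₁ J₁′ A₁ × X₁ ↭ string m₁ J₁ ++ A₁ × Y₁ ↭ (suc m₁ , J₁′) ∷ A₁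
  sim-adds {h} {m} {J} {J′} {A} {X} {X₁} {Y} {y} S pX pY D y-eq = decide phase
    where
    open Sim S
    open Adds D
    a = b + + h

    y≡ : y ≡ a + + 2 + 1ℤ
    y≡ = trans (suc-pred′ y) (cong (_+ 1ℤ) y-eq)

    loadX≡ : ∀ i → load X i ≡ loadX m A i
    loadX≡ i = trans (load-↭ pX i) (load-string m J A i)

    loadY≡ : ∀ i → load Y i ≡ loadX (suc m) A i
    loadY≡ i = trans (load-↭ pY i) (load-∷ (suc m) J′ A i)

    -- Two more sites are cancelled by one more cell in a string shorter than i, so both runs see
    -- the same singular strings among those longer than m, up to the special one of the second run.
    same-vacancy : ∀ {i} → m < i → ℤ.pred y - load Y i ≡ a - load X i
    same-vacancy {i} m<i = trans (cong₂ _-_ y-eq (trans (loadY≡ i) (cong (_+ load A i) (weight-> m<i))))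
      (trans (lem a (weight m i) (load A i)) (cong (a -_) (sym (loadX≡ i))))
      where
      lem : ∀ a w l → a + + 2 - (w + + 2 + l) ≡ a - (w + l)
      lem a w l = solve (a ∷ w ∷ l ∷ [])

    in-A : ∀ {R : ℕ × ℤ → Set} → All R X → All R A
    in-A all = All.++⁻ʳ (string m J) (↭ₚ.All-resp-↭ pX all)

    longest-A : All (λ t → proj₂ t ≡ a - load X (proj₁ t) → proj₁ t ≤ s) A
    longest-A = in-A longest

    -- Strings longer than the growing one lose one from their vacancy number, as the site adds 1
    -- and the load 2; strictness pays for this in `fine`.
    not-longer : ∀ t → (proj₂ t ≡ a - load X (proj₁ t) → proj₁ t ≤ s) →
      s < proj₁ t → proj₂ t ℤ.≤ a - loadX m A (proj₁ t) → proj₂ t + 1ℤ ℤ.≤ a - loadX m A (proj₁ t)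
    not-longer t max s<L I≤ = strict I≤ λ eq →
      contradiction (max (trans eq (cong (a -_) (sym (loadX≡ (proj₁ t)))))) (ℕ.<⇒≱ s<L)

    special≤ : m ≡ h → m ≤ s
    special≤ refl = go m refl
      where
      go : ∀ m′ → m′ ≡ m → m′ ≤ s
      go zero     _    = z≤n
      go (suc m′) refl = All.lookup longest (↭ₚ.∈-resp-↭ (↭-sym pX) (here refl))
        (trans J-eq (trans (lem b (loadX m A m) (+ m)) (cong (a -_) (sym (loadX≡ m)))))
        where
        lem : ∀ b l m → b - l + m ≡ b + m - l
        lem b l m = solve (b ∷ l ∷ m ∷ [])

    Result : Set
    Result = ∃[ Y₁ ] Step y true Y Y₁ × ∃[ m₁ ] ∃[ J₁ ] ∃[ J₁′ ] ∃[ A₁ ]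
      Sim (suc h) m₁ J₁ J₁′ A₁ × X₁ ↭ string m₁ J₁ ++ A₁ × Y₁ ↭ (suc m₁ , J₁′) ∷ A₁

    continue : m ≡ h → s ≡ m → Result
    continue refl refl =
      Y₁ , Step.extend pY sing (All.map max longest-A) ,
      suc m , v , v′ , A ,
      record { J-eq = J₁-eq ; J′-eq = J₁′-eq ; pos = pos
             ; fine = All.zipWith (λ {t} (f , g) → fine₁ t f g) (longest-A , fine) ; phase = inj₁ refl } ,
      ↭-trans new (Perm.prep _ rest↭A) , ↭-refl
      where
      -- Singular strings of equal length have equal riggings, so the growing string may be taken to
      -- be the special one.
      j≡J : j ≡ J
      j≡J = trans singular (trans (cong (a -_) (loadX≡ m)) (sym (trans J-eq (lem b (loadX m A m) (+ m)))))
        where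
        lem : ∀ b l m → b - l + m ≡ b + m - l
        lem b l m = solve (b ∷ l ∷ m ∷ [])
      rest↭A : rest ↭ A
      rest↭A = drop-string m (↭-trans (↭-sym old) (subst (λ z → X ↭ string m z ++ A) (sym j≡J) pX))
      v′ = vacancy y (suc (suc m) ∷ List.map proj₁ A) (suc (suc m))
      Y₁ = (suc (suc m) , v′) ∷ A
      sing : J′ ≡ ℤ.pred y - load Y (suc m)
      sing = trans J′-eq (trans (lem b (loadX (suc m) A (suc m)) (+ m)) (sym (cong₂ _-_ y-eq (loadY≡ (suc m)))))
        where
        lem : ∀ b l m → b + + 2 - l + m ≡ b + m + + 2 - l
        lem b l m = solve (b ∷ l ∷ m ∷ [])
      max : ∀ {t} → (proj₂ t ≡ a - load X (proj₁ t) → proj₁ t ≤ m) →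
            proj₂ t ≡ ℤ.pred y - load Y (proj₁ t) → proj₁ t ≤ suc m
      max {t} lng eq with ℕ.≤-<-connex (proj₁ t) (suc m)
      ... | inj₁ L≤ = L≤
      ... | inj₂ L> = ℕ.m≤n⇒m≤1+n (lng (trans eq (same-vacancy (ℕ.<⇒≤ L>))))
      loadX₁ : ∀ i → load X₁ i ≡ loadX (suc m) A i
      loadX₁ i = trans (load-↭ (↭-trans new (Perm.prep _ rest↭A)) i) (load-∷ (suc m) v A i)
      J₁-eq : v ≡ b - loadX (suc m) A (suc m) + + suc m
      J₁-eq = trans rigged (trans (cong (a + 1ℤ -_) (loadX₁ (suc m))) (lem b (+ m) (loadX (suc m) A (suc m))))
        where
        lem : ∀ b m l → b + m + 1ℤ - l ≡ b - l + (1ℤ + m)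
        lem b m l = solve (b ∷ m ∷ l ∷ [])
      J₁′-eq : v′ ≡ b + + 2 - loadX (suc (suc m)) A (suc (suc m)) + + suc m
      J₁′-eq = trans (cong₂ _-_ y≡ (load-∷ (suc (suc m)) v′ A (suc (suc m))))
        (lem b (+ m) (loadX (suc (suc m)) A (suc (suc m))))
        where
        lem : ∀ b m l → b + m + + 2 + 1ℤ - l ≡ b + + 2 - l + (1ℤ + m)
        lem b m l = solve (b ∷ m ∷ l ∷ [])
      fine₁ : ∀ t → (proj₂ t ≡ a - load X (proj₁ t) → proj₁ t ≤ m) → proj₂ t ℤ.≤ a - loadX m A (proj₁ t) →
              proj₂ t ℤ.≤ b + + suc m - loadX (suc m) A (proj₁ t)
      fine₁ t lng I≤ with ℕ.≤-<-connex (proj₁ t) m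
      ... | inj₁ L≤m = lem (proj₂ t) b (+ m) (weight m (proj₁ t)) _ (load A (proj₁ t)) (weight-≤ L≤m) I≤
        where
        lem : ∀ I b h w w′ l → w′ ≡ w → I ℤ.≤ b + h - (w + l) → I ℤ.≤ b + (1ℤ + h) - (w′ + l)
        lem I b h w _ l refl p = ≤-by (Δ p ⊕ 0≤1) (solve (I ∷ b ∷ h ∷ w ∷ l ∷ []))
      ... | inj₂ m<L = lem (proj₂ t) b (+ m) (weight m (proj₁ t)) _ (load A (proj₁ t)) (weight-> m<L) (not-longer t lng m<L I≤)
        where
        lem : ∀ I b h w w′ l → w′ ≡ w + + 2 → I + 1ℤ ℤ.≤ b + h - (w + l) → I ℤ.≤ b + (1ℤ + h) - (w′ + l)
        lem I b h w _ l refl p = ≤-by (Δ p) (solve (I ∷ b ∷ h ∷ w ∷ l ∷ []))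

    -- The ball goes to a string longer than h, the same in both runs, and the special string rests
    -- from now on.
    switch : m ≤ h → h < s →
             All (λ t → m < proj₁ t → proj₂ t + 1ℤ ℤ.≤ b - loadX m A (proj₁ t) + + proj₁ t) A → Result
    switch m≤h h<s bounded with A″ , A↭ , rest↭ ← pick {s} {j} {rest} {m} {J} {A} (ℕ.≤-<-trans m≤h h<s) (↭-trans (↭-sym old) pX) =
      (suc s , vy) ∷ (suc m , J′) ∷ A″ ,
      Step.extend (↭-trans pY (↭-trans (Perm.prep _ A↭) (Perm.swap _ _ ↭-refl)))
        (trans singular (sym (same-vacancy m<s)))
        ((λ _ → m<s) All.∷ All.map max longest-A″) ,
      m , J , J′ , (suc s , v) ∷ A″ ,
      record { J-eq = trans J-eq (cong (λ z → b - (weight m m + z) + + m) (sym (load-low m (ℕ.<⇒≤ m<s))))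
             ; J′-eq = trans J′-eq (cong (λ z → b + + 2 - (weight (suc m) (suc m) + z) + + m) (sym (load-low (suc m) m<s)))
             ; pos = s≤s z≤n All.∷ from-A pos
             ; fine = ℤ.≤-reflexive v≡ All.∷ fine″
             ; phase = inj₂ record
                 { m<h = s≤s m≤h ; member = here refl ; long = s≤s h<s ; singular = v≡
                 ; bounded = bounded-v All.∷ All.zipWith (λ {t} (p , q) → bounded″ t p q) (from-A bounded , fine″) } } ,
      ↭-trans new (↭-trans (Perm.prep _ rest↭) (↭-sym (↭ₚ.shift (suc s , v) (string m J) A″))) ,
      ↭-trans (Perm.swap _ _ ↭-refl) (↭-reflexive (cong (λ z → (suc m , J′) ∷ (suc s , z) ∷ A″) vy≡v))
      where
      m<s : m < s
      m<s = ℕ.≤-<-trans m≤h h<s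
      from-A : ∀ {R : ℕ × ℤ → Set} → All R A → All R A″
      from-A all = All.tail (↭ₚ.All-resp-↭ A↭ all)
      longest-A″ : All (λ t → proj₂ t ≡ a - load X (proj₁ t) → proj₁ t ≤ s) A″
      longest-A″ = from-A longest-A
      max : ∀ {t} → (proj₂ t ≡ a - load X (proj₁ t) → proj₁ t ≤ s) →
            proj₂ t ≡ ℤ.pred y - load Y (proj₁ t) → proj₁ t ≤ s
      max {t} lng eq with ℕ.≤-<-connex (proj₁ t) m
      ... | inj₁ L≤m = ℕ.≤-trans L≤m (ℕ.<⇒≤ m<s)
      ... | inj₂ m<L = lng (trans eq (same-vacancy m<L))
      load-A : ∀ i → load A i ≡ weight s i + load A″ i
      load-A i = trans (load-↭ A↭ i) (load-∷ s j A″ i)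
      load-low : ∀ i → i ≤ s → load ((suc s , v) ∷ A″) i ≡ load A i
      load-low i i≤s = trans (load-∷ (suc s) v A″ i) (trans (cong (_+ load A″ i) (weight-≤ i≤s)) (sym (load-A i)))
      load-high : ∀ i → s < i → load ((suc s , v) ∷ A″) i ≡ load A i + + 2
      load-high i s<i = trans (load-∷ (suc s) v A″ i) (trans (cong (_+ load A″ i) (weight-> s<i))
        (trans (lem (weight s i) (load A″ i)) (cong (_+ + 2) (sym (load-A i)))))
        where
        lem : ∀ w l → w + + 2 + l ≡ w + l + + 2
        lem w l = solve (w ∷ l ∷ [])
      A₁ : RC
      A₁ = (suc s , v) ∷ A″
      loadX₁ : ∀ i → load X₁ i ≡ loadX m A₁ i
      loadX₁ i = trans (load-↭ (↭-trans new (↭-trans (Perm.prep _ rest↭) (↭-sym (↭ₚ.shift (suc s , v) (string m J) A″)))) i)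
        (load-string m J A₁ i)
      v≡ : v ≡ b + + suc h - loadX m A₁ (suc s)
      v≡ = trans rigged (cong₂ _-_ (lem b (+ h)) (loadX₁ (suc s)))
        where
        lem : ∀ b h → b + h + 1ℤ ≡ b + (1ℤ + h)
        lem b h = solve (b ∷ h ∷ [])
      vy = vacancy y (suc s ∷ List.map proj₁ ((suc m , J′) ∷ A″)) (suc s)
      vy≡v : vy ≡ v
      vy≡v = trans (cong₂ _-_ y≡ (trans (load-∷ (suc s) vy ((suc m , J′) ∷ A″) (suc s))
                (cong (λ z → weight (suc s) (suc s) + z) (trans (load-∷ (suc m) J′ A″ (suc s))
                  (cong (_+ load A″ (suc s)) (weight-> (ℕ.m<n⇒m<1+n m<s)))))))
        (trans (lem b (+ h) (weight (suc s) (suc s)) (weight m (suc s)) (load A″ (suc s)))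
          (sym (trans v≡ (cong (λ z → b + + suc h - (weight m (suc s) + z)) (load-∷ (suc s) v A″ (suc s))))))
        where
        lem : ∀ b h w w′ l → b + h + + 2 + 1ℤ - (w + (w′ + + 2 + l)) ≡ b + (1ℤ + h) - (w′ + (w + l))
        lem b h w w′ l = solve (b ∷ h ∷ w ∷ w′ ∷ l ∷ [])
      fine₁ : ∀ t → (proj₂ t ≡ a - load X (proj₁ t) → proj₁ t ≤ s) → proj₂ t ℤ.≤ a - loadX m A (proj₁ t) →
              proj₂ t ℤ.≤ b + + suc h - loadX m A₁ (proj₁ t)
      fine₁ t lng I≤ with ℕ.≤-<-connex (proj₁ t) s
      ... | inj₁ L≤s = lem (proj₂ t) b (+ h) (weight m (proj₁ t)) (load A (proj₁ t)) _ (load-low (proj₁ t) L≤s) I≤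
        where
        lem : ∀ I b h w l l′ → l′ ≡ l → I ℤ.≤ b + h - (w + l) → I ℤ.≤ b + (1ℤ + h) - (w + l′)
        lem I b h w l _ refl p = ≤-by (Δ p ⊕ 0≤1) (solve (I ∷ b ∷ h ∷ w ∷ l ∷ []))
      ... | inj₂ s<L = lem (proj₂ t) b (+ h) (weight m (proj₁ t)) (load A (proj₁ t)) _ (load-high (proj₁ t) s<L) (not-longer t lng s<L I≤)
        where
        lem : ∀ I b h w l l′ → l′ ≡ l + + 2 → I + 1ℤ ℤ.≤ b + h - (w + l) → I ℤ.≤ b + (1ℤ + h) - (w + l′)
        lem I b h w l _ refl p = ≤-by (Δ p) (solve (I ∷ b ∷ h ∷ w ∷ l ∷ []))
      fine″ : All (λ t → proj₂ t ℤ.≤ b + + suc h - loadX m A₁ (proj₁ t)) A″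
      fine″ = All.zipWith (λ {t} (p , q) → fine₁ t p q) (longest-A″ , from-A fine)
      beyond : ∀ I b h l L → I ℤ.≤ b + (1ℤ + h) - l → 1ℤ + (1ℤ + h) ℤ.≤ L → I + 1ℤ ℤ.≤ b - l + L
      beyond I b h l L p q = ≤-by (Δ p ⊕ Δ q) (solve (I ∷ b ∷ h ∷ l ∷ L ∷ []))
      bounded-v : m < suc s → v + 1ℤ ℤ.≤ b - loadX m A₁ (suc s) + + suc s
      bounded-v _ = beyond v b (+ h) (loadX m A₁ (suc s)) (+ suc s) (ℤ.≤-reflexive v≡) (ℤ.+≤+ (s≤s h<s))
      bounded″ : ∀ t → (m < proj₁ t → proj₂ t + 1ℤ ℤ.≤ b - loadX m A (proj₁ t) + + proj₁ t) →
                 proj₂ t ℤ.≤ b + + suc h - loadX m A₁ (proj₁ t) →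
                 m < proj₁ t → proj₂ t + 1ℤ ℤ.≤ b - loadX m A₁ (proj₁ t) + + proj₁ t
      bounded″ t bnd I≤ m<L with ℕ.≤-<-connex (proj₁ t) s
      ... | inj₁ L≤s = subst (λ z → proj₂ t + 1ℤ ℤ.≤ b - (weight m (proj₁ t) + z) + + proj₁ t)
                         (sym (load-low (proj₁ t) L≤s)) (bnd m<L)
      ... | inj₂ s<L = beyond (proj₂ t) b (+ h) (loadX m A₁ (proj₁ t)) (+ proj₁ t) I≤ (ℤ.+≤+ (ℕ.≤-trans (s≤s h<s) s<L))

    decide : m ≡ h ⊎ Rests h m A (loadX m A) → Result
    decide (inj₁ refl) with ℕ.m≤n⇒m<n∨m≡n (special≤ refl)
    ... | inj₂ m≡s = continue refl (sym m≡s)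
    ... | inj₁ m<s = switch ℕ.≤-refl m<s (All.map (λ {t} I≤ m<L → lem (proj₂ t) b (+ m) (loadX m A (proj₁ t)) (+ proj₁ t) I≤ (ℤ.+≤+ m<L)) fine)
      where
      lem : ∀ I b h l L → I ℤ.≤ b + h - l → 1ℤ + h ℤ.≤ L → I + 1ℤ ℤ.≤ b - l + L
      lem I b h l L p q = ≤-by (Δ p ⊕ Δ q) (solve (I ∷ b ∷ h ∷ l ∷ L ∷ []))
    decide (inj₂ R) = switch (ℕ.<⇒≤ R.m<h) (ℕ.<-≤-trans R.long s₀≤s) R.bounded
      where
      module R = Rests R
      s₀≤s : R.s ≤ s
      s₀≤s = All.lookup longest-A R.member (trans R.singular (cong (a -_) (sym (loadX≡ R.s))))

  simulate : ∀ c {h m J J′ A X X′ Y x} → Sim h m J J′ A → X ↭ string m J ++ A → Y ↭ (suc m , J′) ∷ A →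
    ℤ.pred x ≡ b + + h → Positive X → Ones x c X X′ →
    ∃[ Y′ ] Ones (ℤ.suc (ℤ.suc x)) c Y Y′ × ∃[ m₁ ] ∃[ J₁ ] ∃[ J₁′ ] ∃[ A₁ ]
      Sim (h ℕ.+ c) m₁ J₁ J₁′ A₁ × X′ ↭ string m₁ J₁ ++ A₁ × Y′ ↭ (suc m₁ , J₁′) ∷ A₁
  simulate zero {h} {m} {J} {J′} {A} {Y = Y} S pX pY x-eq pos (done p) =
    Y , done ↭-refl , m , J , J′ , A , subst (λ z → Sim z m J J′ A) (sym (ℕ.+-identityʳ h)) S ,
    ↭-trans (↭-sym p) pX , pY
  simulate (suc c) {h} {x = x} S pX pY x-eq pos (more step ones)
    with D ← step⇒adds pos step
    with Y₁ , stepY , m₁ , J₁ , J₁′ , A₁ , S₁ , pX₁ , pY₁ ← sim-adds S pX pY (subst (λ z → Adds z _ _) x-eq D)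
           (trans (ℤ.pred-suc (ℤ.suc x)) (trans (suc≡ x) (cong (_+ + 2) x-eq)))
    with Y′ , onesY , m₂ , J₂ , J₂′ , A₂ , S₂ , pX₂ , pY₂ ← simulate c S₁ pX₁ pY₁
           (trans (ℤ.pred-suc x) (trans (suc-pred′ x) (trans (cong (_+ 1ℤ) x-eq) (+-suc-assoc b h))))
           (positive-string m₁ pX₁ (Sim.pos S₁)) ones
    = Y′ , more stepY onesY , m₂ , J₂ , J₂′ , A₂ ,
      subst (λ z → Sim z m₂ J₂ J₂′ A₂) (sym (ℕ.+-suc h c)) S₂ , pX₂ , pY₂

shiftRC : RC → RC
shiftRC = List.map λ (s , j) → s , j + + s

load-shift : ∀ rc i → load (shiftRC rc) i ≡ load rc i
load-shift rc i = cong (λ z → + (2 ℕ.* sum (List.map (ℕ._⊓ i) z))) (sym (List.map-∘ rc))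

shift-string : ∀ s j rc → shiftRC (string s j ++ rc) ≡ string s (j + + s) ++ shiftRC rc
shift-string zero    j rc = refl
shift-string (suc s) j rc = refl

module _ (b : ℤ) where

  open Compare b

  -- By `J-eq` the special string, with its length subtracted from the rigging, is singular for
  -- `rc`, hence m ≤ s. A longer singular string is excluded by `fine` if the special string grew
  -- with every ball, by `bounded` if it rests. So the ball read by `rc` extends the special string.
  finish : ∀ {c m J J′ A rc rc₂ Y} → Sim c m J J′ A → shiftRC rc ↭ string m J ++ A → Y ↭ (suc m , J′) ∷ A →
           Adds b rc rc₂ → Y ↭ shiftRC rc₂
  finish {c} {m} {J} {J′} {A} {rc} {rc₂} {Y} S pX pY D = ↭-trans pY (↭-trans
      (↭-trans (↭-reflexive (cong (λ z → (suc m , z) ∷ A) J′≡)) (Perm.prep _ (↭-sym rest↭A)))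
      (↭-sym (subst (λ z → shiftRC rc₂ ↭ (suc z , v + + suc z) ∷ shiftRC rest) s≡m (↭ₚ.map⁺ _ new))))
    where
    open Sim S
    open Adds D
    loadX≡ : ∀ i → load rc i ≡ loadX m A i
    loadX≡ i = trans (sym (load-shift rc i)) (trans (load-↭ pX i) (load-string m J A i))
    longest′ : All (λ t → proj₂ t ≡ b - load rc (proj₁ t) + + proj₁ t → proj₁ t ≤ s) (shiftRC rc)
    longest′ = All.map⁺ (All.map (λ {t} lng eq → lng (lem (proj₂ t) (b - load rc (proj₁ t)) (+ proj₁ t) eq)) longest)
      where
      lem : ∀ i v s → i + s ≡ v + s → i ≡ v
      lem i v s eq = trans (lem′ i s) (trans (cong (_- s) eq) (sym (lem′ v s)))
        where
        lem′ : ∀ x s → x ≡ x + s - s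
        lem′ x s = solve (x ∷ s ∷ [])
    m≤s : m ≤ s
    m≤s = go m refl
      where
      go : ∀ m′ → m′ ≡ m → m′ ≤ s
      go zero     _    = z≤n
      go (suc m′) refl = All.lookup longest′ (↭ₚ.∈-resp-↭ (↭-sym pX) (here refl))
        (trans J-eq (cong (λ z → b - z + + m) (sym (loadX≡ m))))
    pS : string s (j + + s) ++ shiftRC rest ↭ string m J ++ A
    pS = ↭-trans (↭-reflexive (sym (shift-string s j rest))) (↭-trans (↭-sym (↭ₚ.map⁺ _ old)) pX)
    j≡ : j + + s ≡ b - loadX m A s + + s
    j≡ = cong (_+ + s) (trans singular (cong (b -_) (loadX≡ s)))
    not-longer : ¬ (m < s)
    not-longer m<s with A″ , A↭ , _ ← pick {s} {j + + s} {shiftRC rest} {m} {J} {A} m<s pS = decide phase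
      where
      member : (s , j + + s) ∈ A
      member = ↭ₚ.∈-resp-↭ (↭-sym A↭) (here refl)
      lem₁ : ∀ x b l c s → x ≡ b - l + s → x ℤ.≤ b + c - l → s ℤ.≤ c
      lem₁ x b l c s eq p = ≤-by (Δ p ⊕ Δ (ℤ.≤-reflexive (sym eq))) (solve (x ∷ b ∷ l ∷ c ∷ s ∷ []))
      decide : m ≡ c ⊎ Rests c m A (loadX m A) → _
      decide (inj₁ refl) = ℕ.<⇒≱ m<s (ℤ.drop‿+≤+ (lem₁ (j + + s) b (loadX m A s) (+ m) (+ s) j≡ (All.lookup fine member)))
      decide (inj₂ R) = ≤-not-> (ℤ.≤-reflexive (sym j≡)) (All.lookup (Rests.bounded R) member m<s)
    s≡m : s ≡ m
    s≡m with ℕ.m≤n⇒m<n∨m≡n m≤s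
    ... | inj₁ m<s = contradiction m<s not-longer
    ... | inj₂ m≡s = sym m≡s
    J≡ : j + + s ≡ J
    J≡ = trans j≡ (trans (cong (λ z → b - loadX m A z + + z) s≡m) (sym J-eq))
    rest↭A : shiftRC rest ↭ A
    rest↭A = drop-string m (subst₂ (λ y z → string y z ++ shiftRC rest ↭ string m J ++ A) s≡m J≡ pS)
    J′≡ : J′ ≡ v + + suc m
    J′≡ = trans J′-eq (trans (lem b (loadX (suc m) A (suc m)) (+ m)) (cong (_+ + suc m) (sym v≡)))
      where
      lem : ∀ b l m → b + + 2 - l + m ≡ b + 1ℤ - l + (1ℤ + m)
      lem b l m = solve (b ∷ l ∷ m ∷ [])
      v≡ : v ≡ b + 1ℤ - loadX (suc m) A (suc m)
      v≡ = trans rigged (trans (cong (λ z → b + 1ℤ - load rc₂ (suc z)) s≡m) (cong (b + 1ℤ -_)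
        (trans (load-↭ new (suc m)) (trans (load-∷ (suc s) v rest (suc m))
          (cong₂ _+_ (cong (λ z → weight (suc z) (suc m)) s≡m)
            (trans (sym (load-shift rest (suc m))) (load-↭ rest↭A (suc m))))))))

Fine : ℤ → RC → Set
Fine a X = All (λ t → proj₂ t ℤ.≤ a - load X (proj₁ t)) X

fine-suc : ∀ {a X} → Fine a X → Fine (a + 1ℤ) X
fine-suc {a} {X} = All.map λ {t} p → lem (proj₂ t) a (load X (proj₁ t)) p
  where
  lem : ∀ I a l → I ℤ.≤ a - l → I ℤ.≤ a + 1ℤ - l
  lem I a l p = ≤-by (Δ p ⊕ 0≤1) (solve (I ∷ a ∷ l ∷ []))

fine-adds : ∀ {a X X₁} → Fine a X → Adds a X X₁ → Fine (a + 1ℤ) X₁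
fine-adds {a} {X} {X₁} fine D = ↭ₚ.All-resp-↭ (↭-sym new)
    (ℤ.≤-reflexive rigged All.∷ All.zipWith (λ {t} (p , q) → fine₁ t p q) (on-rest longest , on-rest fine))
  where
  open Adds D
  on-rest : ∀ {R : ℕ × ℤ → Set} → All R X → All R rest
  on-rest all = All.++⁻ʳ (string s j) (↭ₚ.All-resp-↭ old all)
  loadX : ∀ i → load X i ≡ weight s i + load rest i
  loadX i = trans (load-↭ old i) (load-string s j rest i)
  loadX₁ : ∀ i → load X₁ i ≡ weight (suc s) i + load rest i
  loadX₁ i = trans (load-↭ new i) (load-∷ (suc s) v rest i)
  fine₁ : ∀ t → (proj₂ t ≡ a - load X (proj₁ t) → proj₁ t ≤ s) → proj₂ t ℤ.≤ a - load X (proj₁ t) →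
          proj₂ t ℤ.≤ a + 1ℤ - load X₁ (proj₁ t)
  fine₁ t lng I≤ with ℕ.≤-<-connex (proj₁ t) s
  ... | inj₁ L≤s = lem (proj₂ t) a _ _ (trans (loadX₁ L) (trans (cong (_+ load rest L) (weight-≤ L≤s)) (sym (loadX L)))) I≤
    where
    L = proj₁ t
    lem : ∀ I a l l′ → l′ ≡ l → I ℤ.≤ a - l → I ℤ.≤ a + 1ℤ - l′
    lem I a l _ refl p = ≤-by (Δ p ⊕ 0≤1) (solve (I ∷ a ∷ l ∷ []))
  ... | inj₂ s<L = lem (proj₂ t) a (weight s L) (load rest L) _ _ (loadX L)
      (trans (loadX₁ L) (cong (_+ load rest L) (weight-> s<L)))
      (strict I≤ λ eq → contradiction (lng eq) (ℕ.<⇒≱ s<L))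
    where
    L = proj₁ t
    lem : ∀ I a w r l l′ → l ≡ w + r → l′ ≡ w + + 2 + r → I + 1ℤ ℤ.≤ a - l → I ℤ.≤ a + 1ℤ - l′
    lem I a w r _ _ refl refl p = ≤-by (Δ p) (solve (I ∷ a ∷ w ∷ r ∷ []))

positive-adds : ∀ {a X X₁} → Positive X → Adds a X X₁ → Positive X₁
positive-adds pos D = ↭ₚ.All-resp-↭ (↭-sym new)
    (s≤s z≤n All.∷ All.++⁻ʳ (string s j) (↭ₚ.All-resp-↭ old pos))
  where open Adds D

ones-↭ : ∀ {x c X X′ X″} → Ones x c X X′ → X′ ↭ X″ → Ones x c X X″
ones-↭ (done p)       q = done (↭-trans p q)
ones-↭ (more step os) q = more step (ones-↭ os q)

sim-start : ∀ {k X} → Fine (ℤ.pred k) X → Positive X →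
  Compare.Sim (ℤ.pred k) 0 0 (ℤ.pred k - load X 0) (vacancy (ℤ.suc k) (1 ∷ List.map proj₁ X) 1) X
sim-start {k} {X} fine posX = record
    { J-eq = sym (trans (ℤ.+-identityʳ _) (cong (λ z → b - z) (ℤ.+-identityˡ (load X 0))))
    ; J′-eq = trans (cong₂ _-_ (suc≡ k) (load-∷ 1 J₀ X 1)) (sym (ℤ.+-identityʳ _))
    ; pos = posX
    ; fine = All.map (λ {t} p → lem (proj₂ t) b (load X (proj₁ t)) p) fine
    ; phase = inj₁ refl }
  where
  b = ℤ.pred k
  J₀ = vacancy (ℤ.suc k) (1 ∷ List.map proj₁ X) 1
  lem : ∀ I b l → I ℤ.≤ b - l → I ℤ.≤ b + 0ℤ - (0ℤ + l)
  lem I b l p = ≤-by (Δ p) (solve (I ∷ b ∷ l ∷ []))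

-- After the empty site no string is singular, so the first of the c + 1 balls
-- creates one; the others are compared with the c balls of the given run.
ones-delay : ∀ {k c X rc rc₂} → Fine (ℤ.pred k) X → Positive X → Positive rc →
  Ones k c X (shiftRC rc) → Step k true rc rc₂ → Ones (ℤ.suc k) (suc c) X (shiftRC rc₂)
ones-delay {k} {c} {X} {rc} fine posX posrc ones step
  with Y′ , ones′ , m , J , J′ , A , S , pX , pY ← Compare.simulate (ℤ.pred k) c (sim-start {k} fine posX)
         ↭-refl ↭-refl (sym (ℤ.+-identityʳ (ℤ.pred k))) posX ones =
  more (Step.create (All.map (λ {t} p → none t p) fine))
    (ones-↭ ones′ (finish (ℤ.pred k) S pX pY (step⇒adds posrc step)))
  where
  none : ∀ t → proj₂ t ℤ.≤ ℤ.pred k - load X (proj₁ t) → ¬ (proj₂ t ≡ ℤ.pred (ℤ.suc k) - load X (proj₁ t))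
  none t p eq = ≤-not-> p (ℤ.≤-reflexive (trans (lem (ℤ.pred k) (load X (proj₁ t)))
    (sym (trans eq (cong (_- load X (proj₁ t)) (trans (ℤ.pred-suc k) (suc-pred′ k)))))))
    where
    lem : ∀ a l → a - l + 1ℤ ≡ a + 1ℤ - l
    lem a l = solve (a ∷ l ∷ [])

suc-1 : ∀ s → s ≡ 1ℤ + s - 1ℤ
suc-1 s = solve (s ∷ [])

-- Scanning a box-ball state together with its successor

module Evolution (B B′ : State) (c : ℤ → ℤ)
  (vanishing : ∃[ x₀ ] ∀ x → x ℤ.≤ x₀ → c x ≡ 0ℤ)
  (load-ball : ∀ x → B x ≡ true → c x ≡ c (x - 1ℤ) + 1ℤ)
  (move-on   : ∀ x → B x ≡ false → c x ≡ 0ℤ ⊔ (c (x - 1ℤ) - 1ℤ))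
  (B′-ball   : ∀ x → B x ≡ true → B′ x ≡ false)
  (B′-empty  : ∀ x → B x ≡ false → c (x - 1ℤ) ≡ 0ℤ → B′ x ≡ false)
  (B′-drop   : ∀ x m → B x ≡ false → c (x - 1ℤ) ≡ + suc m → B′ x ≡ true) where

  pred≡ : ∀ x → ℤ.pred x ≡ x - 1ℤ
  pred≡ x = ℤ.+-comm (ℤ.- 1ℤ) x

  idle : ∀ x → B x ≡ false → c (x - 1ℤ) ≡ 0ℤ → c x ≡ 0ℤ
  idle x eq z = trans (move-on x eq) (cong (λ z → 0ℤ ⊔ (z - 1ℤ)) z)

  before : ∀ k → (∀ x → x ℤ.≤ k → B x ≡ false) → ∀ x → x ℤ.≤ k → c x ≡ 0ℤ
  before k empty = from-bound (λ x → x ℤ.≤ k → c x ≡ 0ℤ) (proj₁ vanishing)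
    (λ x x≤ _ → proj₂ vanishing x x≤)
    (λ x h x≤k → idle x (empty x x≤k) (h (ℤ.≤-trans (x-1≤x x) x≤k)))

  after : ∀ s → (∀ x → s ℤ.< x → B x ≡ false) → c s ≡ 0ℤ → ∀ x → s ℤ.≤ x → c x ≡ 0ℤ
  after s empty cs = from-bound (λ x → s ℤ.≤ x → c x ≡ 0ℤ) s
    (λ x x≤s s≤x → trans (cong c (ℤ.≤-antisym x≤s s≤x)) cs)
    (λ x h s≤x → case ≤-or-> x s of λ where
      (inj₁ x≤s) → trans (cong c (ℤ.≤-antisym x≤s s≤x)) cs
      (inj₂ s<x) → idle x (empty x (ℤ.suc[i]≤j⇒i<j (subst (ℤ._≤ x) (ℤ.+-comm s 1ℤ) s<x)))
        (h (≤-by (Δ s<x) (lem s x))))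
    where
    lem : ∀ s x → x - 1ℤ - s ≡ x - (s + 1ℤ)
    lem s x = solve (s ∷ x ∷ [])

  record Delayed (k : ℤ) (rc : RC) : Set where
    field
      {rc′}   : RC
      {load′} : ℕ
      scan    : Scan B′ k rc′
      carried : + load′ ≡ c k
      ones    : Ones (ℤ.suc k) load′ rc′ (shiftRC rc)
      fine    : Fine k rc′
      pos′    : Positive rc′
      pos     : Positive rc

  drop-one : ∀ {k m X X₁} → B k ≡ false → + suc m ≡ c (k - 1ℤ) → Scan B′ (ℤ.pred k) X →
             Fine (ℤ.pred k) X → Positive X → Step k true X X₁ →
             Scan B′ k X₁ × + m ≡ c k × Fine k X₁ × Positive X₁
  drop-one {k} {m} Bk c≡ scan fine pos step =
    Scan.read scan (subst (λ z → Step k z _ _) (sym (B′-drop k m Bk (sym c≡))) step) ,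
    sym (trans (move-on k Bk) (cong (λ z → 0ℤ ⊔ (z - 1ℤ)) (sym c≡))) ,
    subst (λ z → Fine z _) (sym (suc-pred′ k)) (fine-adds fine adds) ,
    positive-adds pos adds
    where adds = step⇒adds pos step

  -- At an empty site the carrier is idle or drops a ball, and the drop is the first step of `ones`.
  -- At a ball it loads, and `ones-delay` restores the invariant.
  read-site : ∀ {k rc rc₂} b → B k ≡ b → Delayed (ℤ.pred k) rc → Step k b rc rc₂ → Delayed k rc₂
  read-site {k} false Bk D Step.empty = go load′ refl
    where
    open Delayed D
    c≡ : + load′ ≡ c (k - 1ℤ)
    c≡ = trans carried (cong c (pred≡ k))
    ones-k : Ones k load′ rc′ _
    ones-k = subst (λ z → Ones z load′ rc′ _) (ℤ.suc-pred k) ones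
    go : ∀ n → load′ ≡ n → Delayed k _
    go zero refl = record
      { scan = Scan.read scan (subst (λ z → Step k z _ _) (sym (B′-empty k Bk (sym c≡))) Step.empty)
      ; carried = sym (idle k Bk (sym c≡))
      ; ones = case ones of λ where (done p) → done p
      ; fine = subst (λ z → Fine z rc′) (sym (suc-pred′ k)) (fine-suc {ℤ.pred k} fine)
      ; pos′ = pos′ ; pos = pos }
    go (suc m) refl with more step rest ← ones-k
      with scan₁ , c₁ , fine₁ , pos₁ ← drop-one Bk c≡ scan fine pos′ step =
      record { scan = scan₁ ; carried = c₁ ; ones = rest ; fine = fine₁ ; pos′ = pos₁ ; pos = pos }
  read-site {k} true Bk D step = record
    { scan = Scan.read scan (subst (λ z → Step k z _ _) (sym (B′-ball k Bk)) Step.empty)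
    ; carried = trans (ℤ.+-comm 1ℤ (+ load′)) (trans (cong (_+ 1ℤ) (trans carried (cong c (pred≡ k)))) (sym (load-ball k Bk)))
    ; ones = ones-delay fine pos′ pos (subst (λ z → Ones z load′ rc′ _) (ℤ.suc-pred k) ones) step
    ; fine = subst (λ z → Fine z rc′) (sym (suc-pred′ k)) (fine-suc {ℤ.pred k} fine)
    ; pos′ = pos′ ; pos = positive-adds pos (step⇒adds pos step) }
    where open Delayed D

  delayed : ∀ {k rc} → Scan B k rc → Delayed k rc
  delayed {k} (Scan.start empty) = record
    { rc′ = [] ; load′ = 0
    ; scan = Scan.start λ x x≤k → B′-empty x (empty x x≤k) (before k empty (x - 1ℤ) (ℤ.≤-trans (x-1≤x x) x≤k))
    ; carried = sym (before k empty k ℤ.≤-refl)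
    ; ones = done ↭-refl ; fine = All.[] ; pos′ = All.[] ; pos = All.[] }
  delayed (Scan.read scan step) = read-site _ refl (delayed scan) step

  -- To the right of all balls of `B` the carrier drops one ball per site until it is empty, which
  -- is the word read by `Ones`.
  unload : ∀ m {s X Z} → (∀ x → s ℤ.< x → B x ≡ false) → + m ≡ c s → Scan B′ s X → Ones (ℤ.suc s) m X Z →
           Fine s X → Positive X →
           ∃[ s′ ] ∃[ X′ ] Scan B′ s′ X′ × (∀ x → s′ ℤ.< x → B′ x ≡ false) × X′ ↭ Z
  unload zero {s} {X} empty cs scan (done p) _ _ = s , X , scan ,
    (λ x s<x → B′-empty x (empty x s<x) (after s empty (sym cs) (x - 1ℤ)
      (≤-by (Δ (ℤ.i<j⇒suc[i]≤j s<x)) (lem s x)))) , p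
    where
    lem : ∀ s x → x - 1ℤ - s ≡ x - (1ℤ + s)
    lem s x = solve (s ∷ x ∷ [])
  unload (suc m) {s} {X} empty cs scan (more step ones) fine pos
    with scan₁ , c₁ , fine₁ , pos₁ ← drop-one {ℤ.suc s} (empty (ℤ.suc s) (ℤ.suc[i]≤j⇒i<j ℤ.≤-refl))
           (trans cs (cong c (suc-1 s))) (subst (λ z → Scan B′ z X) (sym (ℤ.pred-suc s)) scan)
           (subst (λ z → Fine z X) (sym (ℤ.pred-suc s)) fine) pos step =
    unload m (λ x s<x → empty x (ℤ.<-trans (ℤ.suc[i]≤j⇒i<j ℤ.≤-refl) s<x)) c₁ scan₁ ones fine₁ pos₁

-- The box-ball system

multiplicity-conj : ∀ {l} (α : Sig l) x → multiplicity x α ℕ.+ conj α (ℤ.suc x) ≡ conj α x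
multiplicity-conj α x = go (entries α)
  where
  add : Bool → ℕ → ℕ
  add b = if b then suc else (λ n → n)
  go : ∀ {l} (v : Vec ℤ l) →
       Vec.count (x ℤ.≟_) v ℕ.+ Vec.count (ℤ.suc x ℤ.≤?_) v ≡ Vec.count (x ℤ.≤?_) v
  go Vec.[]      = refl
  go (y Vec.∷ v) = step (x ℤ.≟ y) (ℤ.suc x ℤ.≤? y) (x ℤ.≤? y)
    where
    a = Vec.count (x ℤ.≟_) v
    b = Vec.count (ℤ.suc x ℤ.≤?_) v
    c = Vec.count (x ℤ.≤?_) v
    step : (p : Dec (x ≡ y)) (q : Dec (ℤ.suc x ℤ.≤ y)) (r : Dec (x ℤ.≤ y)) →
           add (does p) a ℕ.+ add (does q) b ≡ add (does r) c
    step (yes refl) (yes q) _       = contradiction (ℤ.suc[i]≤j⇒i<j q) (ℤ.<-irrefl refl)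
    step (yes refl) (no _)  (yes _) = cong suc (go v)
    step (yes refl) (no _)  (no r)  = contradiction ℤ.≤-refl r
    step (no _)     (yes _) (yes _) = trans (ℕ.+-suc a b) (cong suc (go v))
    step (no _)     (yes q) (no r)  = contradiction (ℤ.<⇒≤ (ℤ.suc[i]≤j⇒i<j q)) r
    step (no p)     (no q)  (yes r) = contradiction (ℤ.i<j⇒suc[i]≤j (ℤ.≤∧≢⇒< r p)) q
    step (no _)     (no _)  (no _)  = go v

lookup-translate : ∀ μ (J : Vec ℤ (length μ)) i →
                   Vec.lookup (translate μ J) i ≡ Vec.lookup J i + + List.lookup μ i
lookup-translate (m ∷ μ) (j Vec.∷ J) Fin.zero    = refl
lookup-translate (m ∷ μ) (j Vec.∷ J) (Fin.suc i) = lookup-translate μ J i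

shift-zip : ∀ μ (J : Vec ℤ (length μ)) →
            shiftRC (List.zip μ (Vec.toList J)) ≡ List.zip μ (Vec.toList (translate μ J))
shift-zip []      Vec.[]      = refl
shift-zip (m ∷ μ) (j Vec.∷ J) = cong ((m , j + + m) ∷_) (shift-zip μ J)

-- Row coordinates of the rule ν = F̄(κ, α, α) when α/κ is the box-ball state B:
-- then B′ = ν/α is the state after one step with a carrier of infinite capacity.
module BoxBall {l : ℕ} {κ α ν : Sig l} (C : Cell κ α α ν) (B : State)
               (balls : ∀ x → conj α x ≡ conj κ x ℕ.+ bit (B x)) where

  private
    κα = ≼⇒interlaced (Cell.κ≼μ C)
    αν = ≼⇒interlaced (Cell.μ≼ν C)
    module L = Local l (row κ) (row α) (row α) (row ν) κα κα αν αν
    module T = L.ToRule (Cell.rule C)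

  c : ℤ → ℤ
  c = L.potential

  open Rule T.rule

  c≥0 : ∀ x → 0ℤ ℤ.≤ c x
  c≥0 x = subst (0ℤ ℤ.≤_) (sym (recursion x)) (ℤ.i≤i⊔j 0ℤ _)

  count-α : ∀ x → countTo (row α) l x ≡ countTo (row κ) l x + + bit (B x)
  count-α x = trans (sym (conj-countTo α x)) (trans (cong +_ (balls x)) (cong (_+ + bit (B x)) (conj-countTo κ x)))

  -- Both gaps of the rule are the indicator of a ball at x: a ball adds one to the carrier, an
  -- empty site takes one from it if it can.
  carrier : ∀ x → c x ≡ 0ℤ ⊔ (+ bit (B x) + + bit (B x) + c (x - 1ℤ) - 1ℤ)
  carrier x = trans (recursion x) (cong (λ z → 0ℤ ⊔ (z + z + c (x - 1ℤ) - 1ℤ))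
    (trans (cong (_- countTo (row κ) l x) (count-α x)) (lem (countTo (row κ) l x) (+ bit (B x)))))
    where
    lem : ∀ k b → k + b - k ≡ b
    lem k b = solve (k ∷ b ∷ [])

  load-ball : ∀ x → B x ≡ true → c x ≡ c (x - 1ℤ) + 1ℤ
  load-ball x eq = trans (carrier x) (trans (cong (λ z → 0ℤ ⊔ (+ bit z + + bit z + c (x - 1ℤ) - 1ℤ)) eq)
    (trans (cong (0ℤ ⊔_) (lem (c (x - 1ℤ)))) (ℤ.i≤j⇒i⊔j≡j (c≥0 (x - 1ℤ) ⊕ 0≤1))))
    where
    lem : ∀ c → 1ℤ + 1ℤ + c - 1ℤ ≡ c + 1ℤ
    lem c = solve (c ∷ [])

  move-on : ∀ x → B x ≡ false → c x ≡ 0ℤ ⊔ (c (x - 1ℤ) - 1ℤ)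
  move-on x eq = trans (carrier x) (trans (cong (λ z → 0ℤ ⊔ (+ bit z + + bit z + c (x - 1ℤ) - 1ℤ)) eq)
    (cong (λ z → 0ℤ ⊔ (z - 1ℤ)) (ℤ.+-identityˡ (c (x - 1ℤ)))))

  loaded : ℤ → Bool
  loaded x = does (1ℤ ℤ.≤? c x)

  B′ : State
  B′ x = not (B x) ∧ loaded (x - 1ℤ)

  B′-ball : ∀ x → B x ≡ true → B′ x ≡ false
  B′-ball x eq = cong (λ z → not z ∧ loaded (x - 1ℤ)) eq

  loaded-zero : ∀ x → c x ≡ 0ℤ → loaded x ≡ false
  loaded-zero x eq = dec-false (1ℤ ℤ.≤? c x) λ p → 1≰0 (subst (1ℤ ℤ.≤_) eq p)

  B′-empty : ∀ x → B x ≡ false → c (x - 1ℤ) ≡ 0ℤ → B′ x ≡ false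
  B′-empty x eq z = trans (cong (λ z → not z ∧ loaded (x - 1ℤ)) eq) (loaded-zero (x - 1ℤ) z)

  B′-loaded : ∀ x → B x ≡ false → 1ℤ ℤ.≤ c (x - 1ℤ) → B′ x ≡ true
  B′-loaded x eq p = trans (cong (λ z → not z ∧ loaded (x - 1ℤ)) eq) (dec-true (1ℤ ℤ.≤? c (x - 1ℤ)) p)

  B′-drop : ∀ x m → B x ≡ false → c (x - 1ℤ) ≡ + suc m → B′ x ≡ true
  B′-drop x m eq z = B′-loaded x eq (subst (1ℤ ℤ.≤_) (sym z) (ℤ.+≤+ (s≤s z≤n)))

  zero-or-loaded : ∀ x → c x ≡ 0ℤ ⊎ 1ℤ ℤ.≤ c x
  zero-or-loaded x with ≤-or-> (c x) 0ℤ
  ... | inj₁ p = inj₁ (ℤ.≤-antisym p (c≥0 x))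
  ... | inj₂ p = inj₂ p

  exchange : ∀ x → + bit (B x) + c (x - 1ℤ) - c x ≡ + bit (B′ x)
  exchange x = go (B x) refl (zero-or-loaded (x - 1ℤ))
    where
    by-cases : ∀ {b b′} c₀ → B x ≡ b → B′ x ≡ b′ → c x ≡ c₀ → + bit b + c (x - 1ℤ) - c₀ ≡ + bit b′ →
               + bit (B x) + c (x - 1ℤ) - c x ≡ + bit (B′ x)
    by-cases c₀ refl refl refl eq = eq
    go : ∀ b → B x ≡ b → c (x - 1ℤ) ≡ 0ℤ ⊎ 1ℤ ℤ.≤ c (x - 1ℤ) → + bit (B x) + c (x - 1ℤ) - c x ≡ + bit (B′ x)
    go true  eq _ = by-cases _ eq (B′-ball x eq) (load-ball x eq) (lem (c (x - 1ℤ)))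
      where
      lem : ∀ c → 1ℤ + c - (c + 1ℤ) ≡ 0ℤ
      lem c = solve (c ∷ [])
    go false eq (inj₁ z) = by-cases _ eq (B′-empty x eq z) (move-on x eq)
      (cong (λ y → 0ℤ + y - (0ℤ ⊔ (y - 1ℤ))) z)
    go false eq (inj₂ p) = by-cases _ eq (B′-loaded x eq p) (trans (move-on x eq) (ℤ.i≤j⇒i⊔j≡j (Δ p))) (lem (c (x - 1ℤ)))
      where
      lem : ∀ c → 0ℤ + c - (c - 1ℤ) ≡ 1ℤ
      lem c = solve (c ∷ [])

  balls′ : ∀ x → conj ν x ≡ conj α x ℕ.+ bit (B′ x)
  balls′ x = ℤ.+-injective (begin
    + conj ν x                                              ≡⟨ conj-countTo ν x ⟩
    countTo (row ν) l x                                     ≡⟨ conjugate x ⟩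
    #α + #α - #κ + c (x - 1ℤ) - c x                         ≡⟨ cong (λ z → #α + z - #κ + c (x - 1ℤ) - c x) (count-α x) ⟩
    #α + (#κ + + bit (B x)) - #κ + c (x - 1ℤ) - c x         ≡⟨ lem #α #κ (+ bit (B x)) (c (x - 1ℤ)) (c x) ⟩
    #α + (+ bit (B x) + c (x - 1ℤ) - c x)                   ≡⟨ cong₂ _+_ (sym (conj-countTo α x)) (exchange x) ⟩
    + conj α x + + bit (B′ x)                               ∎)
    where
    open ≡-Reasoning
    #α = countTo (row α) l x
    #κ = countTo (row κ) l x
    lem : ∀ a k b c′ c → a + (k + b) - k + c′ - c ≡ a + (b + c′ - c)
    lem a k b c′ c = solve (a ∷ k ∷ b ∷ c′ ∷ c ∷ [])

  -- Equivalent to: `B` has a ball at x and none at x + 1 exactly if `B′` has none at x and one at x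
  -- + 1. Blocks of the new state begin where blocks of the old one end; this is what preserves ν.
  bits : ∀ x → bit (not (B x) ∧ B (ℤ.suc x)) ℕ.+ bit (B x) ≡ bit (B (ℤ.suc x)) ℕ.+ bit (not (B′ x) ∧ B′ (ℤ.suc x))
  bits x = go (B x) refl (B (ℤ.suc x)) refl (zero-or-loaded x)
    where
    Goal : Bool → Bool → Bool → Bool → Set
    Goal a b a′ b′ = bit (not a ∧ b) ℕ.+ bit a ≡ bit b ℕ.+ bit (not a′ ∧ b′)
    by-cases : ∀ {a b a′ b′} → B x ≡ a → B (ℤ.suc x) ≡ b → B′ x ≡ a′ → B′ (ℤ.suc x) ≡ b′ → Goal a b a′ b′ →
               Goal (B x) (B (ℤ.suc x)) (B′ x) (B′ (ℤ.suc x))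
    by-cases refl refl refl refl g = g
    x≡ : ℤ.suc x - 1ℤ ≡ x
    x≡ = sym (suc-1 x)
    go : ∀ a → B x ≡ a → ∀ b → B (ℤ.suc x) ≡ b → c x ≡ 0ℤ ⊎ 1ℤ ℤ.≤ c x →
         Goal (B x) (B (ℤ.suc x)) (B′ x) (B′ (ℤ.suc x))
    go true  ea true  eb _ = by-cases ea eb (B′-ball x ea) (B′-ball (ℤ.suc x) eb) refl
    go true  ea false eb _ = by-cases ea eb (B′-ball x ea)
      (B′-loaded (ℤ.suc x) eb (subst (λ z → 1ℤ ℤ.≤ c z) (sym x≡)
        (subst (1ℤ ℤ.≤_) (sym (load-ball x ea)) (ℤ.+-monoˡ-≤ 1ℤ (c≥0 (x - 1ℤ)))))) refl
    go false ea true  eb _ = by-cases {a′ = B′ x} ea eb refl (B′-ball (ℤ.suc x) eb)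
      (cong (λ z → 1 ℕ.+ bit z) (sym (∧-zeroʳ (not (B′ x)))))
    go false ea false eb (inj₁ z) = by-cases {a′ = B′ x} ea eb refl (B′-empty (ℤ.suc x) eb (trans (cong c x≡) z))
      (cong bit (sym (∧-zeroʳ (not (B′ x)))))
    go false ea false eb (inj₂ p) with zero-or-loaded (x - 1ℤ)
    ... | inj₂ q = by-cases {b′ = B′ (ℤ.suc x)} ea eb (B′-loaded x ea q) refl refl
    ... | inj₁ z = contradiction (subst (1ℤ ℤ.≤_) (trans (move-on x ea) (cong (λ z → 0ℤ ⊔ (z - 1ℤ)) z)) p) 1≰0

  vacuum : ∀ x → multiplicity x κ ℕ.+ bit (B x) ≡ multiplicity x α ℕ.+ bit (B (ℤ.suc x))
  vacuum x = ℕ.+-cancelʳ-≡ (conj κ (ℤ.suc x)) _ _ (begin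
    mκ ℕ.+ bit (B x) ℕ.+ conj κ (ℤ.suc x)                   ≡⟨ swap-last mκ (bit (B x)) _ ⟩
    mκ ℕ.+ conj κ (ℤ.suc x) ℕ.+ bit (B x)                   ≡⟨ cong (ℕ._+ bit (B x)) (multiplicity-conj κ x) ⟩
    conj κ x ℕ.+ bit (B x)                                  ≡⟨ balls x ⟨
    conj α x                                                ≡⟨ multiplicity-conj α x ⟨
    mα ℕ.+ conj α (ℤ.suc x)                                 ≡⟨ cong (mα ℕ.+_) (balls (ℤ.suc x)) ⟩
    mα ℕ.+ (conj κ (ℤ.suc x) ℕ.+ bit (B (ℤ.suc x)))         ≡⟨ ℕ.+-assoc mα _ _ ⟨
    mα ℕ.+ conj κ (ℤ.suc x) ℕ.+ bit (B (ℤ.suc x))           ≡⟨ swap-last mα _ _ ⟩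
    mα ℕ.+ bit (B (ℤ.suc x)) ℕ.+ conj κ (ℤ.suc x)           ∎)
    where
    open ≡-Reasoning
    mκ = multiplicity x κ
    mα = multiplicity x α
    swap-last : ∀ a b c → a ℕ.+ b ℕ.+ c ≡ a ℕ.+ c ℕ.+ b
    swap-last a b c = trans (ℕ.+-assoc a b c) (trans (cong (a ℕ.+_) (ℕ.+-comm b c)) (sym (ℕ.+-assoc a c b)))

  vacuum-step : ∀ x {k} → multiplicity x κ ≡ k ℕ.+ bit (not (B x) ∧ B (ℤ.suc x)) →
                multiplicity x α ≡ k ℕ.+ bit (not (B′ x) ∧ B′ (ℤ.suc x))
  vacuum-step x {k} eq = ℕ.+-cancelʳ-≡ (bit (B (ℤ.suc x))) _ _ (begin
    multiplicity x α ℕ.+ bit (B (ℤ.suc x))                              ≡⟨ vacuum x ⟨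
    multiplicity x κ ℕ.+ bit (B x)                                      ≡⟨ cong (ℕ._+ bit (B x)) eq ⟩
    k ℕ.+ bit (not (B x) ∧ B (ℤ.suc x)) ℕ.+ bit (B x)                   ≡⟨ ℕ.+-assoc k _ _ ⟩
    k ℕ.+ (bit (not (B x) ∧ B (ℤ.suc x)) ℕ.+ bit (B x))                 ≡⟨ cong (k ℕ.+_) (bits x) ⟩
    k ℕ.+ (bit (B (ℤ.suc x)) ℕ.+ bit (not (B′ x) ∧ B′ (ℤ.suc x)))       ≡⟨ cong (k ℕ.+_) (ℕ.+-comm (bit (B (ℤ.suc x))) _) ⟩
    k ℕ.+ (bit (not (B′ x) ∧ B′ (ℤ.suc x)) ℕ.+ bit (B (ℤ.suc x)))       ≡⟨ ℕ.+-assoc k _ _ ⟨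
    k ℕ.+ bit (not (B′ x) ∧ B′ (ℤ.suc x)) ℕ.+ bit (B (ℤ.suc x))         ∎)
    where open ≡-Reasoning

  open Evolution B B′ c vanishing load-ball move-on B′-ball B′-empty B′-drop

  kkr-step : ∀ {μ J} → KKR B μ J → KKR B′ μ (translate μ J)
  kkr-step {μ} {J} K
    with D ← delayed (KKR.scan K)
    with s′ , X′ , scan′ , finished′ , p ← unload (Delayed.load′ D) (KKR.finished K) (Delayed.carried D)
           (Delayed.scan D) (Delayed.ones D) (Delayed.fine D) (Delayed.pos′ D) = record
    { partition = KKR.partition K
    ; ordered = λ i j i+1 μ≡ → subst₂ ℤ._≤_ (sym (lookup-translate μ J j)) (sym (lookup-translate μ J i))
        (ℤ.+-mono-≤ (KKR.ordered K i j i+1 μ≡) (ℤ.≤-reflexive (cong +_ (sym μ≡))))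
    ; scan = scan′
    ; finished = finished′
    ; result = ↭-trans p (↭-trans (↭ₚ.map⁺ _ (KKR.result K)) (↭-reflexive (shift-zip μ J))) }

-- Shifting the field by n changes neither limit. In the second it skips initial terms of the
-- sequence; in the first, periodicity turns it into a shift of t.
solitons-step : ∀ {n l} {X X′ : Pair n l} {μ H₁ H₂} → Forward X X′ → Φ X μ H₁ H₂ → Φ X′ μ H₁ H₂
solitons-step {n} {l} {X} {X′} F Φ₀ = record
  { field-of = shift Λ
  ; extends = λ i i≤n → sym (proj₁ (reads i i≤n)) ,
      trans (cong (λ z → at Λ z (+ i)) (ℤ.+-identityʳ (+ n))) (sym (proj₂ (reads i i≤n)))
  ; partition = partition ; short = short ; hwt₁ = hwt₁ ; hwt₂ = hwt₂
  ; limit₁ = λ j i 1≤i i≤n → case limit₁ j i 1≤i i≤n of λ (T , lim) →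
      T , λ t T≤t → trans (cong₂ (λ α β → (α ‼ j) - (β ‼ j)) (turn′ i t) (turn′ (i ℕ.∸ 1) t))
        (lim (t ℕ.+ n) (ℕ.≤-trans T≤t (ℕ.m≤m+n t n)))
  ; limit₂ = λ j i 1≤i i≤n → case limit₂ j i 1≤i i≤n of λ (T , lim) →
      T , λ t T≤t → lim (n ℕ.+ t) (ℕ.≤-trans T≤t (ℕ.m≤n+m t n))
  }
  where
  open Φ Φ₀
  Λ = field-of
  reads : Reads Λ (+ n) 0ℤ X′
  reads = forward⇒reads Λ {X = X} {X′ = X′} (λ i i≤n → sym (proj₁ (extends i i≤n)) , sym (proj₂ (extends i i≤n))) F
  turn′ : ∀ i t → at Λ (+ n + + i) (+ t) ≡ at Λ (+ i) (+ (t ℕ.+ n))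
  turn′ i t = trans (cong (λ z → at Λ z (+ t)) (ℤ.+-comm (+ n) (+ i))) (turn Λ (+ i) (+ t))

-- Pairs with all labels 1, and the conclusion

module OneLetter {n l} (1≤n : 1 ≤ n) {Z Z′ : Pair n l} (F : Forward Z Z′)
                 (labels₁ : ∀ i → 1 ≤ i → chain (P Z) i ≡ outer Z) where

  open Forward F

  grid-flat : ∀ i j → grid (suc (suc i)) j ≡ grid (suc i) j
  grid-flat i zero    = trans (P-in (suc (suc i))) (trans (labels₁ _ (s≤s z≤n))
    (trans (sym (labels₁ (suc i) (s≤s z≤n))) (sym (P-in (suc i)))))
  grid-flat i (suc j) = cell-unique
    (cell-cong refl (grid-flat i j) refl refl (cells (suc i) j)) (cell-flat (Cell.κ≼α (cells (suc i) j)))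

  grid-one : ∀ {i} j → 1 ≤ i → grid i j ≡ grid 1 j
  grid-one {suc zero}    j _ = refl
  grid-one {suc (suc i)} j _ = trans (grid-flat i j) (grid-one j (s≤s z≤n))

module _ {n l} (1≤n : 1 ≤ n) {Z Z′ : Pair n l} (F : Forward Z Z′)
         (labels₁ : ∀ i → 1 ≤ i → chain (P Z) i ≡ outer Z)
         (labels₂ : ∀ i → 1 ≤ i → chain (Q Z) i ≡ outer Z) where

  open Forward F
  open OneLetter 1≤n F labels₁ using (grid-one)

  grid-one′ : ∀ i {j} → 1 ≤ j → grid i j ≡ grid i 1
  grid-one′ i = OneLetter.grid-one 1≤n (forward-swap F) labels₂ i

  outer′ : outer Z′ ≡ grid 1 1
  outer′ = trans (sym (SST.stop (P Z′) n ℕ.≤-refl)) (trans (P-out n)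
    (trans (grid-one n 1≤n) (grid-one′ 1 1≤n)))

  inner′ : inner Z′ ≡ outer Z
  inner′ = trans (sym (SST.start (P Z′))) (trans (P-out 0) (trans (Q-in n) (labels₂ n 1≤n)))

  labels₁′ : ∀ i → 1 ≤ i → chain (P Z′) i ≡ outer Z′
  labels₁′ i 1≤i = trans (P-out i) (trans (grid-one n 1≤i) (trans (grid-one′ 1 1≤n) (sym outer′)))

  labels₂′ : ∀ i → 1 ≤ i → chain (Q Z′) i ≡ outer Z′
  labels₂′ i 1≤i = trans (Q-out i) (trans (grid-one i 1≤n) (trans (grid-one′ 1 1≤i) (sym outer′)))

  -- Every cell of the diagram of (T , T) except the one at the origin is flat.
  one-cell : Cell (inner Z) (outer Z) (outer Z) (outer Z′)
  one-cell = cell-cong (trans (P-in 0) (SST.start (P Z))) (trans (P-in 1) (labels₁ 1 ℕ.≤-refl))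
    (trans (Q-in 1) (labels₂ 1 ℕ.≤-refl)) (sym outer′) (cells 0 0)

Υcol-step : ∀ {𝓛 n ℓ} → 1 ≤ n → {X X′ : Pair n ℓ} → Forward X X′ → ∀ {μ H₁ H₂ κ m} {ν : Sig m} →
            Υcol 𝓛 X μ H₁ H₂ κ ν → Υcol 𝓛 X′ μ H₁ H₂ (translate μ κ) ν
Υcol-step {n = n} 1≤n {X} {X′} F {μ} {ν = ν} U
  with Y′ , run₁′ , FY ← transport-run ① (forward-enlarge (ℕ.m≤n⊔m (length μ) n) F) (Υcol.run₁ U)
  with Z′ , run₂′ , FZ ← transport-run ② FY (Υcol.run₂ U) = record
  { solitons = solitons-step {X = X} {X′} F solitons
  ; leading₁ = leading₁
  ; leading₂ = leading₂
  ; run₁     = run₁′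
  ; run₂     = run₂′
  ; labels₁  = labels₁′ 1≤n′ FZ labels₁ labels₂
  ; labels₂  = labels₂′ 1≤n′ FZ labels₁ labels₂
  ; B        = BB.B′
  ; balls    = λ x → subst (λ α → conj (outer Z′) x ≡ conj α x ℕ.+ bit (BB.B′ x)) (sym inner≡) (BB.balls′ x)
  ; kkr      = BB.kkr-step kkr
  -- The new J is the old κ = J + μ, so the new κ is κ + μ.
  ; riggings = cong (translate μ) riggings
  ; vacuum   = λ x → subst (λ α → multiplicity x α ≡ multiplicity x ν ℕ.+ bit (not (BB.B′ x) ∧ BB.B′ (ℤ.suc x)))
      (sym inner≡) (BB.vacuum-step x (vacuum x))
  }
  where
  open Υcol U
  1≤n′ : 1 ≤ length μ ℕ.⊔ n
  1≤n′ = ℕ.≤-trans 1≤n (ℕ.m≤n⊔m (length μ) n)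
  inner≡ : inner Z′ ≡ outer Z
  inner≡ = inner′ 1≤n′ FZ labels₁ labels₂
  module BB = BoxBall (one-cell 1≤n′ FZ labels₁ labels₂) B balls

corollary7p4 : (𝓛 : ℕ → Filling → Path) (n ℓ : ℕ) → 1 ≤ n →
    (X X′ : Pair n ℓ) → cRSK X X′ →
    (μ : List ℕ) (H₁ H₂ : Filling) (κ : Vec ℤ (length μ)) (m : ℕ) (ν : Sig m) →
    Υcol 𝓛 X μ H₁ H₂ κ ν →
    Υcol 𝓛 X′ μ H₁ H₂ (translate μ κ) ν
corollary7p4 𝓛 n ℓ 1≤n X X′ cr μ H₁ H₂ κ m ν U = Υcol-step 1≤n (cRSK⇒forward cr) U
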